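{- Assume $\mathbb F$ has characteristic $0$ and $q\in\mathbb F$. Let $\Phi=(A;\{E_i\}_{i=0}^d;A^*;\{E^*_i\}_{i=0}^d)$ be a tridiagonal system on $V$ with $d\geq1$ such that each $E_iV$ and $E^*_iV$ has dimension one, with $\theta_i=q^{2i-d}$ and $\theta^*_i=q^{d-2i}$ ($0\le i\le d$). Regard $V$ as a $U^+_q$-module with $W_0$ acting as $A$, $W_1$ as $A^*$. Let $\xi$, $x_{12}$ be as in the context and $\{r_n\}_{n\in\mathbb N}$ the unique sequence with $r_0=1$ such that $W_{ -n}=r_nx_{12}-q\xi r_{n-1}I$ on $V$ for all $n\in\mathbb N$ ($r_{ -1}=0$). Then the formal power series $R(t)=\sum_{n\in\mathbb N}r_nt^n$ satisfies $$R(t)=\exp\Biggl(\sum_{k=1}^\infty \frac{1+q^{k(d+1)}\xi^k+q^{ -k(d+1)}\xi^k}{q^k+q^{ -k}}\,\frac{q^kt^k}{k}\Biggr).$$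
   Context: $q$ is a nonzero element of $\mathbb F$ that is not a root of unity; $b=q^2$. A TD pair on a nonzero finite-dimensional $\mathbb F$-space $V$ is an ordered pair $A,A^*\in\mathrm{End}(V)$, each diagonalizable, such that for some ordering $\{V_i\}_{i=0}^d$ of the eigenspaces of $A$, $A^*V_i\subseteq V_{i-1}+V_i+V_{i+1}$ ($V_{ -1}=V_{d+1}=0$), for some ordering $\{V^*_i\}$ of the eigenspaces of $A^*$, $AV^*_i\subseteq V^*_{i-1}+V^*_i+V^*_{i+1}$, and no subspace other than $0,V$ is invariant under both; such orderings are standard. A TD system is $(A;\{E_i\};A^*;\{E^*_i\})$ with $A,A^*$ a TD pair and $\{E_i\}$, $\{E^*_i\}$ the primitive idempotents of $A$, $A^*$ in standard orderings. $U^+_q$ is the algebra generated by $W_0,W_1$ with relations $[W_0,[W_0,[W_0,W_1]_b]_{b^{ -1}}]=0$, $[W_1,[W_1,[W_1,W_0]_b]_{b^{ -1}}]=0$ ($[X,Y]=XY-YX$, $[X,Y]_b=bXY-YX$); under the hypotheses $A,A^*$ satisfy these relations. Alternating elements, defined recursively with $G_0=\tilde G_0=1$: for $n\geq1$, $G_n=\frac{\sum_{k=0}^{n-1}W_{ -k}W_{n-k}b^{ -k}-\sum_{k=1}^{n-1}G_k\tilde G_{n-k}b^{ -k}}{1+b^{ -n}}+\frac{[W_n,W_0]}{(1+b^{ -n})(1-b^{ -1})}$, $\tilde G_n=G_n+\frac{[W_0,W_n]}{1-b^{ -1}}$, $W_{ -n}=\frac{[W_0,G_n]_b}{b-1}$,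 $W_{n+1}=\frac{[G_n,W_1]_b}{b-1}$ (order $W_0,W_1,G_1,\tilde G_1,W_{ -1},W_2,G_2,\dots$). $x_{12}=A$, $x_{30}=A^*$; $x_{01}$ acts as $q^{d-2i}$ on $(E^*_{d-i}V+\cdots+E^*_dV)\cap(E_iV+\cdots+E_dV)$ and $x_{23}$ acts as $q^{2i-d}$ on $(E^*_0V+\cdots+E^*_iV)\cap(E_0V+\cdots+E_{d-i}V)$, $0\le i\le d$. $\xi$ is the unique nonzero scalar (known to exist) with $\xi(x_{01}-x_{23})=[x_{30},x_{12}]/(q-q^{ -1})$ and $\xi^{ -1}(x_{12}-x_{30})=[x_{01},x_{23}]/(q-q^{ -1})$. The sequence $\{r_n\}$ exists (Lemma 10.5 of the paper) and is unique. -}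

module Defs where

open import Level using (Level; _⊔_) renaming (suc to lsuc)
open import Algebra.Bundles using (CommutativeRing)
open import Data.Nat as ℕ using (ℕ; zero; suc; _∸_; _≤ᵇ_; _<_)
open import Data.Integer as ℤ using (ℤ; +_; -[1+_]; _⊖_)
open import Data.Fin using (Fin; toℕ) renaming (zero to fzero; suc to fsuc)
open import Data.Bool using (Bool; true; false; if_then_else_)
open import Data.Product using (Σ; ∃; _×_; _,_)
open import Data.Sum using (_⊎_)
open import Relation.Nullary using (¬_)
open import Relation.Binary.PropositionalEquality using (_≡_)

record Field (c ℓ : Level) : Set (lsuc (c ⊔ ℓ)) where
  field
    commutativeRing : CommutativeRing c ℓ
  open CommutativeRing commutativeRing public
  field
    _⁻¹       : Carrier → Carrier
    ⁻¹-inverse : ∀ x → ¬ (x ≈ 0#) → (x * (x ⁻¹)) ≈ 1#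
    0≉1       : ¬ (0# ≈ 1#)

module Over {c ℓ : Level} (F : Field c ℓ) where
  open Field F public

  fromℕ : ℕ → Carrier
  fromℕ zero    = 0#
  fromℕ (suc n) = 1# + fromℕ n

  CharZero : Set ℓ
  CharZero = ∀ n → ¬ (fromℕ (suc n) ≈ 0#)

  pow : Carrier → ℕ → Carrier
  pow x zero    = 1#
  pow x (suc n) = x * pow x n

  zpow : Carrier → ℤ → Carrier
  zpow x (+ n)     = pow x n
  zpow x -[1+ n ]  = pow (x ⁻¹) (suc n)

  NotRootOfUnity : Carrier → Set ℓ
  NotRootOfUnity q = ¬ (q ≈ 0#) × (∀ n → ¬ (pow q (suc n) ≈ 1#))

  fact : ℕ → Carrier
  fact zero    = 1#
  fact (suc n) = fromℕ (suc n) * fact n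

  sumℕ : ℕ → (ℕ → Carrier) → Carrier
  sumℕ zero    f = 0#
  sumℕ (suc n) f = sumℕ n f + f n

  sumF : ∀ {n} → (Fin n → Carrier) → Carrier
  sumF {zero}  f = 0#
  sumF {suc n} f = f fzero + sumF (λ i → f (fsuc i))

  Vect : ℕ → Set c
  Vect N = Fin N → Carrier

  Mat : ℕ → Set c
  Mat N = Fin N → Fin N → Carrier

  module _ {N : ℕ} where
    _≈V_ : Vect N → Vect N → Set ℓ
    u ≈V v = ∀ i → u i ≈ v i

    _≈M_ : Mat N → Mat N → Set ℓ
    M ≈M P = ∀ i j → M i j ≈ P i j

    0V : Vect N
    0V _ = 0#

    _+V_ : Vect N → Vect N → Vect N
    (u +V v) i = u i + v i

    _·V_ : Carrier → Vect N → Vect N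
    (a ·V v) i = a * v i

    sumVF : ∀ {n} → (Fin n → Vect N) → Vect N
    sumVF f i = sumF (λ k → f k i)

    0M : Mat N
    0M _ _ = 0#

    IM : Mat N
    IM i j with i Data.Fin.≟ j
    ... | Relation.Nullary.yes _ = 1#
    ... | Relation.Nullary.no _  = 0#

    _+M_ : Mat N → Mat N → Mat N
    (M +M P) i j = M i j + P i j

    _-M_ : Mat N → Mat N → Mat N
    (M -M P) i j = M i j - P i j

    _·M_ : Carrier → Mat N → Mat N
    (a ·M M) i j = a * M i j

    _⊗_ : Mat N → Mat N → Mat N
    (M ⊗ P) i j = sumF (λ k → M i k * P k j)

    sumMF : ∀ {n} → (Fin n → Mat N) → Mat N
    sumMF f i j = sumF (λ k → f k i j)

    _⊙_ : Mat N → Vect N → Vect N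
    (M ⊙ v) i = sumF (λ k → M i k * v k)

    comm : Mat N → Mat N → Mat N
    comm X Y = (X ⊗ Y) -M (Y ⊗ X)

    commb : Carrier → Mat N → Mat N → Mat N
    commb b X Y = (b ·M (X ⊗ Y)) -M (Y ⊗ X)

    record Subspace (ℓ' : Level) : Set (c ⊔ ℓ ⊔ lsuc ℓ') where
      field
        mem     : Vect N → Set ℓ'
        mem-≈   : ∀ {u v} → u ≈V v → mem u → mem v
        mem-0   : mem 0V
        mem-+   : ∀ {u v} → mem u → mem v → mem (u +V v)
        mem-·   : ∀ a {v} → mem v → mem (a ·V v)

    Invariant : ∀ {ℓ'} → Subspace ℓ' → Mat N → Set (c ⊔ ℓ')
    Invariant W M = ∀ v → Subspace.mem W v → Subspace.mem W (M ⊙ v)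

    NonzeroV : Vect N → Set ℓ
    NonzeroV v = ¬ (v ≈V 0V)

    Irreducible : (ℓ' : Level) → Mat N → Mat N → Set (c ⊔ ℓ ⊔ lsuc ℓ')
    Irreducible ℓ' M P = (W : Subspace ℓ') → Invariant W M → Invariant W P →
      (∃ λ v → Subspace.mem W v × NonzeroV v) → ∀ v → Subspace.mem W v

    ImageDimOne : Mat N → Set (c ⊔ ℓ)
    ImageDimOne M = ∃ λ v → NonzeroV v × (∃ λ u → (M ⊙ u) ≈V v)
                              × (∀ w → ∃ λ a → (M ⊙ w) ≈V (a ·V v))

    InSum : ∀ {n} → (Fin n → Mat N) → (Fin n → Bool) → Vect N → Set (c ⊔ ℓ)
    InSum {n} E sel v = ∃ λ (u : Fin n → Vect N) →
      v ≈V sumVF (λ j → if sel j then E j ⊙ u j else 0V)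

  Far : ∀ {n} → Fin n → Fin n → Set
  Far i j = suc (toℕ i) < toℕ j ⊎ suc (toℕ j) < toℕ i

  record ArePrimitiveIdempotents {N d : ℕ} (A : Mat N) (E : Fin (suc d) → Mat N)
                                 (θ : Fin (suc d) → Carrier) : Set (c ⊔ ℓ) where
    field
      idem      : ∀ i → (E i ⊗ E i) ≈M E i
      orth      : ∀ i j → ¬ (i ≡ j) → (E i ⊗ E j) ≈M 0M
      sum-I     : sumMF E ≈M IM
      nonzero   : ∀ i → ¬ (E i ≈M 0M)
      eigen     : ∀ i → (A ⊗ E i) ≈M (θ i ·M E i)
      distinct  : ∀ i j → ¬ (i ≡ j) → ¬ (θ i ≈ θ j)

  record IsTDSystem {N d : ℕ} (A : Mat N) (E : Fin (suc d) → Mat N)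
                    (As : Mat N) (Es : Fin (suc d) → Mat N)
                    (θ θs : Fin (suc d) → Carrier) (ℓ' : Level)
                    : Set (c ⊔ ℓ ⊔ lsuc ℓ') where
    field
      primA   : ArePrimitiveIdempotents A E θ
      primAs  : ArePrimitiveIdempotents As Es θs
      tridA   : ∀ i j → Far i j → ((E i ⊗ As) ⊗ E j) ≈M 0M
      tridAs  : ∀ i j → Far i j → ((Es i ⊗ A) ⊗ Es j) ≈M 0M
      irred   : Irreducible ℓ' A As

  -- Alternating elements of U^+_q evaluated at W0 ↦ A, W1 ↦ As.
  -- For index n:  Wm = W_{-n},  Wp = W_{n+1},  G = G_n,  Gt = G~_n.

  record Alt (N : ℕ) : Set c where
    constructor alt
    field
      Wm Wp G Gt : Mat N

  module _ {N : ℕ} (b : Carrier) (A As : Mat N) where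
    private
      base : Alt N
      base = alt A As IM IM

      step : ℕ → (ℕ → Alt N) → Alt N
      step n h = alt Wmn Wpn Gn Gtn
        where
          m = suc n
          W- : ℕ → Mat N
          W- k = Alt.Wm (h k)
          W+ : ℕ → Mat N      -- W_{k}, k ≥ 1
          W+ k = Alt.Wp (h (k ∸ 1))
          Gk : ℕ → Mat N
          Gk k = Alt.G (h k)
          Gtk : ℕ → Mat N
          Gtk k = Alt.Gt (h k)
          sumM : ℕ → (ℕ → Mat N) → Mat N
          sumM zero f = 0M
          sumM (suc k) f = sumM k f +M f k
          binv : Carrier
          binv = b ⁻¹
          t1 : Mat N
          t1 = sumM m (λ k → pow binv k ·M (W- k ⊗ W+ (m ∸ k)))
          t2 : Mat N
          t2 = sumM m (λ k → if k ≤ᵇ 0 then 0M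
                              else (pow binv k ·M (Gk k ⊗ Gtk (m ∸ k))))
          Gn : Mat N
          Gn = (((1# + pow binv m) ⁻¹) ·M (t1 -M t2))
               +M ((((1# + pow binv m) * (1# - binv)) ⁻¹) ·M comm (W+ m) A)
          Gtn : Mat N
          Gtn = Gn +M (((1# - binv) ⁻¹) ·M comm A (W+ m))
          Wmn : Mat N
          Wmn = ((b - 1#) ⁻¹) ·M commb b A Gn
          Wpn : Mat N
          Wpn = ((b - 1#) ⁻¹) ·M commb b Gn As

      hist : ℕ → (ℕ → Alt N)
      hist zero    = λ _ → base
      hist (suc n) = λ k → if k ≤ᵇ n then hist n k else step n (hist n)

    altElems : ℕ → Alt N
    altElems n = hist n n

    Wneg : ℕ → Mat N
    Wneg n = Alt.Wm (altElems n)

  PowerSeries : Set c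
  PowerSeries = ℕ → Carrier

  _*PS_ : PowerSeries → PowerSeries → PowerSeries
  (f *PS g) n = sumℕ (suc n) (λ i → f i * g (n ∸ i))

  onePS : PowerSeries
  onePS zero    = 1#
  onePS (suc _) = 0#

  powPS : PowerSeries → ℕ → PowerSeries
  powPS S zero    = onePS
  powPS S (suc m) = S *PS powPS S m

  -- exp(S) = Σ_m S^m / m!  for S with zero constant term; the coefficient of
  -- t^n only receives contributions from m ≤ n (S^m has order ≥ m).
  expPS : PowerSeries → PowerSeries
  expPS S n = sumℕ (suc n) (λ m → (fact m ⁻¹) * powPS S m n)

  rPrev : (ℕ → Carrier) → ℕ → Carrier
  rPrev r zero    = 0#
  rPrev r (suc m) = r m

  expoSeries : Carrier → ℕ → Carrier → PowerSeries
  expoSeries q d ξ zero    = 0#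
  expoSeries q d ξ (suc m) =
    ((1# + (pow q (k ℕ.* suc d) * pow ξ k)) + (pow (q ⁻¹) (k ℕ.* suc d) * pow ξ k))
    * ((pow q k + pow (q ⁻¹) k) ⁻¹)
    * (pow q k * (fromℕ k ⁻¹))
    where k = suc m

{-# OPTIONS --safe #-}
-- On V the alternating elements turn out to be G_n = r_n - q ξ r_{n-1} x₂₃, G̃_n = r_n - q ξ r_{n-1} x₀₁ and
-- W_{n+1} = r_n A* - q ξ r_{n-1}. Their defining recursion then says R(t) R(t/b) P(t) = 1, where P(t) collects
-- the scalars by which ξ(q⁻¹x₂₃ + q x₀₁) + A A* and ξ x₂₃x₀₁ + q A + q⁻¹A* act on V; these operators are
-- scalar because they commute with A and A*. The eigenvalues are read off the split basis u_{i+1} = (A - θ_i) u_i,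
-- on which A* acts by A* u_i = θ_i u_i + φ_i u_{i-1}: the condition φ_{d+1} = 0 gives
-- P(t) = (1 - t)(1 - ξ q^{d+1} t)(1 - ξ q^{-d-1} t). Finally, t d/dt turns the exponential into a series with
-- the same property, and R(t) R(t/b) determines R(t) since 1 + b^{-n} ≠ 0.
module Submission where

open import Defs
open import Level using (_⊔_; Lift; lift; lower)
open import Algebra.Bundles using (CommutativeRing)
open import Algebra.Bundles.Raw using (RawRing)
open import Algebra.Solver.Ring.AlmostCommutativeRing using (fromCommutativeRing; _-Raw-AlmostCommutative⟶_)
import Algebra.Solver.Ring as RingSolver
import Algebra.Properties.Ring as RingProperties
import Algebra.Properties.AbelianGroup as AbelianGroupProperties
import Algebra.Properties.Group as GroupProperties
import Algebra.Properties.Semiring.Mult.TCOptimised as Multiples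
open import Data.Bool using (Bool; true; false; if_then_else_)
open import Data.Fin as Fin using (Fin; toℕ; fromℕ<) renaming (zero to fzero; suc to fsuc)
import Data.Fin.Properties as Finₚ
open import Data.Integer as ℤ using (ℤ; +_; -[1+_]; _⊖_)
import Data.Integer.Properties as ℤₚ
open import Data.Maybe using (Maybe; just; nothing)
open import Data.Nat as ℕ using (ℕ; zero; suc; _≤_; _<_; z≤n; s≤s; _∸_; _≤ᵇ_; _<ᵇ_)
import Data.Nat.Properties as ℕₚ
open import Data.Product using (_×_; _,_; proj₁; proj₂; ∃)
open import Data.Sum using (_⊎_; inj₁; inj₂)
open import Function using (_∘_)
open import Relation.Nullary using (¬_; yes; no; contradiction)
open import Relation.Binary.PropositionalEquality as ≡ using (_≡_)
import Relation.Binary.Reasoning.Setoid as SetoidReasoning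

-- Equality in F is not assumed decidable, so bases and dimension counts are avoided. Statements
-- about all of V are obtained from a subspace that is invariant under A and A* and contains a
-- nonzero vector: the span of a family preserved by both operators, or the equalizer of two
-- operators. Irreducibility makes it everything.
--
-- The operator x₀₁ has eigenvalue q^(d-2n) on the split space U n, where A - θ_n raises n and A* -
-- θ_n lowers it. This yields q-Weyl relations of x₀₁ with A and A*. Those of x₂₃ come from the same
-- construction with both orderings reversed and q replaced by its inverse.
--
-- The recursion alone gives the claimed value of G_n only up to an unknown scalar multiple of the
-- identity. Inserting it in W_(-n) and comparing with the hypothesis on r_n shows that this scalar
-- vanishes. The vanishing is at once the induction step and the coefficient identity behind the
-- product formula for R(t).

module IntegerSolver {c ℓ} (R : CommutativeRing c ℓ) where
  open CommutativeRing R
  open RingProperties ring using (-‿distribˡ-*; -‿distribʳ-*)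
  open GroupProperties +-group using () renaming (⁻¹-involutive to -‿involutive; ε⁻¹≈ε to -0≈0)
  open AbelianGroupProperties +-abelianGroup using () renaming (⁻¹-∙-comm to -‿+-comm)
  open Multiples semiring using (1+×; ×-homo-+; ×1-homo-*) renaming (_×_ to _×′_)
  open SetoidReasoning setoid

  -- Integer coefficients let the solver detect cancelling monomials, since equality of integers can
  -- be decided. The multiples `_×′_` are the variant in which `1 ×′ 1#` reduces to `1#`, so the
  -- constants of the solver are literally those of the goals.
  fromℤ : ℤ → Carrier
  fromℤ (+ n)    = n ×′ 1#
  fromℤ -[1+ n ] = - (suc n ×′ 1#)

  fromℤ-⊖ : ∀ m n → fromℤ (m ⊖ n) ≈ m ×′ 1# - n ×′ 1#
  fromℤ-⊖ m zero = begin
    m ×′ 1#         ≈⟨ +-identityʳ _ ⟨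
    m ×′ 1# + 0#    ≈⟨ +-congˡ -0≈0 ⟨
    m ×′ 1# - 0#    ∎
  fromℤ-⊖ zero (suc n) = sym (+-identityˡ _)
  fromℤ-⊖ (suc m) (suc n) = begin
    fromℤ (suc m ⊖ suc n)                       ≡⟨ ≡.cong fromℤ (ℤₚ.[1+m]⊖[1+n]≡m⊖n m n) ⟩
    fromℤ (m ⊖ n)                               ≈⟨ fromℤ-⊖ m n ⟩
    m ×′ 1# - n ×′ 1#                           ≈⟨ +-identityˡ _ ⟨
    0# + (m ×′ 1# - n ×′ 1#)                    ≈⟨ +-congʳ (-‿inverseʳ 1#) ⟨
    (1# - 1#) + (m ×′ 1# - n ×′ 1#)             ≈⟨ +-assoc _ _ _ ⟩
    1# + (- 1# + (m ×′ 1# - n ×′ 1#))           ≈⟨ +-congˡ (+-assoc _ _ _) ⟨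
    1# + ((- 1# + m ×′ 1#) - n ×′ 1#)           ≈⟨ +-congˡ (+-congʳ (+-comm _ _)) ⟩
    1# + ((m ×′ 1# - 1#) - n ×′ 1#)             ≈⟨ +-congˡ (+-assoc _ _ _) ⟩
    1# + (m ×′ 1# + (- 1# - n ×′ 1#))           ≈⟨ +-assoc _ _ _ ⟨
    (1# + m ×′ 1#) + (- 1# - n ×′ 1#)           ≈⟨ +-congˡ (-‿+-comm _ _) ⟩
    (1# + m ×′ 1#) - (1# + n ×′ 1#)             ≈⟨ +-cong (1+× m 1#) (-‿cong (1+× n 1#)) ⟨
    suc m ×′ 1# - suc n ×′ 1#                   ∎

  fromℤ-neg : ∀ i → fromℤ (ℤ.- i) ≈ - fromℤ i
  fromℤ-neg (+ zero)  = sym -0≈0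
  fromℤ-neg (+ suc n) = refl
  fromℤ-neg -[1+ n ]  = sym (-‿involutive _)

  fromℤ-+ : ∀ i j → fromℤ (i ℤ.+ j) ≈ fromℤ i + fromℤ j
  fromℤ-+ (+ m)    (+ n)    = ×-homo-+ 1# m n
  fromℤ-+ (+ m)    -[1+ n ] = fromℤ-⊖ m (suc n)
  fromℤ-+ -[1+ m ] (+ n)    = trans (fromℤ-⊖ n (suc m)) (+-comm _ _)
  fromℤ-+ -[1+ m ] -[1+ n ] = begin
    - (suc (suc (m ℕ.+ n)) ×′ 1#)       ≡⟨ ≡.cong (λ k → - (suc k ×′ 1#)) (ℕₚ.+-suc m n) ⟨
    - ((suc m ℕ.+ suc n) ×′ 1#)         ≈⟨ -‿cong (×-homo-+ 1# (suc m) (suc n)) ⟩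
    - (suc m ×′ 1# + suc n ×′ 1#)       ≈⟨ -‿+-comm _ _ ⟨
    - (suc m ×′ 1#) - suc n ×′ 1#       ∎

  fromℤ-pos-* : ∀ m j → fromℤ (+ m ℤ.* j) ≈ m ×′ 1# * fromℤ j
  fromℤ-pos-* m (+ n) = trans (reflexive (≡.cong fromℤ (≡.sym (ℤₚ.pos-* m n)))) (×1-homo-* m n)
  fromℤ-pos-* m -[1+ n ] = begin
    fromℤ (+ m ℤ.* -[1+ n ])           ≡⟨ ≡.cong fromℤ (ℤₚ.neg-distribʳ-* (+ m) (+ suc n)) ⟨
    fromℤ (ℤ.- (+ m ℤ.* + suc n))      ≈⟨ fromℤ-neg (+ m ℤ.* + suc n) ⟩
    - fromℤ (+ m ℤ.* + suc n)          ≈⟨ -‿cong (fromℤ-pos-* m (+ suc n)) ⟩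
    - (m ×′ 1# * (suc n ×′ 1#))        ≈⟨ -‿distribʳ-* _ _ ⟩
    m ×′ 1# * - (suc n ×′ 1#)          ∎

  fromℤ-* : ∀ i j → fromℤ (i ℤ.* j) ≈ fromℤ i * fromℤ j
  fromℤ-* (+ m)    j = fromℤ-pos-* m j
  fromℤ-* -[1+ m ] j = begin
    fromℤ (-[1+ m ] ℤ.* j)             ≡⟨ ≡.cong fromℤ (ℤₚ.neg-distribˡ-* (+ suc m) j) ⟨
    fromℤ (ℤ.- (+ suc m ℤ.* j))        ≈⟨ fromℤ-neg (+ suc m ℤ.* j) ⟩
    - fromℤ (+ suc m ℤ.* j)            ≈⟨ -‿cong (fromℤ-pos-* (suc m) j) ⟩
    - (suc m ×′ 1# * fromℤ j)          ≈⟨ -‿distribˡ-* _ _ ⟩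
    - (suc m ×′ 1#) * fromℤ j          ∎

  ℤ-rawRing : RawRing _ _
  ℤ-rawRing = record
    { Carrier = ℤ ; _≈_ = _≡_ ; _+_ = ℤ._+_ ; _*_ = ℤ._*_ ; -_ = ℤ.-_ ; 0# = + 0 ; 1# = + 1 }

  fromℤ-morphism : ℤ-rawRing -Raw-AlmostCommutative⟶ fromCommutativeRing R
  fromℤ-morphism = record
    { ⟦_⟧ = fromℤ ; +-homo = fromℤ-+ ; *-homo = fromℤ-* ; -‿homo = fromℤ-neg
    ; 0-homo = refl ; 1-homo = refl }

  fromℤ-≟ : ∀ i j → Maybe (fromℤ i ≈ fromℤ j)
  fromℤ-≟ i j with i ℤₚ.≟ j
  ... | yes i≡j = just (reflexive (≡.cong fromℤ i≡j))
  ... | no  _   = nothing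

  open RingSolver ℤ-rawRing (fromCommutativeRing R) fromℤ-morphism fromℤ-≟ public
    using (Polynomial; solve; _:=_; _:+_; _:*_; _:-_; :-_; con)

  :1 : ∀ {n} → Polynomial n
  :1 = con (+ 1)

  :0 : ∀ {n} → Polynomial n
  :0 = con (+ 0)

-- Order on natural numbers

≤ᵇ-true : ∀ {m n} → m ≤ n → (m ≤ᵇ n) ≡ true
≤ᵇ-true {m} {n} m≤n with m ≤ᵇ n | ℕₚ.≤⇒≤ᵇ m≤n
... | true | _ = ≡.refl

<ᵇ-irrefl : ∀ n → (n <ᵇ n) ≡ false
<ᵇ-irrefl zero    = ≡.refl
<ᵇ-irrefl (suc n) = <ᵇ-irrefl n

≤ᵇ-false : ∀ {m n} → (m ≤ᵇ n) ≡ false → n < m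
≤ᵇ-false {m} {n} m≰ᵇn = ℕₚ.≰⇒> λ m≤n → contradiction (≡.trans (≡.sym (≤ᵇ-true m≤n)) m≰ᵇn) λ ()

-- Reversing an ordering preserves distances; by contraposition, j ≤ k + 1 gives d - k ≤ (d - j) +
-- 1.
reflect-far : ∀ {d j k} → j ≤ d → suc (d ∸ j) < d ∸ k → suc k < j
reflect-far {d} {j} {k} j≤d lt = ℕₚ.≰⇒> λ j≤1+k → ℕₚ.<⇒≱ lt
  (ℕₚ.m≤n+o⇒m∸n≤o d k (ℕₚ.≤-trans (ℕₚ.≤-reflexive (≡.sym (ℕₚ.m∸n+n≡m j≤d)))
    (ℕₚ.≤-trans (ℕₚ.+-monoʳ-≤ (d ∸ j) j≤1+k)
      (ℕₚ.≤-reflexive (≡.trans (ℕₚ.+-suc (d ∸ j) k) (≡.trans (≡.cong suc (ℕₚ.+-comm (d ∸ j) k))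
        (≡.sym (ℕₚ.+-suc k (d ∸ j)))))))))

module Proof {c ℓ} (F : Field c ℓ) where
  open Over F

  -- Field arithmetic

  open IntegerSolver commutativeRing
    using (solve; _:=_; _:+_; _:*_; _:-_; :-_; :1; :0)
  open SetoidReasoning setoid
  open GroupProperties +-group using () renaming (x∙y⁻¹≈ε⇒x≈y to x-y≈0⇒x≈y)

  x≈y⇒x-y≈0 : ∀ {x y} → x ≈ y → x - y ≈ 0#
  x≈y⇒x-y≈0 {x} {y} x≈y = trans (+-congʳ x≈y) (-‿inverseʳ y)

  module _ {a b : Carrier} where
    -- Certificates of ideal membership: an equation follows from known ones once its difference is
    -- a combination of theirs, which is a polynomial identity for the solver. The cofactors stay
    -- implicit because unification reads them off the `solve` call. Inverses enter as extra
    -- variables whose defining equation is among the known ones.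
    linear₁ : ∀ {k l r} → l ≈ r → a - b ≈ k * (l - r) → a ≈ b
    linear₁ {k} l≈r eq = x-y≈0⇒x≈y a b (trans eq (trans (*-congˡ (x≈y⇒x-y≈0 l≈r)) (zeroʳ k)))

    linear₂ : ∀ {k l r k′ l′ r′} → l ≈ r → l′ ≈ r′ →
              a - b ≈ k * (l - r) + k′ * (l′ - r′) → a ≈ b
    linear₂ {k′ = k′} l≈r l′≈r′ eq = linear₁ l≈r (trans eq (trans (+-congˡ
      (trans (*-congˡ (x≈y⇒x-y≈0 l′≈r′)) (zeroʳ k′))) (+-identityʳ _)))

    linear₃ : ∀ {k l r k′ l′ r′ k″ l″ r″} → l ≈ r → l′ ≈ r′ → l″ ≈ r″ →
              a - b ≈ k * (l - r) + k′ * (l′ - r′) + k″ * (l″ - r″) → a ≈ b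
    linear₃ {k″ = k″} l≈r l′≈r′ l″≈r″ eq = linear₂ l≈r l′≈r′ (trans eq (trans (+-congˡ
      (trans (*-congˡ (x≈y⇒x-y≈0 l″≈r″)) (zeroʳ k″))) (+-identityʳ _)))

    linear₄ : ∀ {k l r k′ l′ r′ k″ l″ r″ k‴ l‴ r‴} → l ≈ r → l′ ≈ r′ → l″ ≈ r″ → l‴ ≈ r‴ →
              a - b ≈ k * (l - r) + k′ * (l′ - r′) + k″ * (l″ - r″) + k‴ * (l‴ - r‴) → a ≈ b
    linear₄ {k‴ = k‴} l≈r l′≈r′ l″≈r″ l‴≈r‴ eq = linear₃ l≈r l′≈r′ l″≈r″ (trans eq (trans (+-congˡ
      (trans (*-congˡ (x≈y⇒x-y≈0 l‴≈r‴)) (zeroʳ k‴))) (+-identityʳ _)))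

  ⁻¹-inverseˡ : ∀ {x} → ¬ (x ≈ 0#) → x ⁻¹ * x ≈ 1#
  ⁻¹-inverseˡ {x} x≉0 = trans (*-comm (x ⁻¹) x) (⁻¹-inverse x x≉0)

  x*y≈0⇒y≈0 : ∀ {x y} → ¬ (x ≈ 0#) → x * y ≈ 0# → y ≈ 0#
  x*y≈0⇒y≈0 {x} {y} x≉0 xy≈0 = linear₂ (⁻¹-inverse x x≉0) xy≈0
    (solve 3 (λ x x′ y → y :- :0 := (:- y) :* (x :* x′ :- :1) :+ x′ :* (x :* y :- :0))
       refl x (x ⁻¹) y)

  *-cancelˡ : ∀ {x y z} → ¬ (x ≈ 0#) → x * y ≈ x * z → y ≈ z
  *-cancelˡ {x} {y} {z} x≉0 xy≈xz = x-y≈0⇒x≈y y z (x*y≈0⇒y≈0 x≉0 (linear₁ xy≈xz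
    (solve 3 (λ x y z → x :* (y :- z) :- :0 := :1 :* (x :* y :- x :* z)) refl x y z)))

  *-≉0 : ∀ {x y} → ¬ (x ≈ 0#) → ¬ (y ≈ 0#) → ¬ (x * y ≈ 0#)
  *-≉0 x≉0 y≉0 xy≈0 = y≉0 (x*y≈0⇒y≈0 x≉0 xy≈0)

  x*y≈1⇒x≉0 : ∀ {x y} → x * y ≈ 1# → ¬ (x ≈ 0#)
  x*y≈1⇒x≉0 {y = y} xy≈1 x≈0 = 0≉1 (trans (sym (zeroˡ y)) (trans (*-congʳ (sym x≈0)) xy≈1))

  ⁻¹-unique : ∀ {x y} → x * y ≈ 1# → x ⁻¹ ≈ y
  ⁻¹-unique {x} xy≈1 = *-cancelˡ x≉0 (trans (⁻¹-inverse x x≉0) (sym xy≈1))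
    where x≉0 = x*y≈1⇒x≉0 xy≈1

  pow-cong : ∀ {x y} n → x ≈ y → pow x n ≈ pow y n
  pow-cong zero    x≈y = refl
  pow-cong (suc n) x≈y = *-cong x≈y (pow-cong n x≈y)

  pow-+ : ∀ x m n → pow x (m ℕ.+ n) ≈ pow x m * pow x n
  pow-+ x zero    n = sym (*-identityˡ _)
  pow-+ x (suc m) n = trans (*-congˡ (pow-+ x m n)) (sym (*-assoc _ _ _))

  pow-1# : ∀ n → pow 1# n ≈ 1#
  pow-1# zero    = refl
  pow-1# (suc n) = trans (*-identityˡ _) (pow-1# n)

  pow-distrib-* : ∀ x y n → pow (x * y) n ≈ pow x n * pow y n
  pow-distrib-* x y zero    = sym (*-identityˡ 1#)
  pow-distrib-* x y (suc n) = trans (*-congˡ (pow-distrib-* x y n))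
    (solve 4 (λ x y a b → (x :* y) :* (a :* b) := (x :* a) :* (y :* b)) refl x y (pow x n) (pow y n))

  pow-* : ∀ x m n → pow x (m ℕ.* n) ≈ pow (pow x n) m
  pow-* x zero    n = refl
  pow-* x (suc m) n = trans (pow-+ x n (m ℕ.* n)) (*-congˡ (pow-* x m n))

  pow-inverse : ∀ {x y} n → x * y ≈ 1# → pow x n * pow y n ≈ 1#
  pow-inverse {x} {y} n xy≈1 = trans (sym (pow-distrib-* x y n)) (trans (pow-cong n xy≈1) (pow-1# n))

  zpow-⊖ : ∀ {x} → ¬ (x ≈ 0#) → ∀ m n → zpow x (m ⊖ n) ≈ pow x m * pow (x ⁻¹) n
  zpow-⊖ x≉0 m       zero    = sym (*-identityʳ _)
  zpow-⊖ x≉0 zero    (suc n) = sym (*-identityˡ _)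
  zpow-⊖ {x} x≉0 (suc m) (suc n) = begin
    zpow x (suc m ⊖ suc n)                    ≡⟨ ≡.cong (zpow x) (ℤₚ.[1+m]⊖[1+n]≡m⊖n m n) ⟩
    zpow x (m ⊖ n)                            ≈⟨ zpow-⊖ x≉0 m n ⟩
    pow x m * pow (x ⁻¹) n                    ≈⟨ linear₁ (⁻¹-inverse x x≉0)
      (solve 4 (λ x y a b → a :* b :- (x :* a) :* (y :* b) := (:- (a :* b)) :* (x :* y :- :1))
         refl x (x ⁻¹) (pow x m) (pow (x ⁻¹) n)) ⟩
    pow x (suc m) * pow (x ⁻¹) (suc n)        ∎

  -- Formal power series

  fromℕ-+ : ∀ m n → fromℕ (m ℕ.+ n) ≈ fromℕ m + fromℕ n
  fromℕ-+ zero    n = sym (+-identityˡ _)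
  fromℕ-+ (suc m) n = trans (+-congˡ (fromℕ-+ m n)) (sym (+-assoc _ _ _))

  sumℕ-cong-< : ∀ n {f g} → (∀ i → i < n → f i ≈ g i) → sumℕ n f ≈ sumℕ n g
  sumℕ-cong-< zero    f≈g = refl
  sumℕ-cong-< (suc n) f≈g =
    +-cong (sumℕ-cong-< n (λ i i<n → f≈g i (ℕₚ.m<n⇒m<1+n i<n))) (f≈g n ℕₚ.≤-refl)

  sumℕ-0 : ∀ n → sumℕ n (λ _ → 0#) ≈ 0#
  sumℕ-0 zero    = refl
  sumℕ-0 (suc n) = trans (+-identityʳ _) (sumℕ-0 n)

  sumℕ-zero-< : ∀ n {f} → (∀ i → i < n → f i ≈ 0#) → sumℕ n f ≈ 0#
  sumℕ-zero-< n f≈0 = trans (sumℕ-cong-< n f≈0) (sumℕ-0 n)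

  sumℕ-+ : ∀ n f g → sumℕ n (λ i → f i + g i) ≈ sumℕ n f + sumℕ n g
  sumℕ-+ zero    f g = sym (+-identityˡ 0#)
  sumℕ-+ (suc n) f g = trans (+-congʳ (sumℕ-+ n f g))
    (solve 4 (λ a b x y → (a :+ b) :+ (x :+ y) := (a :+ x) :+ (b :+ y)) refl
       (sumℕ n f) (sumℕ n g) (f n) (g n))

  sumℕ-*ˡ : ∀ n a f → sumℕ n (λ i → a * f i) ≈ a * sumℕ n f
  sumℕ-*ˡ zero    a f = sym (zeroʳ a)
  sumℕ-*ˡ (suc n) a f = trans (+-congʳ (sumℕ-*ˡ n a f)) (sym (distribˡ a _ _))

  sumℕ-head : ∀ n f → sumℕ (suc n) f ≈ f 0 + sumℕ n (f ∘ suc)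
  sumℕ-head zero    f = +-comm 0# (f 0)
  sumℕ-head (suc n) f = trans (+-congʳ (sumℕ-head n f)) (+-assoc _ _ _)

  infix 4 _≋_
  _≋_ : PowerSeries → PowerSeries → Set ℓ
  f ≋ g = ∀ n → f n ≈ g n

  infixl 6 _+PS_
  _+PS_ : PowerSeries → PowerSeries → PowerSeries
  (f +PS g) n = f n + g n

  infixr 7 _·PS_
  _·PS_ : Carrier → PowerSeries → PowerSeries
  (a ·PS f) n = a * f n

  *PS-cong-≤ : ∀ {f f′ g g′} n → (∀ k → k ≤ n → f k ≈ f′ k) → (∀ k → k ≤ n → g k ≈ g′ k) →
               (f *PS g) n ≈ (f′ *PS g′) n
  *PS-cong-≤ n f≈f′ g≈g′ = sumℕ-cong-< (suc n) λ i i<1+n →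
    *-cong (f≈f′ i (ℕₚ.≤-pred i<1+n)) (g≈g′ (n ∸ i) (ℕₚ.m∸n≤m n i))

  *PS-cong : ∀ {f f′ g g′} → f ≋ f′ → g ≋ g′ → f *PS g ≋ f′ *PS g′
  *PS-cong f≋f′ g≋g′ n = *PS-cong-≤ n (λ k _ → f≋f′ k) (λ k _ → g≋g′ k)

  *PS-congʳ : ∀ g {f f′} → f ≋ f′ → f *PS g ≋ f′ *PS g
  *PS-congʳ g f≋f′ = *PS-cong {g = g} f≋f′ (λ _ → refl)

  *PS-0 : ∀ f g → (f *PS g) 0 ≈ f 0 * g 0
  *PS-0 f g = +-identityˡ _

  -- This is f = f 0 + t (f ∘ suc). It lets commutativity and associativity be proved by induction
  -- on the coefficient, without rearranging double sums.
  *PS-suc : ∀ f g n → (f *PS g) (suc n) ≈ f 0 * g (suc n) + ((f ∘ suc) *PS g) n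
  *PS-suc f g n = sumℕ-head (suc n) (λ i → f i * g (suc n ∸ i))

  *PS-distribʳ : ∀ f g h → (f +PS g) *PS h ≋ (f *PS h) +PS (g *PS h)
  *PS-distribʳ f g h n = trans (sumℕ-cong-< (suc n) λ i _ → distribʳ (h (n ∸ i)) (f i) (g i))
    (sumℕ-+ (suc n) _ _)

  ·PS-*PS : ∀ a f g → (a ·PS f) *PS g ≋ a ·PS (f *PS g)
  ·PS-*PS a f g n = trans (sumℕ-cong-< (suc n) λ i _ → *-assoc a (f i) (g (n ∸ i)))
    (sumℕ-*ˡ (suc n) a _)

  *PS-sucʳ : ∀ f g n → (f *PS g) (suc n) ≈ f (suc n) * g 0 + (f *PS (g ∘ suc)) n
  *PS-sucʳ f g zero = trans (*PS-suc f g 0) (trans (+-congˡ (*PS-0 (f ∘ suc) g))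
    (trans (+-comm _ _) (+-congˡ (sym (*PS-0 f (g ∘ suc))))))
  *PS-sucʳ f g (suc n) = begin
    (f *PS g) (suc (suc n))
      ≈⟨ *PS-suc f g (suc n) ⟩
    f 0 * g (suc (suc n)) + ((f ∘ suc) *PS g) (suc n)
      ≈⟨ +-congˡ (*PS-sucʳ (f ∘ suc) g n) ⟩
    f 0 * g (suc (suc n)) + (f (suc (suc n)) * g 0 + ((f ∘ suc) *PS (g ∘ suc)) n)
      ≈⟨ solve 3 (λ x y z → x :+ (y :+ z) := y :+ (x :+ z)) refl _ _ _ ⟩
    f (suc (suc n)) * g 0 + (f 0 * g (suc (suc n)) + ((f ∘ suc) *PS (g ∘ suc)) n)
      ≈⟨ +-congˡ (*PS-suc f (g ∘ suc) n) ⟨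
    f (suc (suc n)) * g 0 + (f *PS (g ∘ suc)) (suc n) ∎

  *PS-comm : ∀ f g → f *PS g ≋ g *PS f
  *PS-comm f g zero    = trans (*PS-0 f g) (trans (*-comm _ _) (sym (*PS-0 g f)))
  *PS-comm f g (suc n) = trans (*PS-suc f g n)
    (trans (+-cong (*-comm _ _) (*PS-comm (f ∘ suc) g n)) (sym (*PS-sucʳ g f n)))

  *PS-assoc : ∀ f g h → (f *PS g) *PS h ≋ f *PS (g *PS h)
  *PS-assoc f g h zero = begin
    ((f *PS g) *PS h) 0   ≈⟨ *PS-0 (f *PS g) h ⟩
    (f *PS g) 0 * h 0     ≈⟨ *-congʳ (*PS-0 f g) ⟩
    f 0 * g 0 * h 0       ≈⟨ *-assoc _ _ _ ⟩
    f 0 * (g 0 * h 0)     ≈⟨ *-congˡ (*PS-0 g h) ⟨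
    f 0 * (g *PS h) 0     ≈⟨ *PS-0 f (g *PS h) ⟨
    (f *PS (g *PS h)) 0   ∎
  *PS-assoc f g h (suc n) = begin
    ((f *PS g) *PS h) (suc n)
      ≈⟨ *PS-suc (f *PS g) h n ⟩
    (f *PS g) 0 * h (suc n) + (((f *PS g) ∘ suc) *PS h) n
      ≈⟨ +-cong (*-congʳ (*PS-0 f g)) (*PS-congʳ h (*PS-suc f g) n) ⟩
    f 0 * g 0 * h (suc n) + (((f 0 ·PS (g ∘ suc)) +PS ((f ∘ suc) *PS g)) *PS h) n
      ≈⟨ +-congˡ (*PS-distribʳ _ _ h n) ⟩
    f 0 * g 0 * h (suc n) + (((f 0 ·PS (g ∘ suc)) *PS h) n + (((f ∘ suc) *PS g) *PS h) n)
      ≈⟨ +-congˡ (+-cong (·PS-*PS (f 0) (g ∘ suc) h n) (*PS-assoc (f ∘ suc) g h n)) ⟩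
    f 0 * g 0 * h (suc n) + (f 0 * ((g ∘ suc) *PS h) n + ((f ∘ suc) *PS (g *PS h)) n)
      ≈⟨ solve 5 (λ a b x y z → a :* b :* x :+ (a :* y :+ z) := a :* (b :* x :+ y) :+ z)
           refl (f 0) (g 0) (h (suc n)) _ _ ⟩
    f 0 * (g 0 * h (suc n) + ((g ∘ suc) *PS h) n) + ((f ∘ suc) *PS (g *PS h)) n
      ≈⟨ +-congʳ (*-congˡ (*PS-suc g h n)) ⟨
    f 0 * (g *PS h) (suc n) + ((f ∘ suc) *PS (g *PS h)) n
      ≈⟨ *PS-suc f (g *PS h) n ⟨
    (f *PS (g *PS h)) (suc n) ∎

  *PS-distribˡ : ∀ f g h → f *PS (g +PS h) ≋ (f *PS g) +PS (f *PS h)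
  *PS-distribˡ f g h n = trans (*PS-comm f _ n) (trans (*PS-distribʳ g h f n)
    (+-cong (*PS-comm g f n) (*PS-comm h f n)))

  *PS-·PS : ∀ a f g → f *PS (a ·PS g) ≋ a ·PS (f *PS g)
  *PS-·PS a f g n = trans (*PS-comm f _ n) (trans (·PS-*PS a g f n) (*-congˡ (*PS-comm g f n)))

  *PS-vanishʳ : ∀ {n} f g → (∀ k → k ≤ n → g k ≈ 0#) → (f *PS g) n ≈ 0#
  *PS-vanishʳ {n} f g g≈0 = sumℕ-zero-< (suc n) λ i _ →
    trans (*-congˡ (g≈0 (n ∸ i) (ℕₚ.m∸n≤m n i))) (zeroʳ (f i))

  *PS-leading : ∀ {n} f g → (∀ k → k ≤ n → f k ≈ 0#) → (f *PS g) (suc n) ≈ f (suc n) * g 0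
  *PS-leading {n} f g f≈0 = begin
    (f *PS g) (suc n)                              ≈⟨ *PS-sucʳ f g n ⟩
    f (suc n) * g 0 + (f *PS (g ∘ suc)) n          ≈⟨ +-congˡ (*PS-comm f _ n) ⟩
    f (suc n) * g 0 + ((g ∘ suc) *PS f) n          ≈⟨ +-congˡ (*PS-vanishʳ (g ∘ suc) f f≈0) ⟩
    f (suc n) * g 0 + 0#                           ≈⟨ +-identityʳ _ ⟩
    f (suc n) * g 0                                ∎

  -- `rPrev` is multiplication by t, hence it can be pulled out of a product.
  rPrev-*PS : ∀ f g → rPrev f *PS g ≋ rPrev (f *PS g)
  rPrev-*PS f g zero    = trans (*PS-0 (rPrev f) g) (zeroˡ (g 0))
  rPrev-*PS f g (suc n) = trans (*PS-suc (rPrev f) g n) (trans (+-congʳ (zeroˡ _)) (+-identityˡ _))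

  rPrev-cong : ∀ {f g} → f ≋ g → rPrev f ≋ rPrev g
  rPrev-cong f≋g zero    = refl
  rPrev-cong f≋g (suc n) = f≋g n

  *PS-rPrev : ∀ f g → f *PS rPrev g ≋ rPrev (f *PS g)
  *PS-rPrev f g n = trans (*PS-comm f _ n) (trans (rPrev-*PS g f n) (rPrev-cong (*PS-comm g f) n))

  *PS-onePS : ∀ f → f *PS onePS ≋ f
  *PS-onePS f n = trans (*PS-comm f onePS n) (lemma n)
    where
    lemma : onePS *PS f ≋ f
    lemma zero    = trans (*PS-0 onePS f) (*-identityˡ _)
    lemma (suc n) = trans (*PS-suc onePS f n) (trans (+-cong (*-identityˡ _)
      (trans (*PS-comm _ f n) (*PS-vanishʳ f _ (λ _ _ → refl)))) (+-identityʳ _))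

  -- The Euler derivation t d/dt: it needs no index shift, unlike d/dt.
  euler : PowerSeries → PowerSeries
  euler f n = fromℕ n * f n

  euler-*PS : ∀ f g → euler (f *PS g) ≋ (euler f *PS g) +PS (f *PS euler g)
  euler-*PS f g n = begin
    fromℕ n * (f *PS g) n
      ≈⟨ sumℕ-*ˡ (suc n) (fromℕ n) _ ⟨
    sumℕ (suc n) (λ i → fromℕ n * (f i * g (n ∸ i)))
      ≈⟨ sumℕ-cong-< (suc n) split ⟩
    sumℕ (suc n) (λ i → euler f i * g (n ∸ i) + f i * euler g (n ∸ i))
      ≈⟨ sumℕ-+ (suc n) _ _ ⟩
    (euler f *PS g) n + (f *PS euler g) n ∎
    where
    split : ∀ i → i < suc n →
            fromℕ n * (f i * g (n ∸ i)) ≈ euler f i * g (n ∸ i) + f i * euler g (n ∸ i)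
    split i i<1+n = trans
      (*-congʳ (trans (reflexive (≡.cong fromℕ (≡.sym (ℕₚ.m+[n∸m]≡n (ℕₚ.≤-pred i<1+n)))))
                      (fromℕ-+ i (n ∸ i))))
      (solve 4 (λ a b x y → (a :+ b) :* (x :* y) := a :* x :* y :+ x :* (b :* y)) refl
         (fromℕ i) (fromℕ (n ∸ i)) (f i) (g (n ∸ i)))

  euler-rPrev : ∀ f → euler (rPrev f) ≋ rPrev (euler f) +PS rPrev f
  euler-rPrev f zero    = trans (zeroˡ _) (sym (+-identityˡ 0#))
  euler-rPrev f (suc n) = solve 2 (λ a x → (:1 :+ a) :* x := a :* x :+ x) refl (fromℕ n) (f n)

  -- f(t) ↦ f(βt)
  dilate : Carrier → PowerSeries → PowerSeries
  dilate β f n = pow β n * f n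

  dilate-*PS : ∀ β f g → dilate β (f *PS g) ≋ dilate β f *PS dilate β g
  dilate-*PS β f g n = trans (sym (sumℕ-*ˡ (suc n) (pow β n) _)) (sumℕ-cong-< (suc n) split)
    where
    split : ∀ i → i < suc n → pow β n * (f i * g (n ∸ i)) ≈ dilate β f i * dilate β g (n ∸ i)
    split i i<1+n = trans
      (*-congʳ (trans (reflexive (≡.cong (pow β) (≡.sym (ℕₚ.m+[n∸m]≡n (ℕₚ.≤-pred i<1+n)))))
                      (pow-+ β i (n ∸ i))))
      (solve 4 (λ a b x y → (a :* b) :* (x :* y) := a :* x :* (b :* y)) refl
         (pow β i) (pow β (n ∸ i)) (f i) (g (n ∸ i)))

  dilate-rPrev : ∀ β f → dilate β (rPrev f) ≋ β ·PS rPrev (dilate β f)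
  dilate-rPrev β f zero    = trans (zeroʳ _) (sym (zeroʳ β))
  dilate-rPrev β f (suc n) = *-assoc _ _ _

  -- The exponential of a power series

  module Exponential (charZero : CharZero) (S : PowerSeries) (S₀≈0 : S 0 ≈ 0#) where

    powPS-order : ∀ m n → n < m → powPS S m n ≈ 0#
    powPS-order (suc m) zero    _         =
      trans (*PS-0 S (powPS S m)) (trans (*-congʳ S₀≈0) (zeroˡ _))
    powPS-order (suc m) (suc n) (s≤s n<m) = begin
      (S *PS powPS S m) (suc n)
        ≈⟨ *PS-suc S (powPS S m) n ⟩
      S 0 * powPS S m (suc n) + ((S ∘ suc) *PS powPS S m) n
        ≈⟨ +-cong (trans (*-congʳ S₀≈0) (zeroˡ _))
             (*PS-vanishʳ (S ∘ suc) (powPS S m)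
               (λ k k≤n → powPS-order m k (ℕₚ.≤-<-trans k≤n n<m))) ⟩
      0# + 0#
        ≈⟨ +-identityˡ 0# ⟩
      0# ∎

    euler-onePS : ∀ n → euler onePS n ≈ 0#
    euler-onePS zero    = zeroˡ _
    euler-onePS (suc n) = zeroʳ _

    euler-powPS : ∀ m → euler (powPS S (suc m)) ≋ fromℕ (suc m) ·PS (euler S *PS powPS S m)
    euler-powPS zero n = trans (euler-*PS S onePS n) (trans
      (+-congˡ (*PS-vanishʳ S (euler onePS) (λ k _ → euler-onePS k)))
      (solve 1 (λ x → x :+ :0 := (:1 :+ :0) :* x) refl _))
    euler-powPS (suc m) n = begin
      euler (S *PS powPS S (suc m)) n
        ≈⟨ euler-*PS S (powPS S (suc m)) n ⟩
      (euler S *PS powPS S (suc m)) n + (S *PS euler (powPS S (suc m))) n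
        ≈⟨ +-congˡ (*PS-cong (λ _ → refl) (euler-powPS m) n) ⟩
      (euler S *PS powPS S (suc m)) n + (S *PS (fromℕ (suc m) ·PS (euler S *PS powPS S m))) n
        ≈⟨ +-congˡ (*PS-·PS (fromℕ (suc m)) S (euler S *PS powPS S m) n) ⟩
      (euler S *PS powPS S (suc m)) n + fromℕ (suc m) * (S *PS (euler S *PS powPS S m)) n
        ≈⟨ +-congˡ (*-congˡ swap) ⟩
      (euler S *PS powPS S (suc m)) n + fromℕ (suc m) * (euler S *PS powPS S (suc m)) n
        ≈⟨ solve 2 (λ x a → x :+ a :* x := (:1 :+ a) :* x) refl _ (fromℕ (suc m)) ⟩
      fromℕ (suc (suc m)) * (euler S *PS powPS S (suc m)) n ∎
      where
      swap : (S *PS (euler S *PS powPS S m)) n ≈ (euler S *PS powPS S (suc m)) n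
      swap = trans (sym (*PS-assoc S (euler S) (powPS S m) n))
        (trans (*PS-congʳ (powPS S m) (*PS-comm S (euler S)) n) (*PS-assoc (euler S) S (powPS S m) n))

    fact≉0 : ∀ n → ¬ (fact n ≈ 0#)
    fact≉0 zero    = 0≉1 ∘ sym
    fact≉0 (suc n) = *-≉0 (charZero n) (fact≉0 n)

    fact-suc⁻¹ : ∀ n → (fact (suc n)) ⁻¹ * fromℕ (suc n) ≈ (fact n) ⁻¹
    fact-suc⁻¹ n = *-cancelˡ (fact≉0 n) (linear₂ (⁻¹-inverse _ (fact≉0 (suc n))) (⁻¹-inverse _ (fact≉0 n))
      (solve 4 (λ m f F′ f′ → f :* (F′ :* m) :- f :* f′ :=
          :1 :* (m :* f :* F′ :- :1) :+ (:- :1) :* (f :* f′ :- :1))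
        refl (fromℕ (suc n)) (fact n) ((fact (suc n)) ⁻¹) ((fact n) ⁻¹)))

    -- `expPS` cuts its sum at a bound that moves with the coefficient. A fixed bound `M` gives a
    -- finite linear combination of powers, over which a product can be distributed.
    expTruncated : ℕ → PowerSeries
    expTruncated M n = sumℕ M (λ m → (fact m) ⁻¹ * powPS S m n)

    expTruncated-stable : ∀ j n → expTruncated (j ℕ.+ suc n) n ≈ expPS S n
    expTruncated-stable zero    n = refl
    expTruncated-stable (suc j) n = trans (+-cong (expTruncated-stable j n)
      (trans (*-congˡ (powPS-order (j ℕ.+ suc n) n (ℕₚ.m≤n+m (suc n) j))) (zeroʳ _))) (+-identityʳ _)

    *PS-expTruncated : ∀ f M n →
      (f *PS expTruncated M) n ≈ sumℕ M (λ m → (fact m) ⁻¹ * (f *PS powPS S m) n)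
    *PS-expTruncated f zero    n = *PS-vanishʳ f _ (λ _ _ → refl)
    *PS-expTruncated f (suc M) n = trans
      (*PS-distribˡ f (expTruncated M) ((fact M) ⁻¹ ·PS powPS S M) n)
      (+-cong (*PS-expTruncated f M n) (*PS-·PS _ f (powPS S M) n))

    *PS-suc-euler : ∀ g n → (euler S *PS g) (suc n) ≈ ((euler S ∘ suc) *PS g) n
    *PS-suc-euler g n = trans (*PS-suc (euler S) g n)
      (trans (+-congʳ (trans (*-congʳ (zeroˡ _)) (zeroˡ _))) (+-identityˡ _))

    -- The differential equation of the exponential. Differentiation turns term m + 1 into `euler S`
    -- times term m, so a sum up to n + 1 becomes one up to n. This bound suffices because `euler S`
    -- has no constant term and meets only coefficients of exp(S) of index at most n.
    euler-expPS : euler (expPS S) ≋ euler S *PS expPS S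
    euler-expPS zero    = trans (zeroˡ _) (sym (trans (*PS-0 (euler S) (expPS S))
      (trans (*-congʳ (zeroˡ _)) (zeroˡ _))))
    euler-expPS (suc n) = begin
      fromℕ (suc n) * expPS S (suc n)
        ≈⟨ sumℕ-*ˡ (suc (suc n)) (fromℕ (suc n)) _ ⟨
      sumℕ (suc (suc n)) (λ m → fromℕ (suc n) * ((fact m) ⁻¹ * powPS S m (suc n)))
        ≈⟨ sumℕ-cong-< (suc (suc n)) (λ m _ →
             solve 3 (λ a b x → a :* (b :* x) := b :* (a :* x)) refl _ _ _) ⟩
      sumℕ (suc (suc n)) (λ m → (fact m) ⁻¹ * euler (powPS S m) (suc n))
        ≈⟨ sumℕ-head (suc n) _ ⟩
      (fact 0) ⁻¹ * euler onePS (suc n) +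
        sumℕ (suc n) (λ m → (fact (suc m)) ⁻¹ * euler (powPS S (suc m)) (suc n))
        ≈⟨ +-cong (trans (*-congˡ (euler-onePS (suc n))) (zeroʳ _)) (sumℕ-cong-< (suc n) (λ m _ →
             trans (*-congˡ (euler-powPS m (suc n))) (trans (sym (*-assoc _ _ _))
               (*-cong (fact-suc⁻¹ m) (*PS-suc-euler (powPS S m) n))))) ⟩
      0# + sumℕ (suc n) (λ m → (fact m) ⁻¹ * ((euler S ∘ suc) *PS powPS S m) n)
        ≈⟨ +-identityˡ _ ⟩
      sumℕ (suc n) (λ m → (fact m) ⁻¹ * ((euler S ∘ suc) *PS powPS S m) n)
        ≈⟨ *PS-expTruncated (euler S ∘ suc) (suc n) n ⟨
      ((euler S ∘ suc) *PS expTruncated (suc n)) n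
        ≈⟨ *PS-cong-≤ n (λ _ _ → refl) stable ⟩
      ((euler S ∘ suc) *PS expPS S) n
        ≈⟨ *PS-suc-euler (expPS S) n ⟨
      (euler S *PS expPS S) (suc n) ∎
      where
      stable : ∀ k → k ≤ n → expTruncated (suc n) k ≈ expPS S k
      stable k k≤n = trans
        (reflexive (≡.cong (λ M → expTruncated M k)
          (≡.trans (≡.sym (≡.cong suc (ℕₚ.m∸n+n≡m k≤n))) (≡.sym (ℕₚ.+-suc (n ∸ k) k)))))
        (expTruncated-stable (n ∸ k) k)

    expPS-0 : expPS S 0 ≈ 1#
    expPS-0 = trans (+-identityˡ _) (⁻¹-inverseˡ (fact≉0 0))

  -- multiplication by 1 - at
  factor : Carrier → PowerSeries → PowerSeries
  factor a f n = f n - a * rPrev f n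

  -- at / (1 - at), the Euler derivation applied to -log (1 - at)
  geometric : Carrier → PowerSeries
  geometric a zero    = 0#
  geometric a (suc n) = pow a (suc n)

  factor-*PS : ∀ a f g → factor a f *PS g ≋ factor a (f *PS g)
  factor-*PS a f g n = begin
    (factor a f *PS g) n
      ≈⟨ *PS-congʳ g (λ k →
           solve 3 (λ x a y → x :- a :* y := x :+ (:- a) :* y) refl (f k) a (rPrev f k)) n ⟩
    ((f +PS (- a) ·PS rPrev f) *PS g) n
      ≈⟨ *PS-distribʳ f _ g n ⟩
    (f *PS g) n + (((- a) ·PS rPrev f) *PS g) n
      ≈⟨ +-congˡ (trans (·PS-*PS (- a) (rPrev f) g n) (*-congˡ (rPrev-*PS f g n))) ⟩
    (f *PS g) n + (- a) * rPrev (f *PS g) n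
      ≈⟨ solve 3 (λ x a y → x :+ (:- a) :* y := x :- a :* y) refl _ a _ ⟩
    factor a (f *PS g) n ∎

  *PS-factor : ∀ a f g → f *PS factor a g ≋ factor a (f *PS g)
  *PS-factor a f g n = trans (*PS-comm f (factor a g) n) (trans (factor-*PS a g f n)
    (+-cong (*PS-comm g f n) (-‿cong (*-congˡ (rPrev-cong (*PS-comm g f) n)))))

  factor-geometric : ∀ a → factor a (geometric a) ≋ a ·PS rPrev onePS
  factor-geometric a zero          = solve 1 (λ a → :0 :- a :* :0 := a :* :0) refl a
  factor-geometric a (suc zero)    = solve 1 (λ a → a :* :1 :- a :* :0 := a :* :1) refl a
  factor-geometric a (suc (suc n)) =
    solve 2 (λ a x → a :* x :- a :* x := a :* :0) refl a (pow a (suc n))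

  euler-factor : ∀ a f g → euler f ≋ f *PS (g +PS geometric a) →
                 euler (factor a f) ≋ factor a f *PS g
  euler-factor a f g hyp n = linear₃ (euler-rPrev f n) (hyp n) eulerPrev
    (solve 7 (λ N x y a ex z v →
        N :* (x :- a :* y) :- v :=
        (:- a) :* (N :* y :- (z :+ y)) :+ :1 :* (N :* x :- ex) :+ (:- :1) :* (v :+ a :* y :- (ex :- a :* z)))
      refl (fromℕ n) (f n) (rPrev f n) a ((f *PS (g +PS geometric a)) n) (rPrev (euler f) n)
           ((factor a f *PS g) n))
    where
    eulerPrev : (factor a f *PS g) n + a * rPrev f n ≈ (f *PS (g +PS geometric a)) n - a * rPrev (euler f) n
    eulerPrev = begin
      (factor a f *PS g) n + a * rPrev f n
        ≈⟨ +-congˡ (*-congˡ (rPrev-cong (*PS-onePS f) n)) ⟨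
      (factor a f *PS g) n + a * rPrev (f *PS onePS) n
        ≈⟨ +-congˡ (*-congˡ (*PS-rPrev f onePS n)) ⟨
      (factor a f *PS g) n + a * (f *PS rPrev onePS) n
        ≈⟨ +-congˡ (*PS-·PS a f (rPrev onePS) n) ⟨
      (factor a f *PS g) n + (f *PS (a ·PS rPrev onePS)) n
        ≈⟨ +-congˡ (*PS-cong (λ _ → refl) (factor-geometric a) n) ⟨
      (factor a f *PS g) n + (f *PS factor a (geometric a)) n
        ≈⟨ +-congˡ (trans (*PS-factor a f (geometric a) n) (sym (factor-*PS a f (geometric a) n))) ⟩
      (factor a f *PS g) n + (factor a f *PS geometric a) n
        ≈⟨ *PS-distribˡ (factor a f) g (geometric a) n ⟨
      (factor a f *PS (g +PS geometric a)) n
        ≈⟨ factor-*PS a f (g +PS geometric a) n ⟩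
      (f *PS (g +PS geometric a)) n - a * rPrev (f *PS (g +PS geometric a)) n
        ≈⟨ +-congˡ (-‿cong (*-congˡ (rPrev-cong hyp n))) ⟨
      (f *PS (g +PS geometric a)) n - a * rPrev (euler f) n ∎

  factor-injective : ∀ a {f g} → factor a f ≋ factor a g → f ≋ g
  factor-injective a {f} {g} hyp zero    = linear₁ (hyp 0)
    (solve 3 (λ a x y → x :- y := :1 :* ((x :- a :* :0) :- (y :- a :* :0))) refl a (f 0) (g 0))
  factor-injective a {f} {g} hyp (suc n) = linear₂ (hyp (suc n)) (factor-injective a hyp n)
    (solve 5 (λ a x y z w → x :- y :=
        :1 :* ((x :- a :* z) :- (y :- a :* w)) :+ a :* (z :- w))
      refl a (f (suc n)) (g (suc n)) (f n) (g n))

  factor-0 : ∀ a f → factor a f 0 ≈ f 0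
  factor-0 a f = solve 2 (λ a x → x :- a :* :0 := x) refl a (f 0)

  -- Recovering a series from its product with a dilation

  zeroPS : PowerSeries
  zeroPS _ = 0#

  euler≋0⇒constant : CharZero → ∀ f → euler f ≋ zeroPS → ∀ n → f (suc n) ≈ 0#
  euler≋0⇒constant charZero f hyp n = x*y≈0⇒y≈0 (charZero n) (hyp (suc n))

  -- The difference δ = r - e satisfies δ(βt) r(t) + δ(t) e(βt) = 0. If δ vanishes up to index n,
  -- the next coefficient of this identity is (1 + β^(n+1)) δ_(n+1), since both constant terms are
  -- 1.
  dilate-*PS-injective : ∀ β → (∀ n → ¬ (1# + pow β (suc n) ≈ 0#)) → ∀ r e → r 0 ≈ 1# → e 0 ≈ 1# →
                         dilate β r *PS r ≋ dilate β e *PS e → r ≋ e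
  dilate-*PS-injective β 1+βⁿ≉0 r e r₀≈1 e₀≈1 hyp n = below n n ℕₚ.≤-refl
    where
    δ : PowerSeries
    δ k = r k - e k

    split : ∀ n → (dilate β δ *PS r) n + (δ *PS dilate β e) n ≈ 0#
    split n = begin
      (dilate β δ *PS r) n + (δ *PS dilate β e) n
        ≈⟨ +-cong (*PS-congʳ r (λ k → solve 3 (λ p x y → p :* (x :- y) := p :* x :+ (:- :1) :* (p :* y))
                               refl (pow β k) (r k) (e k)) n)
                  (*PS-congʳ (dilate β e) (λ k →
                     solve 2 (λ x y → x :- y := x :+ (:- :1) :* y) refl (r k) (e k)) n) ⟩
      ((dilate β r +PS (- 1#) ·PS dilate β e) *PS r) n + ((r +PS (- 1#) ·PS e) *PS dilate β e) n
        ≈⟨ +-cong (trans (*PS-distribʳ (dilate β r) ((- 1#) ·PS dilate β e) r n) (+-congˡ (·PS-*PS (- 1#) (dilate β e) r n)))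
                  (trans (*PS-distribʳ r ((- 1#) ·PS e) (dilate β e) n) (+-cong (*PS-comm r (dilate β e) n)
                     (trans (·PS-*PS (- 1#) e (dilate β e) n) (*-congˡ (*PS-comm e (dilate β e) n))))) ⟩
      ((dilate β r *PS r) n + (- 1#) * (dilate β e *PS r) n) +
      ((dilate β e *PS r) n + (- 1#) * (dilate β e *PS e) n)
        ≈⟨ linear₁ (hyp n) (solve 3 (λ x y z → (x :+ (:- :1) :* y) :+ (y :+ (:- :1) :* z) :- :0 :=
             :1 :* (x :- z)) refl _ _ _) ⟩
      0# ∎

    below : ∀ n k → k ≤ n → r k ≈ e k
    below zero    zero z≤n = trans r₀≈1 (sym e₀≈1)
    below (suc n) k k≤1+n with ℕₚ.m≤n⇒m<n∨m≡n k≤1+n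
    ... | inj₁ k<1+n  = below n k (ℕₚ.≤-pred k<1+n)
    ... | inj₂ ≡.refl = x-y≈0⇒x≈y _ _ (x*y≈0⇒y≈0 (1+βⁿ≉0 n) (begin
      (1# + pow β (suc n)) * δ (suc n)
        ≈⟨ linear₂ r₀≈1 e₀≈1 (solve 4 (λ b d x y → (:1 :+ b) :* d :- (b :* d :* x :+ d :* (:1 :* y)) :=
             (:- (b :* d)) :* (x :- :1) :+ (:- d) :* (y :- :1)) refl (pow β (suc n)) (δ (suc n)) (r 0) (e 0)) ⟩
      dilate β δ (suc n) * r 0 + δ (suc n) * dilate β e 0
        ≈⟨ +-cong (*PS-leading (dilate β δ) r (λ k k≤n → trans (*-congˡ (δ≈0 k k≤n)) (zeroʳ _)))
                  (*PS-leading δ (dilate β e) δ≈0) ⟨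
      (dilate β δ *PS r) (suc n) + (δ *PS dilate β e) (suc n)
        ≈⟨ split (suc n) ⟩
      0# ∎))
      where
      δ≈0 : ∀ k → k ≤ n → δ k ≈ 0#
      δ≈0 k k≤n = x≈y⇒x-y≈0 (below n k k≤n)

  -- The power sum condition says that S(t) + S(βt) and the sum of the -log(1 - aᵢ t) have the same
  -- Euler derivative. Hence for e = exp(S) the product of e(t) e(βt) with the three factors is
  -- constant, as it is for r by hypothesis, and both constants are 1.
  expPS-unique :
    CharZero → (β a₁ a₂ a₃ : Carrier) → (∀ n → ¬ (1# + pow β (suc n) ≈ 0#)) →
    (S : PowerSeries) → S 0 ≈ 0# →
    (∀ n → (1# + pow β n) * euler S n ≈ geometric a₁ n + geometric a₂ n + geometric a₃ n) →
    (r : PowerSeries) → r 0 ≈ 1# →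
    (∀ n → factor a₁ (factor a₂ (factor a₃ (dilate β r *PS r))) (suc n) ≈ 0#) →
    r ≋ expPS S
  expPS-unique charZero β a₁ a₂ a₃ 1+βⁿ≉0 S S₀≈0 powerSums r r₀≈1 recurrence =
    dilate-*PS-injective β 1+βⁿ≉0 r e r₀≈1 expPS-0
      (factor-injective a₃ (factor-injective a₂ (factor-injective a₁ agree)))
    where
    open Exponential charZero S S₀≈0

    e Φ p : PowerSeries
    e = expPS S
    Φ = dilate β e *PS e
    -- Left-nested and started at `zeroPS`, so that `euler-factor` strips one geometric series at a
    -- time and ends with derivative zero.
    p = ((zeroPS +PS geometric a₁) +PS geometric a₂) +PS geometric a₃

    dilate-euler : euler (dilate β e) ≋ dilate β e *PS dilate β (euler S)
    dilate-euler n = begin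
      fromℕ n * (pow β n * e n)              ≈⟨ solve 3 (λ a b x → a :* (b :* x) := b :* (a :* x)) refl _ _ _ ⟩
      pow β n * (fromℕ n * e n)              ≈⟨ *-congˡ (euler-expPS n) ⟩
      dilate β (euler S *PS e) n             ≈⟨ dilate-*PS β (euler S) e n ⟩
      (dilate β (euler S) *PS dilate β e) n  ≈⟨ *PS-comm (dilate β (euler S)) (dilate β e) n ⟩
      (dilate β e *PS dilate β (euler S)) n  ∎

    euler-Φ : euler Φ ≋ Φ *PS p
    euler-Φ n = begin
      euler Φ n
        ≈⟨ euler-*PS (dilate β e) e n ⟩
      (euler (dilate β e) *PS e) n + (dilate β e *PS euler e) n
        ≈⟨ +-cong (*PS-congʳ e dilate-euler n) (*PS-cong (λ _ → refl) euler-expPS n) ⟩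
      ((dilate β e *PS dilate β (euler S)) *PS e) n + (dilate β e *PS (euler S *PS e)) n
        ≈⟨ +-cong (trans (*PS-assoc (dilate β e) (dilate β (euler S)) e n)
                         (*PS-cong (λ _ → refl) (*PS-comm (dilate β (euler S)) e) n))
                  (*PS-cong (λ _ → refl) (*PS-comm (euler S) e) n) ⟩
      (dilate β e *PS (e *PS dilate β (euler S))) n + (dilate β e *PS (e *PS euler S)) n
        ≈⟨ +-cong (*PS-assoc (dilate β e) e (dilate β (euler S)) n) (*PS-assoc (dilate β e) e (euler S) n) ⟨
      (Φ *PS dilate β (euler S)) n + (Φ *PS euler S) n
        ≈⟨ *PS-distribˡ Φ (dilate β (euler S)) (euler S) n ⟨
      (Φ *PS (dilate β (euler S) +PS euler S)) n
        ≈⟨ *PS-cong (λ _ → refl) (λ k → linear₁ (powerSums k)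
             (solve 5 (λ b s x y z → b :* s :+ s :- (((:0 :+ x) :+ y) :+ z) :=
                :1 :* ((:1 :+ b) :* s :- (x :+ y :+ z))) refl (pow β k) (euler S k) _ _ _)) n ⟩
      (Φ *PS p) n ∎

    Ψ : PowerSeries
    Ψ = factor a₁ (factor a₂ (factor a₃ Φ))

    euler-Ψ : euler Ψ ≋ zeroPS
    euler-Ψ n = trans
      (euler-factor a₁ _ zeroPS
        (euler-factor a₂ _ (zeroPS +PS geometric a₁)
          (euler-factor a₃ Φ ((zeroPS +PS geometric a₁) +PS geometric a₂) euler-Φ)) n)
      (*PS-vanishʳ {n} Ψ zeroPS (λ _ _ → refl))

    factors-0 : ∀ f → factor a₁ (factor a₂ (factor a₃ f)) 0 ≈ f 0
    factors-0 f = trans (factor-0 a₁ (factor a₂ (factor a₃ f)))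
      (trans (factor-0 a₂ (factor a₃ f)) (factor-0 a₃ f))

    square-0 : ∀ f → f 0 ≈ 1# → (dilate β f *PS f) 0 ≈ 1#
    square-0 f f₀≈1 = trans (*PS-0 (dilate β f) f)
      (trans (*-cong (trans (*-identityˡ _) f₀≈1) f₀≈1) (*-identityˡ 1#))

    agree : factor a₁ (factor a₂ (factor a₃ (dilate β r *PS r))) ≋ Ψ
    agree zero    = trans (trans (factors-0 (dilate β r *PS r)) (square-0 r r₀≈1)) (sym (trans (factors-0 Φ) (square-0 e expPS-0)))
    agree (suc n) = trans (recurrence n) (sym (euler≋0⇒constant charZero Ψ euler-Ψ n))

  -- Matrices acting on vectors

  sumF-cong : ∀ {n} {f g : Fin n → Carrier} → (∀ i → f i ≈ g i) → sumF f ≈ sumF g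
  sumF-cong {zero}  f≈g = refl
  sumF-cong {suc n} f≈g = +-cong (f≈g fzero) (sumF-cong (f≈g ∘ fsuc))

  sumF-0 : ∀ n → sumF {n} (λ _ → 0#) ≈ 0#
  sumF-0 zero    = refl
  sumF-0 (suc n) = trans (+-identityˡ _) (sumF-0 n)

  sumF-+ : ∀ {n} (f g : Fin n → Carrier) → sumF (λ i → f i + g i) ≈ sumF f + sumF g
  sumF-+ {zero}  f g = sym (+-identityˡ 0#)
  sumF-+ {suc n} f g = trans (+-congˡ (sumF-+ (f ∘ fsuc) (g ∘ fsuc)))
    (solve 4 (λ a b x y → (a :+ b) :+ (x :+ y) := (a :+ x) :+ (b :+ y)) refl
       (f fzero) (g fzero) (sumF (f ∘ fsuc)) (sumF (g ∘ fsuc)))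

  sumF-*ˡ : ∀ {n} a (f : Fin n → Carrier) → sumF (λ i → a * f i) ≈ a * sumF f
  sumF-*ˡ {zero}  a f = sym (zeroʳ a)
  sumF-*ˡ {suc n} a f = trans (+-congˡ (sumF-*ˡ a (f ∘ fsuc))) (sym (distribˡ a _ _))

  sumF-*ʳ : ∀ {n} a (f : Fin n → Carrier) → sumF (λ i → f i * a) ≈ sumF f * a
  sumF-*ʳ a f = trans (sumF-cong (λ i → *-comm (f i) a)) (trans (sumF-*ˡ a f) (*-comm a _))

  sumF-swap : ∀ {m n} (f : Fin m → Fin n → Carrier) →
              sumF (λ i → sumF (f i)) ≈ sumF (λ j → sumF (λ i → f i j))
  sumF-swap {zero}  {n} f = sym (sumF-0 n)
  sumF-swap {suc m} {n} f = trans (+-congˡ (sumF-swap (f ∘ fsuc)))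
    (sym (sumF-+ (f fzero) (λ j → sumF (λ i → f (fsuc i) j))))

  module _ {N : ℕ} where

    ⊙-cong : ∀ (M : Mat N) {u v} → u ≈V v → (M ⊙ u) ≈V (M ⊙ v)
    ⊙-cong M u≈v i = sumF-cong (λ k → *-congˡ (u≈v k))

    ⊙-congᴹ : ∀ {M P : Mat N} → M ≈M P → ∀ v → (M ⊙ v) ≈V (P ⊙ v)
    ⊙-congᴹ M≈P v i = sumF-cong (λ k → *-congʳ (M≈P i k))

    ⊙-+V : ∀ (M : Mat N) u v → (M ⊙ (u +V v)) ≈V ((M ⊙ u) +V (M ⊙ v))
    ⊙-+V M u v i = trans (sumF-cong (λ k → distribˡ (M i k) (u k) (v k)))
      (sumF-+ (λ k → M i k * u k) (λ k → M i k * v k))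

    ⊙-·V : ∀ (M : Mat N) a v → (M ⊙ (a ·V v)) ≈V (a ·V (M ⊙ v))
    ⊙-·V M a v i = trans
      (sumF-cong (λ k → solve 3 (λ m a x → m :* (a :* x) := a :* (m :* x)) refl (M i k) a (v k)))
      (sumF-*ˡ a (λ k → M i k * v k))

    ⊙-0V : ∀ (M : Mat N) → (M ⊙ 0V) ≈V 0V
    ⊙-0V M i = trans (sumF-cong (λ k → zeroʳ (M i k))) (sumF-0 N)

    ⊙-zero : ∀ (M : Mat N) {v} → v ≈V 0V → (M ⊙ v) ≈V 0V
    ⊙-zero M v≈0 i = trans (⊙-cong M v≈0 i) (⊙-0V M i)

    ⊙-linear₂ : ∀ (M : Mat N) a u b v →
                (M ⊙ ((a ·V u) +V (b ·V v))) ≈V ((a ·V (M ⊙ u)) +V (b ·V (M ⊙ v)))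
    ⊙-linear₂ M a u b v i =
      trans (⊙-+V M (a ·V u) (b ·V v) i) (+-cong (⊙-·V M a u i) (⊙-·V M b v i))

    0M-⊙ : ∀ v → (0M {N} ⊙ v) ≈V 0V
    0M-⊙ v i = trans (sumF-cong (λ k → zeroˡ (v k))) (sumF-0 N)

    ⊗-⊙ : ∀ (M P : Mat N) v → ((M ⊗ P) ⊙ v) ≈V (M ⊙ (P ⊙ v))
    ⊗-⊙ M P v i = begin
      sumF (λ k → sumF (λ j → M i j * P j k) * v k)
        ≈⟨ sumF-cong (λ k → sumF-*ʳ (v k) (λ j → M i j * P j k)) ⟨
      sumF (λ k → sumF (λ j → M i j * P j k * v k))
        ≈⟨ sumF-swap (λ k j → M i j * P j k * v k) ⟩
      sumF (λ j → sumF (λ k → M i j * P j k * v k))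
        ≈⟨ sumF-cong (λ j → trans (sumF-cong (λ k → *-assoc (M i j) (P j k) (v k))) (sumF-*ˡ (M i j) (λ k → P j k * v k))) ⟩
      (M ⊙ (P ⊙ v)) i ∎

    +M-⊙ : ∀ (M P : Mat N) v → ((M +M P) ⊙ v) ≈V ((M ⊙ v) +V (P ⊙ v))
    +M-⊙ M P v i = trans (sumF-cong (λ k → distribʳ (v k) (M i k) (P i k)))
      (sumF-+ (λ k → M i k * v k) (λ k → P i k * v k))

    ·M-⊙ : ∀ a (M : Mat N) v → ((a ·M M) ⊙ v) ≈V (a ·V (M ⊙ v))
    ·M-⊙ a M v i = trans (sumF-cong (λ k → *-assoc a (M i k) (v k))) (sumF-*ˡ a (λ k → M i k * v k))

    -M-⊙ : ∀ (M P : Mat N) v i → ((M -M P) ⊙ v) i ≈ (M ⊙ v) i - (P ⊙ v) i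
    -M-⊙ M P v i = begin
      sumF (λ k → (M i k - P i k) * v k)
        ≈⟨ sumF-cong (λ k → solve 3 (λ m p x → (m :- p) :* x := m :* x :+ (:- :1) :* (p :* x))
                              refl (M i k) (P i k) (v k)) ⟩
      sumF (λ k → M i k * v k + (- 1#) * (P i k * v k))
        ≈⟨ trans (sumF-+ (λ k → M i k * v k) (λ k → (- 1#) * (P i k * v k)))
             (+-congˡ (sumF-*ˡ (- 1#) (λ k → P i k * v k))) ⟩
      (M ⊙ v) i + (- 1#) * (P ⊙ v) i
        ≈⟨ solve 2 (λ x y → x :+ (:- :1) :* y := x :- y) refl ((M ⊙ v) i) ((P ⊙ v) i) ⟩
      (M ⊙ v) i - (P ⊙ v) i ∎

    comm-⊙ : ∀ (M P : Mat N) v i → (comm M P ⊙ v) i ≈ (M ⊙ (P ⊙ v)) i - (P ⊙ (M ⊙ v)) i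
    comm-⊙ M P v i = trans (-M-⊙ (M ⊗ P) (P ⊗ M) v i) (+-cong (⊗-⊙ M P v i) (-‿cong (⊗-⊙ P M v i)))

    commb-⊙ : ∀ b (M P : Mat N) v i →
              (commb b M P ⊙ v) i ≈ b * (M ⊙ (P ⊙ v)) i - (P ⊙ (M ⊙ v)) i
    commb-⊙ b M P v i = trans (-M-⊙ (b ·M (M ⊗ P)) (P ⊗ M) v i)
      (+-cong (trans (·M-⊙ b (M ⊗ P) v i) (*-congˡ (⊗-⊙ M P v i))) (-‿cong (⊗-⊙ P M v i)))

    sumMF-⊙ : ∀ {n} (f : Fin n → Mat N) v i → (sumMF f ⊙ v) i ≈ sumF (λ k → (f k ⊙ v) i)
    sumMF-⊙ f v i = trans (sumF-cong (λ k → sym (sumF-*ʳ (v k) (λ j → f j i k))))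
      (sumF-swap (λ k j → f j i k * v k))

  IM-suc : ∀ {N} (i j : Fin N) → IM (fsuc i) (fsuc j) ≈ IM i j
  IM-suc i j with i Fin.≟ j
  ... | yes _ = refl
  ... | no  _ = refl

  IM-⊙ : ∀ {N} (v : Vect N) → (IM ⊙ v) ≈V v
  IM-⊙ {suc N} v fzero = begin
    1# * v fzero + sumF (λ k → 0# * v (fsuc k))
      ≈⟨ +-cong (*-identityˡ _) (trans (sumF-cong (λ k → zeroˡ (v (fsuc k)))) (sumF-0 N)) ⟩
    v fzero + 0#
      ≈⟨ +-identityʳ _ ⟩
    v fzero ∎
  IM-⊙ {suc N} v (fsuc i) = begin
    0# * v fzero + sumF (λ k → IM (fsuc i) (fsuc k) * v (fsuc k))
      ≈⟨ +-cong (zeroˡ _) (sumF-cong (λ k → *-congʳ (IM-suc i k))) ⟩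
    0# + (IM ⊙ (v ∘ fsuc)) i
      ≈⟨ +-identityˡ _ ⟩
    (IM ⊙ (v ∘ fsuc)) i
      ≈⟨ IM-⊙ (v ∘ fsuc) i ⟩
    v (fsuc i) ∎

  scalar-⊙ : ∀ {N} a (v : Vect N) → ((a ·M IM) ⊙ v) ≈V (a ·V v)
  scalar-⊙ a v i = trans (·M-⊙ a IM v i) (*-congˡ (IM-⊙ v i))

  -- All that is extracted is N > 0; the entry of `v` at this index may vanish. Evaluating at a
  -- vector of ones there turns vector equations into scalar ones.
  coordinate : ∀ {N} {v : Vect N} → NonzeroV v → Fin N
  coordinate {zero}  v≢0 = contradiction (λ ()) v≢0
  coordinate {suc N} v≢0 = fzero

  -- Spans, equalizers and irreducible pairs

  module _ {N : ℕ} where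

    data Span (P : Vect N → Set (c ⊔ ℓ)) : Vect N → Set (c ⊔ ℓ) where
      span-gen : ∀ {v} → P v → Span P v
      span-≈   : ∀ {u v} → u ≈V v → Span P u → Span P v
      span-0   : Span P 0V
      span-+   : ∀ {u v} → Span P u → Span P v → Span P (u +V v)
      span-·   : ∀ a {v} → Span P v → Span P (a ·V v)

    spanSubspace : (Vect N → Set (c ⊔ ℓ)) → Subspace (c ⊔ ℓ)
    spanSubspace P = record
      { mem = Span P ; mem-≈ = span-≈ ; mem-0 = span-0 ; mem-+ = span-+ ; mem-· = span-· }

    span-⊙ : ∀ {P} (M : Mat N) → (∀ v → P v → Span P (M ⊙ v)) → ∀ v → Span P v → Span P (M ⊙ v)
    span-⊙ M step v (span-gen Pv)             = step v Pv
    span-⊙ M step v (span-≈ {u} u≈v s)        = span-≈ (⊙-cong M u≈v) (span-⊙ M step u s)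
    span-⊙ M step _ span-0                    = span-≈ (λ i → sym (⊙-0V M i)) span-0
    span-⊙ M step _ (span-+ {u} {v} s t)      =
      span-≈ (λ i → sym (⊙-+V M u v i)) (span-+ (span-⊙ M step u s) (span-⊙ M step v t))
    span-⊙ M step _ (span-· a {v} s)          =
      span-≈ (λ i → sym (⊙-·V M a v i)) (span-· a (span-⊙ M step v s))

    span-agree : ∀ {P} (M M′ : Mat N) → (∀ v → P v → (M ⊙ v) ≈V (M′ ⊙ v)) →
                 ∀ v → Span P v → (M ⊙ v) ≈V (M′ ⊙ v)
    span-agree M M′ agree v (span-gen Pv) = agree v Pv
    span-agree M M′ agree v (span-≈ {u} u≈v s) i =
      trans (sym (⊙-cong M u≈v i)) (trans (span-agree M M′ agree u s i) (⊙-cong M′ u≈v i))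
    span-agree M M′ agree _ span-0 i = trans (⊙-0V M i) (sym (⊙-0V M′ i))
    span-agree M M′ agree _ (span-+ {u} {v} s t) i = trans (⊙-+V M u v i)
      (trans (+-cong (span-agree M M′ agree u s i) (span-agree M M′ agree v t i))
        (sym (⊙-+V M′ u v i)))
    span-agree M M′ agree _ (span-· a {v} s) i = trans (⊙-·V M a v i)
      (trans (*-congˡ (span-agree M M′ agree v s i)) (sym (⊙-·V M′ a v i)))

    -- Operators are shown equal by showing that this subspace is invariant and nonzero. `Lift`
    -- brings it to the universe level at which irreducibility is available.
    equalizer : Mat N → Mat N → Subspace (c ⊔ ℓ)
    equalizer M M′ = record
      { mem   = λ v → Lift c ((M ⊙ v) ≈V (M′ ⊙ v))
      ; mem-≈ = λ u≈v p → lift λ i →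
          trans (sym (⊙-cong M u≈v i)) (trans (lower p i) (⊙-cong M′ u≈v i))
      ; mem-0 = lift λ i → trans (⊙-0V M i) (sym (⊙-0V M′ i))
      ; mem-+ = λ {u} {v} p q → lift λ i →
          trans (⊙-+V M u v i) (trans (+-cong (lower p i) (lower q i)) (sym (⊙-+V M′ u v i)))
      ; mem-· = λ a {v} p → lift λ i →
          trans (⊙-·V M a v i) (trans (*-congˡ (lower p i)) (sym (⊙-·V M′ a v i)))
      }

    module IrreduciblePair {A B : Mat N} (irred : Irreducible (c ⊔ ℓ) A B) where

      -- Applied to the split spaces and to the chain `u n`, this shows that they span V with no
      -- dimension count.
      generated : ∀ {P} → (∀ v → P v → Span P (A ⊙ v)) → (∀ v → P v → Span P (B ⊙ v)) →
                  ∀ {v} → P v → NonzeroV v → ∀ w → Span P w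
      generated {P} stepA stepB {v} Pv v≢0 = irred (spanSubspace P)
        (span-⊙ A stepA) (span-⊙ B stepB) (v , span-gen Pv , v≢0)

      -- The eigenspace of M for μ is invariant under A and B and contains `u`. The explicit
      -- eigenvector takes the place of algebraic closedness.
      schur : ∀ (M : Mat N) μ →
              (∀ v → (M ⊙ (A ⊙ v)) ≈V (A ⊙ (M ⊙ v))) → (∀ v → (M ⊙ (B ⊙ v)) ≈V (B ⊙ (M ⊙ v))) →
              ∀ {u} → NonzeroV u → (M ⊙ u) ≈V (μ ·V u) → ∀ v → (M ⊙ v) ≈V (μ ·V v)
      schur M μ commA commB {u} u≢0 Mu≈μu v i = trans
        (lower (irred (equalizer M (μ ·M IM)) (invariant A commA) (invariant B commB)
           (u , lift (λ j → trans (Mu≈μu j) (sym (scalar-⊙ μ u j))) , u≢0) v) i)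
        (scalar-⊙ μ v i)
        where
        invariant : ∀ T → (∀ v → (M ⊙ (T ⊙ v)) ≈V (T ⊙ (M ⊙ v))) →
                    Invariant (equalizer M (μ ·M IM)) T
        invariant T commT v p = lift λ j → begin
          (M ⊙ (T ⊙ v)) j                ≈⟨ commT v j ⟩
          (T ⊙ (M ⊙ v)) j                ≈⟨ ⊙-cong T (λ k → trans (lower p k) (scalar-⊙ μ v k)) j ⟩
          (T ⊙ (μ ·V v)) j               ≈⟨ ⊙-·V T μ v j ⟩
          μ * (T ⊙ v) j                  ≈⟨ scalar-⊙ μ (T ⊙ v) j ⟨
          ((μ ·M IM) ⊙ (T ⊙ v)) j        ∎

      -- Equality in F is not assumed decidable, so a nonzero vector need not have an invertible
      -- coordinate; irreducibility supplies the cancellation instead.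
      scalar-zero : ∀ {x v} → NonzeroV v → (x ·V v) ≈V 0V → x ≈ 0#
      scalar-zero {x} {v} v≢0 xv≈0 = trans (sym (*-identityʳ x)) (all≈0 (λ _ → 1#) (coordinate v≢0))
        where
        all≈0 : ∀ w → (x ·V w) ≈V 0V
        all≈0 w i = trans (sym (scalar-⊙ x w i)) (trans
          (lower (irred (equalizer (x ·M IM) 0M) (invariant A) (invariant B)
            (v , lift (λ j → trans (scalar-⊙ x v j)
                               (trans (xv≈0 j) (sym (0M-⊙ v j)))) , v≢0) w) i)
          (0M-⊙ w i))
          where
          invariant : ∀ T → Invariant (equalizer (x ·M IM) 0M) T
          invariant T u p = lift λ j → begin
            ((x ·M IM) ⊙ (T ⊙ u)) j   ≈⟨ scalar-⊙ x (T ⊙ u) j ⟩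
            x * (T ⊙ u) j             ≈⟨ ⊙-·V T x u j ⟨
            (T ⊙ (x ·V u)) j          ≈⟨ ⊙-zero T (λ k → trans
                                           (sym (scalar-⊙ x u k))
                                           (trans (lower p k) (0M-⊙ u k))) j ⟩
            0#                        ≈⟨ 0M-⊙ (T ⊙ u) j ⟨
            (0M ⊙ (T ⊙ u)) j          ∎

  -- Primitive idempotents and the split decomposition

  module _ {N : ℕ} where

    ⊙-sumF : ∀ {n} (M : Mat N) (u : Fin n → Vect N) →
             (M ⊙ (λ i → sumF (λ k → u k i))) ≈V (λ i → sumF (λ k → (M ⊙ u k) i))
    ⊙-sumF M u i = trans (sumF-cong (λ j → sym (sumF-*ˡ (M i j) (λ k → u k j))))
      (sumF-swap (λ j k → M i j * u k j))

    -- The vector `v` itself serves as every `u j`, so one witness works for all selections.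
    inSum : ∀ {n} (E : Fin n → Mat N) (sel : Fin n → Bool) v →
            (∀ i → v i ≈ sumF (λ k → (E k ⊙ v) i)) →
            (∀ j → sel j ≡ false → (E j ⊙ v) ≈V 0V) → InSum E sel v
    inSum E sel v resolution vanish = (λ _ → v) , λ i →
      trans (resolution i) (sumF-cong (λ j → selected j (sel j) ≡.refl i))
      where
      selected : ∀ j b → sel j ≡ b → (E j ⊙ v) ≈V (if b then E j ⊙ v else 0V)
      selected j true  _  i = refl
      selected j false eq i = vanish j eq i

  module IdempotentProperties {N d : ℕ} {A : Mat N} {E : Fin (suc d) → Mat N}
                              {θ : Fin (suc d) → Carrier}
                              (prim : ArePrimitiveIdempotents A E θ) where
    open ArePrimitiveIdempotents prim

    resolve : ∀ v i → v i ≈ sumF (λ k → (E k ⊙ v) i)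
    resolve v i = trans (sym (IM-⊙ v i)) (trans (sym (⊙-congᴹ sum-I v i)) (sumMF-⊙ E v i))

    agree : ∀ (M M′ : Mat N) v → (∀ k → (M ⊙ (E k ⊙ v)) ≈V (M′ ⊙ (E k ⊙ v))) →
            (M ⊙ v) ≈V (M′ ⊙ v)
    agree M M′ v hyp i = begin
      (M ⊙ v) i                              ≈⟨ ⊙-cong M (resolve v) i ⟩
      (M ⊙ (λ i → sumF (λ k → (E k ⊙ v) i))) i    ≈⟨ ⊙-sumF M (λ k → E k ⊙ v) i ⟩
      sumF (λ k → (M ⊙ (E k ⊙ v)) i)         ≈⟨ sumF-cong (λ k → hyp k i) ⟩
      sumF (λ k → (M′ ⊙ (E k ⊙ v)) i)        ≈⟨ ⊙-sumF M′ (λ k → E k ⊙ v) i ⟨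
      (M′ ⊙ (λ i → sumF (λ k → (E k ⊙ v) i))) i   ≈⟨ ⊙-cong M′ (resolve v) i ⟨
      (M′ ⊙ v) i                             ∎

    components-zero : ∀ v → (∀ k → (E k ⊙ v) ≈V 0V) → v ≈V 0V
    components-zero v E≈0 i = trans (resolve v i) (trans (sumF-cong (λ k → E≈0 k i)) (sumF-0 (suc d)))

    E-idem : ∀ j v → (E j ⊙ (E j ⊙ v)) ≈V (E j ⊙ v)
    E-idem j v i = trans (sym (⊗-⊙ (E j) (E j) v i)) (⊙-congᴹ (idem j) v i)

    E-orth : ∀ j k → ¬ (j ≡ k) → ∀ v → (E j ⊙ (E k ⊙ v)) ≈V 0V
    E-orth j k j≢k v i = trans (sym (⊗-⊙ (E j) (E k) v i))
      (trans (⊙-congᴹ (orth j k j≢k) v i) (0M-⊙ v i))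

    A-E : ∀ j v → (A ⊙ (E j ⊙ v)) ≈V (θ j ·V (E j ⊙ v))
    A-E j v i = trans (sym (⊗-⊙ A (E j) v i)) (trans (⊙-congᴹ (eigen j) v i) (·M-⊙ (θ j) (E j) v i))

    -- The field `eigen` has the idempotent on the right of A. Testing on the components E_k v moves
    -- it to the left, since E_j E_k vanishes unless j = k.
    E-A : ∀ j v → (E j ⊙ (A ⊙ v)) ≈V (θ j ·V (E j ⊙ v))
    E-A j v i = trans (sym (⊗-⊙ (E j) A v i))
      (trans (agree (E j ⊗ A) (θ j ·M E j) v onImage i) (·M-⊙ (θ j) (E j) v i))
      where
      eigenvalues : ∀ k i → θ k * (E j ⊙ (E k ⊙ v)) i ≈ θ j * (E j ⊙ (E k ⊙ v)) i
      eigenvalues k i with j Fin.≟ k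
      ... | yes ≡.refl = refl
      ... | no  j≢k    = trans (*-congˡ (E-orth j k j≢k v i))
                           (trans (zeroʳ _) (sym (trans (*-congˡ (E-orth j k j≢k v i)) (zeroʳ _))))

      onImage : ∀ k → ((E j ⊗ A) ⊙ (E k ⊙ v)) ≈V ((θ j ·M E j) ⊙ (E k ⊙ v))
      onImage k i = begin
        ((E j ⊗ A) ⊙ (E k ⊙ v)) i       ≈⟨ ⊗-⊙ (E j) A (E k ⊙ v) i ⟩
        (E j ⊙ (A ⊙ (E k ⊙ v))) i       ≈⟨ ⊙-cong (E j) (A-E k v) i ⟩
        (E j ⊙ (θ k ·V (E k ⊙ v))) i    ≈⟨ ⊙-·V (E j) (θ k) (E k ⊙ v) i ⟩
        θ k * (E j ⊙ (E k ⊙ v)) i       ≈⟨ eigenvalues k i ⟩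
        θ j * (E j ⊙ (E k ⊙ v)) i       ≈⟨ ·M-⊙ (θ j) (E j) (E k ⊙ v) i ⟨
        ((θ j ·M E j) ⊙ (E k ⊙ v)) i    ∎

    -- E_j T v is the sum of the E_j T E_k v, and `hyp` kills each term for one of two reasons.
    E-vanish : ∀ T j v → (∀ k → (E k ⊙ v) ≈V 0V ⊎ ((E j ⊗ T) ⊗ E k) ≈M 0M) → (E j ⊙ (T ⊙ v)) ≈V 0V
    E-vanish T j v hyp i = trans (sym (⊗-⊙ (E j) T v i))
      (trans (agree (E j ⊗ T) 0M v onImage i) (0M-⊙ v i))
      where
      onImage : ∀ k → ((E j ⊗ T) ⊙ (E k ⊙ v)) ≈V (0M ⊙ (E k ⊙ v))
      onImage k i with hyp k
      ... | inj₁ Ekv≈0 = trans (⊙-zero (E j ⊗ T) Ekv≈0 i) (sym (0M-⊙ (E k ⊙ v) i))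
      ... | inj₂ far   = trans (sym (⊗-⊙ (E j ⊗ T) (E k) v i))
        (trans (⊙-congᴹ far v i) (trans (0M-⊙ v i) (sym (0M-⊙ (E k ⊙ v) i))))

    E-shift : ∀ T a j v → (∀ i → (E j ⊙ (T ⊙ v)) i ≈ a * (E j ⊙ v) i) →
              (E j ⊙ ((T ⊙ v) +V ((- a) ·V v))) ≈V 0V
    E-shift T a j v hyp i = begin
      (E j ⊙ ((T ⊙ v) +V ((- a) ·V v))) i
        ≈⟨ ⊙-+V (E j) (T ⊙ v) ((- a) ·V v) i ⟩
      (E j ⊙ (T ⊙ v)) i + (E j ⊙ ((- a) ·V v)) i
        ≈⟨ +-cong (hyp i) (⊙-·V (E j) (- a) v i) ⟩
      a * (E j ⊙ v) i + (- a) * (E j ⊙ v) i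
        ≈⟨ solve 2 (λ a x → a :* x :+ (:- a) :* x := :0) refl a ((E j ⊙ v) i) ⟩
      0# ∎

    E-shift-0 : ∀ T a j v → (E j ⊙ v) ≈V 0V → (E j ⊙ (T ⊙ v)) ≈V 0V →
                (E j ⊙ ((T ⊙ v) +V ((- a) ·V v))) ≈V 0V
    E-shift-0 T a j v Ev≈0 ETv≈0 = E-shift T a j v λ i →
      trans (ETv≈0 i) (sym (trans (*-congˡ (Ev≈0 i)) (zeroʳ a)))

  -- With ρ j = j the spaces U n are (E*_{d-n}V + ... + E*_dV) ∩ (E_nV + ... + E_dV);
  -- with ρ j = d - j both orderings of eigenspaces are inverted.
  module SplitDecomposition
    {N d : ℕ} {A : Mat N} {E : Fin (suc d) → Mat N} {As : Mat N} {Es : Fin (suc d) → Mat N}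
    {θ θs : Fin (suc d) → Carrier}
    (system : IsTDSystem A E As Es θ θs (c ⊔ ℓ))
    (ρ : Fin (suc d) → ℕ) (ρ≤d : ∀ j → ρ j ≤ d) (ρ-far : ∀ j k → suc (ρ j) < ρ k → Far j k)
    (ϑ : ℕ → Carrier) (θ≈ϑ : ∀ j → θ j ≈ ϑ (ρ j)) (θs≈ϑ : ∀ j n → ρ j ℕ.+ n ≡ d → θs j ≈ ϑ n)
    where
    open IsTDSystem system
    module EA  = IdempotentProperties primA
    module EAs = IdempotentProperties primAs

    -- Membership is expressed by vanishing components: such conditions pass through A and A*
    -- directly, whereas `InSum` carries chosen summands. Writing ρ j + n < d avoids truncated
    -- subtraction and admits every natural n, with U n zero beyond d.
    U : ℕ → Vect N → Set (c ⊔ ℓ)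
    U n v = Lift c ((∀ j → ρ j < n → (E j ⊙ v) ≈V 0V) × (∀ j → ρ j ℕ.+ n < d → (Es j ⊙ v) ≈V 0V))

    -- A - ϑ n kills the eigencomponent at position n, which strengthens the first condition by one.
    -- The second weakens by one, because A moves each eigenspace of A* by at most one position.
    raise : ∀ n v → U n v → U (suc n) ((A ⊙ v) +V ((- ϑ n) ·V v))
    raise n v (lift (low , high)) = lift (low′ , high′)
      where
      low′ : ∀ j → ρ j < suc n → (E j ⊙ ((A ⊙ v) +V ((- ϑ n) ·V v))) ≈V 0V
      low′ j ρj<1+n with ℕₚ.m≤n⇒m<n∨m≡n (ℕₚ.≤-pred ρj<1+n)
      ... | inj₁ ρj<n = EA.E-shift-0 A (ϑ n) j v (low j ρj<n)
              (λ i → trans (EA.E-A j v i) (trans (*-congˡ (low j ρj<n i)) (zeroʳ _)))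
      ... | inj₂ ρj≡n = EA.E-shift A (ϑ n) j v
              (λ i → trans (EA.E-A j v i)
                       (*-congʳ (trans (θ≈ϑ j) (reflexive (≡.cong ϑ ρj≡n)))))

      high′ : ∀ j → ρ j ℕ.+ suc n < d → (Es j ⊙ ((A ⊙ v) +V ((- ϑ n) ·V v))) ≈V 0V
      high′ j lt = EAs.E-shift-0 A (ϑ n) j v
        (high j (ℕₚ.<-trans (ℕₚ.+-monoʳ-< (ρ j) (ℕₚ.n<1+n n)) lt))
        (EAs.E-vanish A j v far)
        where
        far : ∀ k → (Es k ⊙ v) ≈V 0V ⊎ ((Es j ⊗ A) ⊗ Es k) ≈M 0M
        far k with ρ k ℕ.+ n ℕₚ.<? d
        ... | yes ρk+n<d = inj₁ (high k ρk+n<d)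
        ... | no  ρk+n≮d = inj₂ (tridAs j k (ρ-far j k (ℕₚ.+-cancelʳ-< n (suc (ρ j)) (ρ k)
                (ℕₚ.<-≤-trans (≡.subst (_< d) (ℕₚ.+-suc (ρ j) n) lt) (ℕₚ.≮⇒≥ ρk+n≮d)))))

    -- On U n the lowest surviving component for A* has position d - n and eigenvalue ϑ n. So the
    -- same sequence ϑ governs both the raising by A and the lowering by A*.
    lower-top : ∀ n v → U n v → ∀ j → ρ j ℕ.+ n ≤ d → (Es j ⊙ ((As ⊙ v) +V ((- ϑ n) ·V v))) ≈V 0V
    lower-top n v (lift (low , high)) j ρj+n≤d with ℕₚ.m≤n⇒m<n∨m≡n ρj+n≤d
    ... | inj₁ lt = EAs.E-shift-0 As (ϑ n) j v (high j lt)
            (λ i → trans (EAs.E-A j v i) (trans (*-congˡ (high j lt i)) (zeroʳ _)))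
    ... | inj₂ eq = EAs.E-shift As (ϑ n) j v (λ i → trans (EAs.E-A j v i) (*-congʳ (θs≈ϑ j n eq)))

    lower-suc : ∀ n v → U (suc n) v → U n ((As ⊙ v) +V ((- ϑ (suc n)) ·V v))
    lower-suc n v Uv@(lift (low , high)) = lift (low′ , high′)
      where
      low′ : ∀ j → ρ j < n → (E j ⊙ ((As ⊙ v) +V ((- ϑ (suc n)) ·V v))) ≈V 0V
      low′ j ρj<n = EA.E-shift-0 As (ϑ (suc n)) j v (low j (ℕₚ.m<n⇒m<1+n ρj<n)) (EA.E-vanish As j v far)
        where
        far : ∀ k → (E k ⊙ v) ≈V 0V ⊎ ((E j ⊗ As) ⊗ E k) ≈M 0M
        far k with ρ k ℕₚ.<? suc n
        ... | yes ρk<1+n = inj₁ (low k ρk<1+n)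
        ... | no  ρk≮1+n = inj₂ (tridA j k (ρ-far j k (ℕₚ.<-≤-trans (s≤s ρj<n) (ℕₚ.≮⇒≥ ρk≮1+n))))

      high′ : ∀ j → ρ j ℕ.+ n < d → (Es j ⊙ ((As ⊙ v) +V ((- ϑ (suc n)) ·V v))) ≈V 0V
      high′ j lt = lower-top (suc n) v Uv j (≡.subst (_≤ d) (≡.sym (ℕₚ.+-suc (ρ j) n)) lt)

    lower-0 : ∀ v → U 0 v → ((As ⊙ v) +V ((- ϑ 0) ·V v)) ≈V 0V
    lower-0 v Uv = EAs.components-zero _ λ j →
      lower-top 0 v Uv j (≡.subst (_≤ d) (≡.sym (ℕₚ.+-identityʳ (ρ j))) (ρ≤d j))

    U-beyond : ∀ n v → d < n → U n v → v ≈V 0V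
    U-beyond n v d<n (lift (low , _)) = EA.components-zero v (λ j → low j (ℕₚ.≤-<-trans (ρ≤d j) d<n))

    module _ {p q : Carrier} (qp≈1 : q * p ≈ 1#)
      (σ : ℕ → Carrier) (σϑ≈1 : ∀ n → σ n * ϑ n ≈ 1#)
      (σ-suc : ∀ n → σ (suc n) ≈ p * p * σ n)
      (X : Mat N) (act-≤ : ∀ n → n ≤ d → ∀ v → U n v → (X ⊙ v) ≈V (σ n ·V v))
      {u₀ : Vect N} (u₀∈U₀ : U 0 u₀) (u₀≢0 : NonzeroV u₀) where

      open IrreduciblePair irred

      act : ∀ n v → U n v → (X ⊙ v) ≈V (σ n ·V v)
      act n v Uv with n ℕₚ.≤? d
      ... | yes n≤d = act-≤ n n≤d v Uv
      ... | no  n≰d = λ i → trans (⊙-zero X v≈0 i) (sym (trans (*-congˡ (v≈0 i)) (zeroʳ _)))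
        where v≈0 = U-beyond n v (ℕₚ.≰⇒> n≰d) Uv

      Split : Vect N → Set (c ⊔ ℓ)
      Split v = ∃ λ n → U n v

      restore : ∀ T a v → Span Split v → Span Split ((T ⊙ v) +V ((- a) ·V v)) → Span Split (T ⊙ v)
      restore T a v s t = span-≈
        (λ i → solve 3 (λ x a y → (x :+ (:- a) :* y) :+ a :* y := x) refl ((T ⊙ v) i) a (v i))
        (span-+ t (span-· a s))

      split-spans : ∀ v → Span Split v
      split-spans = generated
        (λ v (n , Uv) → restore A (ϑ n) v (span-gen (n , Uv)) (span-gen (suc n , raise n v Uv)))
        stepAs (0 , u₀∈U₀) u₀≢0
        where
        stepAs : ∀ v → Split v → Span Split (As ⊙ v)
        stepAs v (zero  , Uv) = restore As (ϑ 0) v (span-gen (0 , Uv))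
          (span-≈ (λ i → sym (lower-0 v Uv i)) span-0)
        stepAs v (suc n , Uv) = restore As (ϑ (suc n)) v (span-gen (suc n , Uv))
          (span-gen (n , lower-suc n v Uv))

      -- X acts on the components of (T - a)v and v by known scalars, so on Tv as well.
      act-shift : ∀ T a s s′ v → (X ⊙ ((T ⊙ v) +V ((- a) ·V v))) ≈V (s′ ·V ((T ⊙ v) +V ((- a) ·V v))) →
                  (X ⊙ v) ≈V (s ·V v) →
                  ∀ i → (X ⊙ (T ⊙ v)) i ≈ s′ * ((T ⊙ v) i - a * v i) + s * a * v i
      act-shift T a s s′ v shifted Xv≈sv i = linear₃ expand (shifted i) (Xv≈sv i)
        (solve 8 (λ XTv XTa Xv Tv v a s s′ →
            XTv :- (s′ :* (Tv :- a :* v) :+ s :* a :* v) :=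
              (:- :1) :* (XTa :- (XTv :+ (:- a) :* Xv)) :+ :1 :* (XTa :- s′ :* (Tv :+ (:- a) :* v))
              :+ a :* (Xv :- s :* v))
          refl ((X ⊙ (T ⊙ v)) i) _ ((X ⊙ v) i) ((T ⊙ v) i) (v i) a s s′)
        where
        expand : (X ⊙ ((T ⊙ v) +V ((- a) ·V v))) i ≈ (X ⊙ (T ⊙ v)) i + (- a) * (X ⊙ v) i
        expand = trans (⊙-+V X (T ⊙ v) ((- a) ·V v) i) (+-congˡ (⊙-·V X (- a) v i))

      qcomm : Mat N → Mat N → Mat N
      qcomm M P = (q ·M (M ⊗ P)) -M (p ·M (P ⊗ M))

      qcomm-⊙ : ∀ M P v i → (qcomm M P ⊙ v) i ≈ q * (M ⊙ (P ⊙ v)) i - p * (P ⊙ (M ⊙ v)) i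
      qcomm-⊙ M P v i = trans (-M-⊙ (q ·M (M ⊗ P)) (p ·M (P ⊗ M)) v i) (+-cong
        (trans (·M-⊙ q (M ⊗ P) v i) (*-congˡ (⊗-⊙ M P v i)))
        (-‿cong (trans (·M-⊙ p (P ⊗ M) v i) (*-congˡ (⊗-⊙ P M v i)))))

      on-split : ∀ M P → (∀ n v → U n v → ∀ i → q * (M ⊙ (P ⊙ v)) i - p * (P ⊙ (M ⊙ v)) i ≈ (q - p) * v i) →
                 ∀ v i → q * (M ⊙ (P ⊙ v)) i - p * (P ⊙ (M ⊙ v)) i ≈ (q - p) * v i
      on-split M P hyp v i = trans (sym (qcomm-⊙ M P v i)) (trans
        (span-agree (qcomm M P) ((q - p) ·M IM)
          (λ v (n , Uv) i → trans (qcomm-⊙ M P v i) (trans (hyp n v Uv i) (sym (scalar-⊙ (q - p) v i))))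
          v (split-spans v) i)
        (scalar-⊙ (q - p) v i))

      -- For v in U n the two parts of Av = (A - ϑ n)v + ϑ n v have X-eigenvalues p² σ n and σ n.
      -- The raised parts cancel because q p² = p, and σ n ϑ n = 1 leaves (q - p) v.
      XA-relation : ∀ v i → q * (X ⊙ (A ⊙ v)) i - p * (A ⊙ (X ⊙ v)) i ≈ (q - p) * v i
      XA-relation = on-split X A λ n v Uv i → begin
        q * (X ⊙ (A ⊙ v)) i - p * (A ⊙ (X ⊙ v)) i
          ≈⟨ +-cong (*-congˡ (trans (act-shift A (ϑ n) (σ n) (σ (suc n)) v
                                      (act (suc n) _ (raise n v Uv)) (act n v Uv) i)
                                    (+-congʳ (*-congʳ (σ-suc n)))))
                    (-‿cong (*-congˡ (trans (⊙-cong A (act n v Uv) i) (⊙-·V A (σ n) v i)))) ⟩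
        q * (p * p * σ n * ((A ⊙ v) i - ϑ n * v i) + σ n * ϑ n * v i) - p * (σ n * (A ⊙ v) i)
          ≈⟨ linear₂ qp≈1 (σϑ≈1 n) (solve 6 (λ q p s t x y →
               q :* (p :* p :* s :* (x :- t :* y) :+ s :* t :* y) :- p :* (s :* x) :- (q :- p) :* y :=
               (p :* s :* (x :- t :* y)) :* (q :* p :- :1) :+ ((q :- p) :* y) :* (s :* t :- :1))
               refl q p (σ n) (ϑ n) ((A ⊙ v) i) (v i)) ⟩
        (q - p) * v i ∎

      -- Dually, the lowered part of A*v has X-eigenvalue q² σ n, so its two contributions cancel
      -- because p q² = q. On U 0 there is no lowered part, hence the separate case.
      AsX-relation : ∀ v i → q * (As ⊙ (X ⊙ v)) i - p * (X ⊙ (As ⊙ v)) i ≈ (q - p) * v i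
      AsX-relation = on-split As X λ n v Uv i → trans
        (+-cong (*-congˡ (trans (⊙-cong As (act n v Uv) i) (⊙-·V As (σ n) v i))) refl) (on-U n v Uv i)
        where
        on-U : ∀ n v → U n v → ∀ i → q * (σ n * (As ⊙ v) i) - p * (X ⊙ (As ⊙ v)) i ≈ (q - p) * v i
        on-U zero v Uv i = linear₄ (⊙-cong X As≈ i) (trans (⊙-·V X (ϑ 0) v i) (*-congˡ (act 0 v Uv i)))
            (As≈ i) (σϑ≈1 0)
            (solve 8 (λ q p s t y x X X′ →
               q :* (s :* x) :- p :* X :- (q :- p) :* y :=
               (:- p) :* (X :- X′) :+ (:- p) :* (X′ :- t :* (s :* y)) :+
               q :* s :* (x :- t :* y) :+ ((q :- p) :* y) :* (s :* t :- :1))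
               refl q p (σ 0) (ϑ 0) (v i) ((As ⊙ v) i) ((X ⊙ (As ⊙ v)) i) ((X ⊙ (ϑ 0 ·V v)) i))
          where
          As≈ : (As ⊙ v) ≈V (ϑ 0 ·V v)
          As≈ i = linear₁ (lower-0 v Uv i) (solve 3 (λ x a y →
            x :- a :* y := :1 :* (x :+ (:- a) :* y :- :0)) refl ((As ⊙ v) i) (ϑ 0) (v i))
        on-U (suc n) v Uv i = linear₄
          (act-shift As (ϑ (suc n)) (σ (suc n)) (σ n) v (act n _ (lower-suc n v Uv)) (act (suc n) v Uv) i)
          (σ-suc n) qp≈1 (σϑ≈1 (suc n))
          (solve 8 (λ q p s s′ t x y X →
             q :* (s :* x) :- p :* X :- (q :- p) :* y :=
             (:- p) :* (X :- (s′ :* (x :- t :* y) :+ s :* t :* y)) :+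
             (q :* (x :- t :* y)) :* (s :- p :* p :* s′) :+
             (p :* s′ :* (x :- t :* y)) :* (q :* p :- :1) :+ ((q :- p) :* y) :* (s :* t :- :1))
             refl q p (σ (suc n)) (σ n) (ϑ (suc n)) ((As ⊙ v) i) (v i) ((X ⊙ (As ⊙ v)) i))

  -- Scalar operators in the equitable relations

  module EquitableRelations
    {N : ℕ} {A B X Z : Mat N} {q p ξ : Carrier} (qp≈1 : q * p ≈ 1#) (q-p≉0 : ¬ (q - p ≈ 0#))
    (irred : Irreducible (c ⊔ ℓ) A B)
    (XA : ∀ v i → q * (X ⊙ (A ⊙ v)) i - p * (A ⊙ (X ⊙ v)) i ≈ (q - p) * v i)
    (BX : ∀ v i → q * (B ⊙ (X ⊙ v)) i - p * (X ⊙ (B ⊙ v)) i ≈ (q - p) * v i)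
    (AZ : ∀ v i → q * (A ⊙ (Z ⊙ v)) i - p * (Z ⊙ (A ⊙ v)) i ≈ (q - p) * v i)
    (ZB : ∀ v i → q * (Z ⊙ (B ⊙ v)) i - p * (B ⊙ (Z ⊙ v)) i ≈ (q - p) * v i)
    (XZ : ∀ v i → (q - p) * ξ * ((X ⊙ v) i - (Z ⊙ v) i) ≈ (B ⊙ (A ⊙ v)) i - (A ⊙ (B ⊙ v)) i)
    where
    open IrreduciblePair irred

    under : ∀ (T : Mat N) {a b e : Carrier} {x y z : Vect N} → (∀ i → a * x i - b * y i ≈ e * z i) →
            ∀ i → a * (T ⊙ x) i - b * (T ⊙ y) i ≈ e * (T ⊙ z) i
    under T {a} {b} {e} {x} {y} {z} eq i = begin
      a * (T ⊙ x) i - b * (T ⊙ y) i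
        ≈⟨ solve 4 (λ a b x y → a :* x :- b :* y := a :* x :+ (:- b) :* y) refl a b _ _ ⟩
      a * (T ⊙ x) i + (- b) * (T ⊙ y) i
        ≈⟨ ⊙-linear₂ T a x (- b) y i ⟨
      (T ⊙ ((a ·V x) +V ((- b) ·V y))) i
        ≈⟨ ⊙-cong T (λ j → trans (solve 4 (λ a b x y → a :* x :+ (:- b) :* y := a :* x :- b :* y)
                                     refl a b (x j) (y j)) (eq j)) i ⟩
      (T ⊙ (e ·V z)) i
        ≈⟨ ⊙-·V T e z i ⟩
      e * (T ⊙ z) i ∎

    under-XZ : ∀ (T : Mat N) v i → (q - p) * ξ * ((T ⊙ (X ⊙ v)) i - (T ⊙ (Z ⊙ v)) i) ≈
                                   (T ⊙ (B ⊙ (A ⊙ v))) i - (T ⊙ (A ⊙ (B ⊙ v))) i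
    under-XZ T v i = begin
      (q - p) * ξ * ((T ⊙ (X ⊙ v)) i - (T ⊙ (Z ⊙ v)) i)
        ≈⟨ solve 3 (λ k x y → k :* (x :- y) := k :* x :+ (:- k) :* y) refl ((q - p) * ξ) _ _ ⟩
      (q - p) * ξ * (T ⊙ (X ⊙ v)) i + (- ((q - p) * ξ)) * (T ⊙ (Z ⊙ v)) i
        ≈⟨ ⊙-linear₂ T _ (X ⊙ v) _ (Z ⊙ v) i ⟨
      (T ⊙ ((((q - p) * ξ) ·V (X ⊙ v)) +V ((- ((q - p) * ξ)) ·V (Z ⊙ v)))) i
        ≈⟨ ⊙-cong T (λ j → linear₁ (XZ v j) (solve 5 (λ k x y z w →
             k :* x :+ (:- k) :* y :- (:1 :* z :+ (:- :1) :* w) := :1 :* (k :* (x :- y) :- (z :- w)))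
             refl ((q - p) * ξ) ((X ⊙ v) j) ((Z ⊙ v) j) ((B ⊙ (A ⊙ v)) j) ((A ⊙ (B ⊙ v)) j))) i ⟩
      (T ⊙ ((1# ·V (B ⊙ (A ⊙ v))) +V ((- 1#) ·V (A ⊙ (B ⊙ v))))) i
        ≈⟨ ⊙-linear₂ T 1# (B ⊙ (A ⊙ v)) (- 1#) (A ⊙ (B ⊙ v)) i ⟩
      1# * (T ⊙ (B ⊙ (A ⊙ v))) i + (- 1#) * (T ⊙ (A ⊙ (B ⊙ v))) i
        ≈⟨ solve 2 (λ x y → :1 :* x :+ (:- :1) :* y := x :- y) refl _ _ ⟩
      (T ⊙ (B ⊙ (A ⊙ v))) i - (T ⊙ (A ⊙ (B ⊙ v))) i ∎

    combine : Carrier → Mat N → Carrier → Mat N → Carrier → Mat N → Mat N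
    combine a P b Q e R = ((a ·M P) +M (b ·M Q)) +M (e ·M R)

    combine-⊙ : ∀ a P b Q e R v i →
                (combine a P b Q e R ⊙ v) i ≈ a * (P ⊙ v) i + b * (Q ⊙ v) i + e * (R ⊙ v) i
    combine-⊙ a P b Q e R v i = trans (+M-⊙ ((a ·M P) +M (b ·M Q)) (e ·M R) v i) (+-cong
      (trans (+M-⊙ (a ·M P) (b ·M Q) v i) (+-cong (·M-⊙ a P v i) (·M-⊙ b Q v i))) (·M-⊙ e R v i))

    ⊙-combine : ∀ T a P b Q e R v i → (T ⊙ (combine a P b Q e R ⊙ v)) i ≈
                a * (T ⊙ (P ⊙ v)) i + b * (T ⊙ (Q ⊙ v)) i + e * (T ⊙ (R ⊙ v)) i
    ⊙-combine T a P b Q e R v i = trans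
      (⊙-cong T (combine-⊙ a P b Q e R v) i)
      (trans (⊙-+V T _ (e ·V (R ⊙ v)) i)
        (+-cong (⊙-linear₂ T a (P ⊙ v) b (Q ⊙ v) i) (⊙-·V T e (R ⊙ v) i)))

    -- In the difference of the two convolutions in the recursion for G_(n+1), the coefficients n
    -- and n - 1 of R(t) R(t/b) come out multiplied by Y and by -ξ C.
    Y C : Mat N
    Y = combine (ξ * p) Z (ξ * q) X 1# (A ⊗ B)
    C = combine ξ (Z ⊗ X) q A p B

    Y-⊙ : ∀ v i → (Y ⊙ v) i ≈ ξ * p * (Z ⊙ v) i + ξ * q * (X ⊙ v) i + 1# * (A ⊙ (B ⊙ v)) i
    Y-⊙ v i = trans (combine-⊙ _ Z _ X 1# (A ⊗ B) v i) (+-congˡ (*-congˡ (⊗-⊙ A B v i)))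

    C-⊙ : ∀ v i → (C ⊙ v) i ≈ ξ * (Z ⊙ (X ⊙ v)) i + q * (A ⊙ v) i + p * (B ⊙ v) i
    C-⊙ v i = trans (combine-⊙ ξ (Z ⊗ X) q A p B v i) (+-congʳ (+-congʳ (*-congˡ (⊗-⊙ Z X v i))))

    ⊙-Y : ∀ T v i → (T ⊙ (Y ⊙ v)) i ≈
          ξ * p * (T ⊙ (Z ⊙ v)) i + ξ * q * (T ⊙ (X ⊙ v)) i + 1# * (T ⊙ (A ⊙ (B ⊙ v))) i
    ⊙-Y T v i = trans (⊙-combine T _ Z _ X 1# (A ⊗ B) v i)
      (+-congˡ (*-congˡ (⊙-cong T (⊗-⊙ A B v) i)))

    ⊙-C : ∀ T v i → (T ⊙ (C ⊙ v)) i ≈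
          ξ * (T ⊙ (Z ⊙ (X ⊙ v))) i + q * (T ⊙ (A ⊙ v)) i + p * (T ⊙ (B ⊙ v)) i
    ⊙-C T v i = trans (⊙-combine T ξ (Z ⊗ X) q A p B v i)
      (+-congʳ (+-congʳ (*-congˡ (⊙-cong T (⊗-⊙ Z X v) i))))

    -- `XA` and `AZ` have the same right-hand side, so ξ[pZ + qX, A] = -ξ(q - p) A(X - Z). By `XZ`
    -- this is -A[B, A] = -[AB, A].
    Y-A : ∀ v → (Y ⊙ (A ⊙ v)) ≈V (A ⊙ (Y ⊙ v))
    Y-A v i = trans (Y-⊙ (A ⊙ v) i) (trans
      (linear₃ (XA v i) (AZ v i) (under-XZ A v i)
        (solve 10 (λ q p ξ v xa ax za az aba aab →
          ξ :* p :* za :+ ξ :* q :* xa :+ :1 :* aba :- (ξ :* p :* az :+ ξ :* q :* ax :+ :1 :* aab) :=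
          ξ :* (q :* xa :- p :* ax :- (q :- p) :* v) :+ (:- ξ) :* (q :* az :- p :* za :- (q :- p) :* v)
          :+ (:- :1) :* ((q :- p) :* ξ :* (ax :- az) :- (aba :- aab)))
          refl q p ξ (v i) ((X ⊙ (A ⊙ v)) i) ((A ⊙ (X ⊙ v)) i) ((Z ⊙ (A ⊙ v)) i) ((A ⊙ (Z ⊙ v)) i)
          ((A ⊙ (B ⊙ (A ⊙ v))) i) ((A ⊙ (A ⊙ (B ⊙ v))) i)))
      (sym (⊙-Y A v i)))

    Y-B : ∀ v → (Y ⊙ (B ⊙ v)) ≈V (B ⊙ (Y ⊙ v))
    Y-B v i = trans (Y-⊙ (B ⊙ v) i) (trans
      (linear₃ (BX v i) (ZB v i) (XZ (B ⊙ v) i)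
        (solve 10 (λ q p ξ v xb bx zb bz bab abb →
          ξ :* p :* zb :+ ξ :* q :* xb :+ :1 :* abb :- (ξ :* p :* bz :+ ξ :* q :* bx :+ :1 :* bab) :=
          (:- ξ) :* (q :* bx :- p :* xb :- (q :- p) :* v) :+ ξ :* (q :* zb :- p :* bz :- (q :- p) :* v)
          :+ :1 :* ((q :- p) :* ξ :* (xb :- zb) :- (bab :- abb)))
          refl q p ξ (v i) ((X ⊙ (B ⊙ v)) i) ((B ⊙ (X ⊙ v)) i) ((Z ⊙ (B ⊙ v)) i) ((B ⊙ (Z ⊙ v)) i)
          ((B ⊙ (A ⊙ (B ⊙ v))) i) ((A ⊙ (B ⊙ (B ⊙ v))) i)))
      (sym (⊙-Y B v i)))

    -- Z times `XA` and `AZ` times X both contain ZAX. Eliminating it gives q[ZX, A] = (q - p)(Z -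
    -- X), and `XZ` turns ξ times this into -[B, A].
    C-A : ∀ v → (C ⊙ (A ⊙ v)) ≈V (A ⊙ (C ⊙ v))
    C-A v i = trans (C-⊙ (A ⊙ v) i) (trans
      (linear₄ (under Z (XA v) i) (AZ (X ⊙ v) i) (XZ v i) qp≈1
        (solve 11 (λ q p ξ x z zxa zax azx ba ab aa →
          ξ :* zxa :+ q :* aa :+ p :* ba :- (ξ :* azx :+ q :* aa :+ p :* ab) :=
          (p :* ξ) :* (q :* zxa :- p :* zax :- (q :- p) :* z)
          :+ (:- (p :* ξ)) :* (q :* azx :- p :* zax :- (q :- p) :* x)
          :+ (:- p) :* ((q :- p) :* ξ :* (x :- z) :- (ba :- ab))
          :+ (ξ :* (azx :- zxa)) :* (q :* p :- :1))
          refl q p ξ ((X ⊙ v) i) ((Z ⊙ v) i) ((Z ⊙ (X ⊙ (A ⊙ v))) i) ((Z ⊙ (A ⊙ (X ⊙ v))) i)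
          ((A ⊙ (Z ⊙ (X ⊙ v))) i) ((B ⊙ (A ⊙ v)) i) ((A ⊙ (B ⊙ v)) i) ((A ⊙ (A ⊙ v)) i)))
      (sym (⊙-C A v i)))

    C-B : ∀ v → (C ⊙ (B ⊙ v)) ≈V (B ⊙ (C ⊙ v))
    C-B v i = trans (C-⊙ (B ⊙ v) i) (trans
      (linear₄ (under Z (BX v) i) (ZB (X ⊙ v) i) (XZ v i) qp≈1
        (solve 11 (λ q p ξ x z zxb zbx bzx ba ab bb →
          ξ :* zxb :+ q :* ab :+ p :* bb :- (ξ :* bzx :+ q :* ba :+ p :* bb) :=
          (:- (q :* ξ)) :* (q :* zbx :- p :* zxb :- (q :- p) :* z)
          :+ (q :* ξ) :* (q :* zbx :- p :* bzx :- (q :- p) :* x)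
          :+ q :* ((q :- p) :* ξ :* (x :- z) :- (ba :- ab))
          :+ (ξ :* (bzx :- zxb)) :* (q :* p :- :1))
          refl q p ξ ((X ⊙ v) i) ((Z ⊙ v) i) ((Z ⊙ (X ⊙ (B ⊙ v))) i) ((Z ⊙ (B ⊙ (X ⊙ v))) i)
          ((B ⊙ (Z ⊙ (X ⊙ v))) i) ((B ⊙ (A ⊙ v)) i) ((A ⊙ (B ⊙ v)) i) ((B ⊙ (B ⊙ v)) i)))
      (sym (⊙-C B v i)))

    -- Values of the two scalar operators

    module Eigenvalues
      (d : ℕ) (s t : Carrier) (st≈1 : s * t ≈ 1#) (q²s²≉1 : ¬ (q * q * (s * s) - 1# ≈ 0#))
      (ϑ σ : ℕ → Carrier) (ϑ-0 : ϑ 0 ≈ t) (σ-0 : σ 0 ≈ s)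
      (ϑ-suc : ∀ n → ϑ (suc n) ≈ q * q * ϑ n) (σ-suc : ∀ n → σ (suc n) ≈ p * p * σ n)
      (ϑ-top : ϑ (suc d) ≈ q * q * s) (σ-top : σ (suc d) ≈ p * p * t)
      (u : ℕ → Vect N) (u-suc : ∀ n i → u (suc n) i ≈ (A ⊙ u n) i - ϑ n * u n i)
      (X-u : ∀ n → (X ⊙ u n) ≈V (σ n ·V u n)) (B-u₀ : (B ⊙ u 0) ≈V (t ·V u 0))
      (φ₁ : Carrier) (B-u₁ : ∀ i → (B ⊙ u 1) i ≈ q * q * t * u 1 i + φ₁ * u 0 i)
      (u₀≢0 : NonzeroV (u 0))
      where

      T-u-suc : ∀ (T : Mat N) n i → (T ⊙ u (suc n)) i ≈ (T ⊙ (A ⊙ u n)) i - ϑ n * (T ⊙ u n) i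
      T-u-suc T n i = begin
        (T ⊙ u (suc n)) i
          ≈⟨ ⊙-cong T (λ j → trans (u-suc n j) (solve 3 (λ x a y → x :- a :* y := :1 :* x :+ (:- a) :* y)
               refl _ (ϑ n) (u n j))) i ⟩
        (T ⊙ ((1# ·V (A ⊙ u n)) +V ((- ϑ n) ·V u n))) i
          ≈⟨ ⊙-linear₂ T 1# (A ⊙ u n) (- ϑ n) (u n) i ⟩
        1# * (T ⊙ (A ⊙ u n)) i + (- ϑ n) * (T ⊙ u n) i
          ≈⟨ solve 3 (λ x a y → :1 :* x :+ (:- a) :* y := x :- a :* y) refl _ (ϑ n) _ ⟩
        (T ⊙ (A ⊙ u n)) i - ϑ n * (T ⊙ u n) i ∎

      -- Provisional eigenvalue of Y, still in terms of φ₁. It comes from Y u₀ once Z u₀ is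
      -- eliminated by `XZ`, whose commutator on u₀ is known from B u₀ and B u₁.
      λ₀ : Carrier
      λ₀ = (q - p) ⁻¹ * ((q - p) * ξ * (p + q) * s - p * φ₁ + (q - p) * (t * t))

      AB-u₀ : ∀ i → (A ⊙ (B ⊙ u 0)) i ≈ t * (A ⊙ u 0) i
      AB-u₀ i = trans (⊙-cong A B-u₀ i) (⊙-·V A t (u 0) i)

      BA-u₀ : ∀ i → (B ⊙ (A ⊙ u 0)) i ≈ q * q * t * ((A ⊙ u 0) i - t * u 0 i) + φ₁ * u 0 i + t * (t * u 0 i)
      BA-u₀ i = begin
        (B ⊙ (A ⊙ u 0)) i
          ≈⟨ linear₁ (T-u-suc B 0 i) (solve 4 (λ x y a z →
               x :- (y :+ a :* z) := (:- :1) :* (y :- (x :- a :* z))) refl _ _ (ϑ 0) _) ⟩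
        (B ⊙ u 1) i + ϑ 0 * (B ⊙ u 0) i
          ≈⟨ +-cong (trans (B-u₁ i) (+-congʳ (*-congˡ (trans (u-suc 0 i) (+-congˡ (-‿cong (*-congʳ ϑ-0)))))))
               (*-cong ϑ-0 (B-u₀ i)) ⟩
        q * q * t * ((A ⊙ u 0) i - t * u 0 i) + φ₁ * u 0 i + t * (t * u 0 i) ∎

      Y-u₀ : (Y ⊙ u 0) ≈V (λ₀ ·V u 0)
      Y-u₀ i = *-cancelˡ q-p≉0 (begin
        (q - p) * (Y ⊙ u 0) i
          ≈⟨ *-congˡ (trans (Y-⊙ (u 0) i) (+-cong (+-congˡ (*-congˡ Xu₀)) (*-congˡ (AB-u₀ i)))) ⟩
        (q - p) * (ξ * p * (Z ⊙ u 0) i + ξ * q * (s * u 0 i) + 1# * (t * (A ⊙ u 0) i))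
          ≈⟨ linear₂ Zu₀ qp≈1 (solve 9 (λ q p ξ s t φ a y z →
               (q :- p) :* (ξ :* p :* z :+ ξ :* q :* (s :* y) :+ :1 :* (t :* a)) :-
               ((q :- p) :* ξ :* (p :+ q) :* s :- p :* φ :+ (q :- p) :* (t :* t)) :* y :=
               (:- p) :* ((q :- p) :* ξ :* (s :* y :- z) :-
                 (q :* q :* t :* (a :- t :* y) :+ φ :* y :+ t :* (t :* y) :- t :* a))
               :+ (t :* (t :* y :- a) :* q) :* (q :* p :- :1))
               refl q p ξ s t φ₁ ((A ⊙ u 0) i) (u 0 i) ((Z ⊙ u 0) i)) ⟩
        ((q - p) * ξ * (p + q) * s - p * φ₁ + (q - p) * (t * t)) * u 0 i
          ≈⟨ linear₁ (⁻¹-inverse _ q-p≉0) (solve 4 (λ k k′ x y →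
               x :* y :- k :* (k′ :* x :* y) := (:- (x :* y)) :* (k :* k′ :- :1)) refl (q - p) ((q - p) ⁻¹) _ _) ⟩
        (q - p) * (λ₀ * u 0 i) ∎)
        where
        Xu₀ : (X ⊙ u 0) i ≈ s * u 0 i
        Xu₀ = trans (X-u 0 i) (*-congʳ σ-0)

        Zu₀ : (q - p) * ξ * (s * u 0 i - (Z ⊙ u 0) i) ≈
              q * q * t * ((A ⊙ u 0) i - t * u 0 i) + φ₁ * u 0 i + t * (t * u 0 i) - t * (A ⊙ u 0) i
        Zu₀ = trans (*-congˡ (+-congʳ (sym Xu₀))) (trans (XZ (u 0) i) (+-cong (BA-u₀ i) (-‿cong (AB-u₀ i))))

      Y-scalar : ∀ v i → ξ * p * (Z ⊙ v) i + ξ * q * (X ⊙ v) i + 1# * (A ⊙ (B ⊙ v)) i ≈ λ₀ * v i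
      Y-scalar v i = trans (sym (Y-⊙ v i)) (schur Y λ₀ Y-A Y-B u₀≢0 Y-u₀ v i)

      -- Elimination of Z between `XZ` and `Y-scalar`. The resulting rule moves B past A, so that
      -- the action of B on the chain can be computed one vector after another.
      BA : ∀ v i → (B ⊙ (A ⊙ v)) i ≈ q * q * (A ⊙ (B ⊙ v)) i + (q - p) * ξ * (1# + q * q) * (X ⊙ v) i
                                     - (q * q - 1#) * λ₀ * v i
      BA v i = linear₃ (XZ v i) (Y-scalar v i) qp≈1
        (solve 9 (λ q p ξ l v x z ab ba →
          ba :- (q :* q :* ab :+ (q :- p) :* ξ :* (:1 :+ q :* q) :* x :- (q :* q :- :1) :* l :* v) :=
          (:- :1) :* ((q :- p) :* ξ :* (x :- z) :- (ba :- ab))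
          :+ (:- ((q :- p) :* q)) :* (ξ :* p :* z :+ ξ :* q :* x :+ :1 :* ab :- l :* v)
          :+ (l :* v :- ab :+ (q :- p) :* ξ :* z) :* (q :* p :- :1))
          refl q p ξ λ₀ (v i) ((X ⊙ v) i) ((Z ⊙ v) i) ((A ⊙ (B ⊙ v)) i) ((B ⊙ (A ⊙ v)) i))

      -- Solution of φ (n+1) = q² φ n + (q² - 1)(ϑ n)² + (q - q⁻¹)(1 + q²) ξ σ n - (q² - 1) λ₀, φ 0 = 0.
      φ : ℕ → Carrier
      φ n = p * p * (ϑ n * ϑ n) - ξ * q * σ n + λ₀ - s * ϑ n * (p * p * (t * t) - ξ * s * q + λ₀)

      φ-0 : φ 0 ≈ 0#
      φ-0 = linear₃ ϑ-0 σ-0 st≈1 (solve 8 (λ q p ξ l s t ϑ σ →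
        let h = p :* p :* (t :* t) :- ξ :* s :* q :+ l in
        p :* p :* (ϑ :* ϑ) :- ξ :* q :* σ :+ l :- s :* ϑ :* h :- :0 :=
        (p :* p :* (ϑ :+ t) :- s :* h) :* (ϑ :- t) :+ (:- (ξ :* q)) :* (σ :- s) :+ (:- h) :* (s :* t :- :1))
        refl q p ξ λ₀ s t (ϑ 0) (σ 0))

      φ-suc : ∀ n → φ (suc n) ≈ q * q * φ n + (q * q - 1#) * (ϑ n * ϑ n)
                                + (q - p) * ξ * (1# + q * q) * σ n - (q * q - 1#) * λ₀
      φ-suc n = linear₃ (ϑ-suc n) (σ-suc n) qp≈1 (solve 10 (λ q p ξ l s t ϑ σ ϑ′ σ′ →
        let h = p :* p :* (t :* t) :- ξ :* s :* q :+ l in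
        p :* p :* (ϑ′ :* ϑ′) :- ξ :* q :* σ′ :+ l :- s :* ϑ′ :* h :-
        (q :* q :* (p :* p :* (ϑ :* ϑ) :- ξ :* q :* σ :+ l :- s :* ϑ :* h) :+ (q :* q :- :1) :* (ϑ :* ϑ)
         :+ (q :- p) :* ξ :* (:1 :+ q :* q) :* σ :- (q :* q :- :1) :* l) :=
        (p :* p :* (ϑ′ :+ q :* q :* ϑ) :- s :* h) :* (ϑ′ :- q :* q :* ϑ)
        :+ (:- (ξ :* q)) :* (σ′ :- p :* p :* σ)
        :+ ((q :* q :- :1) :* (p :* q :+ :1) :* (ϑ :* ϑ) :+ ξ :* σ :* (q :- p)) :* (q :* p :- :1))
        refl q p ξ λ₀ s t (ϑ n) (σ n) (ϑ (suc n)) (σ (suc n)))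

      previous : ℕ → Vect N
      previous zero    = 0V
      previous (suc n) = u n

      -- B u_(n+1) = BA u_n - ϑ_n B u_n, and `BA` rewrites the first term. The recursion for φ is
      -- exactly what makes the coefficients of u_n match.
      B-u : ∀ n i → (B ⊙ u n) i ≈ ϑ n * u n i + φ n * previous n i
      -- The definition of u_n multiplied by q² φ_n. This factor makes the case n = 0 hold, where
      -- u_n has no predecessor and φ_0 = 0.
      A-previous : ∀ n i → q * q * φ n * (A ⊙ previous n) i ≈ φ n * ϑ n * previous n i + q * q * φ n * u n i

      B-u zero i = trans (B-u₀ i) (trans (*-congʳ (sym ϑ-0)) (sym (trans (+-congˡ (zeroʳ _)) (+-identityʳ _))))
      B-u (suc n) i = begin
        (B ⊙ u (suc n)) i
          ≈⟨ T-u-suc B n i ⟩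
        (B ⊙ (A ⊙ u n)) i - ϑ n * (B ⊙ u n) i
          ≈⟨ +-cong (trans (BA (u n) i) (+-congʳ (+-cong (*-congˡ AB-u) (*-congˡ (X-u n i)))))
                    (-‿cong (*-congˡ (B-u n i))) ⟩
        q * q * (ϑ n * (A ⊙ u n) i + φ n * (A ⊙ previous n) i) + κ * (σ n * u n i) - m * u n i
          - ϑ n * (ϑ n * u n i + φ n * previous n i)
          ≈⟨ linear₁ (A-previous n i) (solve 10 (λ q² κ m ϑ φ σ a ap u pr →
               q² :* (ϑ :* a :+ φ :* ap) :+ κ :* (σ :* u) :- m :* u :- ϑ :* (ϑ :* u :+ φ :* pr) :-
               (q² :* ϑ :* (a :- ϑ :* u) :+ (q² :* φ :+ (q² :- :1) :* (ϑ :* ϑ) :+ κ :* σ :- m) :* u) :=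
               :1 :* (q² :* φ :* ap :- (φ :* ϑ :* pr :+ q² :* φ :* u)))
               refl (q * q) κ m (ϑ n) (φ n) (σ n) ((A ⊙ u n) i) ((A ⊙ previous n) i) (u n i) (previous n i)) ⟩
        q * q * ϑ n * ((A ⊙ u n) i - ϑ n * u n i)
          + (q * q * φ n + (q * q - 1#) * (ϑ n * ϑ n) + κ * σ n - m) * u n i
          ≈⟨ +-cong (*-cong (ϑ-suc n) (u-suc n i)) (*-congʳ (φ-suc n)) ⟨
        ϑ (suc n) * u (suc n) i + φ (suc n) * u n i ∎
        where
        κ m : Carrier
        κ = (q - p) * ξ * (1# + q * q)
        m = (q * q - 1#) * λ₀

        AB-u : (A ⊙ (B ⊙ u n)) i ≈ ϑ n * (A ⊙ u n) i + φ n * (A ⊙ previous n) i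
        AB-u = trans (⊙-cong A (B-u n) i) (⊙-linear₂ A (ϑ n) (u n) (φ n) (previous n) i)

      A-previous zero    i = linear₁ φ-0 (solve 5 (λ q φ ϑ x u →
        q :* q :* φ :* x :- (φ :* ϑ :* :0 :+ q :* q :* φ :* u) := (q :* q :* (x :- u)) :* (φ :- :0))
        refl q (φ 0) (ϑ 0) ((A ⊙ 0V) i) (u 0 i))
      A-previous (suc n) i = linear₂ (u-suc n i) (ϑ-suc n) (solve 7 (λ q φ ϑ ϑ′ a u u′ →
        q :* q :* φ :* a :- (φ :* ϑ′ :* u :+ q :* q :* φ :* u′) :=
        (:- (q :* q :* φ)) :* (u′ :- (a :- ϑ :* u)) :+ (:- (φ :* u)) :* (ϑ′ :- q :* q :* ϑ))
        refl q (φ (suc n)) (ϑ n) (ϑ (suc n)) ((A ⊙ u n) i) (u n i) (u (suc n) i))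

      Chain : Vect N → Set (c ⊔ ℓ)
      Chain v = Lift c (∃ λ n → u n ≈V v)

      -- By `u-suc` and `B-u` both operators map the chain into its span.
      chain-spans : ∀ v → Span Chain v
      chain-spans = generated stepA stepB (u∈Chain 0) u₀≢0
        where
        u∈Chain : ∀ n → Chain (u n)
        u∈Chain n = lift (n , λ _ → refl)

        stepA : ∀ v → Chain v → Span Chain (A ⊙ v)
        stepA v (lift (n , u≈v)) = span-≈ (λ i → trans (linear₁ (u-suc n i)
            (solve 4 (λ u′ a ϑ u → (u′ :+ ϑ :* u) :- a := :1 :* (u′ :- (a :- ϑ :* u)))
              refl (u (suc n) i) ((A ⊙ u n) i) (ϑ n) (u n i)))
            (⊙-cong A u≈v i))
          (span-+ (span-gen (u∈Chain (suc n))) (span-· (ϑ n) (span-gen (u∈Chain n))))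

        previous-spanned : ∀ n → Span Chain (previous n)
        previous-spanned zero    = span-0
        previous-spanned (suc n) = span-gen (u∈Chain n)

        stepB : ∀ v → Chain v → Span Chain (B ⊙ v)
        stepB v (lift (n , u≈v)) = span-≈ (λ i → trans (sym (B-u n i)) (⊙-cong B u≈v i))
          (span-+ (span-· (ϑ n) (span-gen (u∈Chain n))) (span-· (φ n) (previous-spanned n)))

      module _ (u-d≢0 : NonzeroV (u d)) (u-top : u (suc d) ≈V 0V) where

        φ-top : φ (suc d) ≈ 0#
        φ-top = scalar-zero u-d≢0 λ i → linear₃ (B-u (suc d) i) (⊙-zero B u-top i) (u-top i)
          (solve 5 (λ φ u ϑ u′ bu → φ :* u :- :0 :=
            (:- :1) :* (bu :- (ϑ :* u′ :+ φ :* u)) :+ :1 :* (bu :- :0) :+ (:- ϑ) :* (u′ :- :0))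
            refl (φ (suc d)) (u d i) (ϑ (suc d)) (u (suc d) i) ((B ⊙ u (suc d)) i))

        -- With ϑ_(d+1) = q² s and σ_(d+1) = p² t the equation φ_(d+1) = 0 becomes (q² s² - 1)(1 +
        -- ξ(q s + p t) - λ₀) = 0, whose first factor is nonzero.
        λ₀-value : λ₀ ≈ 1# + ξ * (q * s + p * t)
        λ₀-value = sym (x-y≈0⇒x≈y _ _ (x*y≈0⇒y≈0 q²s²≉1 (linear₃ top qp≈1 st≈1 (solve 6 (λ q p ξ l s t →
          (q :* q :* (s :* s) :- :1) :* (:1 :+ ξ :* (q :* s :+ p :* t) :- l) :- :0 :=
          :1 :* (p :* p :* (q :* q :* s :* (q :* q :* s)) :- ξ :* q :* (p :* p :* t) :+ l
                 :- s :* (q :* q :* s) :* (p :* p :* (t :* t) :- ξ :* s :* q :+ l) :- :0)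
          :+ (:- (q :* q :* (s :* s) :* (p :* q :+ :1) :- ξ :* p :* t
                  :- (p :* q :+ :1) :* (s :* t :* (s :* t)) :- ξ :* q :* s :* (s :* t))) :* (q :* p :- :1)
          :+ (s :* t :+ :1 :+ ξ :* q :* s) :* (s :* t :- :1))
          refl q p ξ λ₀ s t))))
          where
          top : p * p * (q * q * s * (q * q * s)) - ξ * q * (p * p * t) + λ₀
                - s * (q * q * s) * (p * p * (t * t) - ξ * s * q + λ₀) ≈ 0#
          top = trans (sym (+-cong (+-congʳ (+-cong (*-congˡ (*-cong ϑ-top ϑ-top)) (-‿cong (*-congˡ σ-top))))
                                   (-‿cong (*-congʳ (*-congˡ ϑ-top)))))
                      φ-top

        μ₀ : Carrier
        μ₀ = ξ + (q * s + p * t)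

        -- On u₀ one has C = q s (Y - ξ q X) + p t, so the eigenvalue of C is q s λ₀ - ξ q² s² + p
        -- t.
        C-u₀ : (C ⊙ u 0) ≈V (μ₀ ·V u 0)
        C-u₀ i = trans (C-⊙ (u 0) i) (trans
          (+-cong (+-congʳ (*-congˡ (trans (⊙-cong Z (X-u 0) i) (trans (⊙-·V Z (σ 0) (u 0) i) (*-congʳ σ-0)))))
                  (*-congˡ (B-u₀ i)))
          (linear₄ Y-eq λ₀-value qp≈1 st≈1 (solve 9 (λ q p ξ l s t z a u →
            ξ :* (s :* z) :+ q :* a :+ p :* (t :* u) :- (ξ :+ (q :* s :+ p :* t)) :* u :=
            (q :* s) :* (ξ :* p :* z :+ ξ :* q :* (s :* u) :+ :1 :* (t :* a) :- l :* u)
            :+ (q :* s :* u) :* (l :- (:1 :+ ξ :* (q :* s :+ p :* t)))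
            :+ (ξ :* u :* (s :* t) :- ξ :* s :* z) :* (q :* p :- :1)
            :+ (ξ :* u :- q :* a) :* (s :* t :- :1))
            refl q p ξ λ₀ s t ((Z ⊙ u 0) i) ((A ⊙ u 0) i) (u 0 i))))
          where
          Y-eq : ξ * p * (Z ⊙ u 0) i + ξ * q * (s * u 0 i) + 1# * (t * (A ⊙ u 0) i) ≈ λ₀ * u 0 i
          Y-eq = trans (sym (+-cong (+-congˡ (*-congˡ (trans (X-u 0 i) (*-congʳ σ-0)))) (*-congˡ (AB-u₀ i))))
                   (Y-scalar (u 0) i)

        AB-XZ : ∀ v i → ξ * p * (Z ⊙ v) i + ξ * q * (X ⊙ v) i + (A ⊙ (B ⊙ v)) i ≈
                        (1# + ξ * (q * s + p * t)) * v i
        AB-XZ v i = trans (+-congˡ (sym (*-identityˡ _))) (trans (Y-scalar v i) (*-congʳ λ₀-value))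

        ZX-AB : ∀ v i → ξ * (Z ⊙ (X ⊙ v)) i + q * (A ⊙ v) i + p * (B ⊙ v) i ≈ (ξ + (q * s + p * t)) * v i
        ZX-AB v i = trans (sym (C-⊙ v i)) (schur C μ₀ C-A C-B u₀≢0 C-u₀ v i)

  -- The recursion behind altElems is private to Defs. In each `_` below it is recovered by unification:
  -- the proof that follows mentions it applied to distinct variables only, after a with-abstraction.
  module Recursion {N : ℕ} (b : Carrier) (A As : Mat N) where

    hist : ℕ → ℕ → Alt N
    next : ℕ → ℕ → Alt N
    altElems-suc : ∀ n → altElems b A As (suc n) ≡ (if n <ᵇ n then hist n (suc n) else next n (suc n))
    hist = _
    next = _
    altElems-suc n with suc n
    ... | m = ≡.refl

    step : ℕ → ℕ → (ℕ → Alt N) → Alt N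
    next-step : ∀ n m → next n m ≡ step n m (hist n)
    step = _
    next-step n m with hist n
    ... | h = ≡.refl

    module _ (m : ℕ) (h : ℕ → Alt N) where
      WW GG : ℕ → Mat N
      WW k = pow (b ⁻¹) k ·M (Alt.Wm (h k) ⊗ Alt.Wp (h ((m ∸ k) ∸ 1)))
      GG k = if k ≤ᵇ 0 then 0M else (pow (b ⁻¹) k ·M (Alt.G (h k) ⊗ Alt.Gt (h (m ∸ k))))

    sumWW sumGG : ℕ → (ℕ → Alt N) → ℕ → ℕ → Mat N
    -- Stated at `suc n` so that both sums unfold by two terms. Their remaining length `n` and the
    -- abstracted `suc n` are then different variables, as unification requires.
    step-G : ∀ n m h →
      Alt.G (step (suc n) m h) ≡
      (((1# + pow (b ⁻¹) (suc (suc n))) ⁻¹) ·M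
        (((sumWW (suc n) h m n +M WW m h n) +M WW m h (suc n)) -M
         ((sumGG (suc n) h m n +M GG m h n) +M GG m h (suc n)))) +M
      ((((1# + pow (b ⁻¹) (suc (suc n))) * (1# - b ⁻¹)) ⁻¹) ·M comm (Alt.Wp (h (suc n))) A)
    sumWW = _
    sumGG = _
    step-G n m h with suc n
    ... | k = ≡.refl

    hist-altElems : ∀ n k → k ≤ n → hist n k ≡ altElems b A As k
    hist-altElems zero    zero z≤n = ≡.refl
    hist-altElems (suc n) k k≤1+n with ℕₚ.m≤n⇒m<n∨m≡n k≤1+n
    ... | inj₂ ≡.refl = ≡.refl
    ... | inj₁ (s≤s k≤n) with k ≤ᵇ n | ≤ᵇ-true k≤n
    ...   | true | _ = hist-altElems n k k≤n

    altElems-step : ∀ n → altElems b A As (suc n) ≡ step n (suc n) (hist n)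
    altElems-step n with n <ᵇ n | <ᵇ-irrefl n
    ... | false | _ = ≡.refl

    module _ (n : ℕ) where
      private module M = Alt (altElems b A As (suc n))

      Wm-suc : M.Wm ≡ ((b - 1#) ⁻¹) ·M commb b A M.G
      Wm-suc rewrite altElems-step n = ≡.refl

      Wp-suc : M.Wp ≡ ((b - 1#) ⁻¹) ·M commb b M.G As
      Wp-suc rewrite altElems-step n = ≡.refl

      Gt-suc : M.Gt ≡ M.G +M (((1# - b ⁻¹) ⁻¹) ·M comm A (Alt.Wp (hist n n)))
      Gt-suc rewrite altElems-step n = ≡.refl

      G-suc : M.G ≡
        (((1# + pow (b ⁻¹) (suc n)) ⁻¹) ·M
          (sumWW n (hist n) (suc n) (suc n) -M sumGG n (hist n) (suc n) (suc n))) +M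
        ((((1# + pow (b ⁻¹) (suc n)) * (1# - b ⁻¹)) ⁻¹) ·M comm (Alt.Wp (hist n n)) A)
      G-suc rewrite altElems-step n = ≡.refl

    sumWW-⊙ : ∀ n h m k v i → (sumWW n h m k ⊙ v) i ≈ sumℕ k (λ j → (WW m h j ⊙ v) i)
    sumWW-⊙ n h m zero    v i = 0M-⊙ v i
    sumWW-⊙ n h m (suc k) v i = trans (+M-⊙ (sumWW n h m k) (WW m h k) v i) (+-congʳ (sumWW-⊙ n h m k v i))

    sumGG-⊙ : ∀ n h m k v i → (sumGG n h m k ⊙ v) i ≈ sumℕ k (λ j → (GG m h j ⊙ v) i)
    sumGG-⊙ n h m zero    v i = 0M-⊙ v i
    sumGG-⊙ n h m (suc k) v i = trans (+M-⊙ (sumGG n h m k) (GG m h k) v i) (+-congʳ (sumGG-⊙ n h m k v i))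

  sumℕ-*ʳ : ∀ n f a → sumℕ n (λ i → f i * a) ≈ sumℕ n f * a
  sumℕ-*ʳ n f a = trans (sumℕ-cong-< n (λ i _ → *-comm (f i) a)) (trans (sumℕ-*ˡ n a f) (*-comm a _))

  -- The convolution of the sequences r_k P - e r_{k-1} Q and r_k P′ - e r_{k-1} Q′,
  -- with x, y, z, w standing for PP′, PQ′, QP′, QQ′.
  convolution : ∀ β e r m x y z w →
    sumℕ (suc m) (λ j → pow β j * (r j * (r (m ∸ j) * x - e * rPrev r (m ∸ j) * y)
                                   - e * rPrev r j * (r (m ∸ j) * z - e * rPrev r (m ∸ j) * w))) ≈
    (let C = dilate β r *PS r in
     C m * x - e * rPrev C m * y - e * β * rPrev C m * z + e * e * β * rPrev (rPrev C) m * w)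
  convolution β e r m x y z w = begin
    sumℕ (suc m) (λ j → pow β j * (r j * (r (m ∸ j) * x - e * s (m ∸ j) * y)
                                   - e * s j * (r (m ∸ j) * z - e * s (m ∸ j) * w)))
      ≈⟨ sumℕ-cong-< (suc m) (λ j _ → solve 10 (λ b e rj sj rm sm x y z w →
           b :* (rj :* (rm :* x :- e :* sm :* y) :- e :* sj :* (rm :* z :- e :* sm :* w)) :=
           ((b :* rj) :* rm :* x :+ (b :* rj) :* sm :* (:- (e :* y))) :+
           ((b :* sj) :* rm :* (:- (e :* z)) :+ (b :* sj) :* sm :* (e :* e :* w)))
           refl (pow β j) e (r j) (s j) (r (m ∸ j)) (s (m ∸ j)) x y z w) ⟩
    sumℕ (suc m) (λ j → (dilate β r j * r (m ∸ j) * x + dilate β r j * s (m ∸ j) * (- (e * y)))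
                        + (dilate β s j * r (m ∸ j) * (- (e * z)) + dilate β s j * s (m ∸ j) * (e * e * w)))
      ≈⟨ trans (sumℕ-+ (suc m) _ _) (+-cong
           (trans (sumℕ-+ (suc m) _ _) (+-cong (sumℕ-*ʳ (suc m) _ x) (sumℕ-*ʳ (suc m) _ (- (e * y)))))
           (trans (sumℕ-+ (suc m) _ _)
             (+-cong (sumℕ-*ʳ (suc m) _ (- (e * z))) (sumℕ-*ʳ (suc m) _ (e * e * w))))) ⟩
    (C m * x + (dilate β r *PS s) m * (- (e * y)))
      + ((dilate β s *PS r) m * (- (e * z)) + (dilate β s *PS s) m * (e * e * w))
      ≈⟨ +-cong (+-congˡ (*-congʳ (*PS-rPrev (dilate β r) r m)))
                (+-cong (*-congʳ (left r)) (*-congʳ (trans (left s)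
                  (*-congˡ (rPrev-cong (*PS-rPrev (dilate β r) r) m))))) ⟩
    (C m * x + rPrev C m * (- (e * y)))
      + (β * rPrev C m * (- (e * z)) + β * rPrev (rPrev C) m * (e * e * w))
      ≈⟨ solve 9 (λ C C′ C″ β e x y z w →
           (C :* x :+ C′ :* (:- (e :* y))) :+ (β :* C′ :* (:- (e :* z)) :+ β :* C″ :* (e :* e :* w)) :=
           C :* x :- e :* C′ :* y :- e :* β :* C′ :* z :+ e :* e :* β :* C″ :* w)
           refl (C m) (rPrev C m) (rPrev (rPrev C) m) β e x y z w ⟩
    C m * x - e * rPrev C m * y - e * β * rPrev C m * z + e * e * β * rPrev (rPrev C) m * w ∎
    where
    s C : PowerSeries
    s = rPrev r
    C = dilate β r *PS r

    left : ∀ g → (dilate β s *PS g) m ≈ β * rPrev (dilate β r *PS g) m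
    left g = trans (*PS-congʳ g (dilate-rPrev β r) m)
      (trans (·PS-*PS β (rPrev (dilate β r)) g m) (*-congˡ (rPrev-*PS (dilate β r) g m)))

  -- Alternating elements

  module AlternatingElements
    {N : ℕ} {A B X Z : Mat N} {q p ξ l : Carrier} (i₀ : Fin N)
    (qp≈1 : q * p ≈ 1#) (q-p≉0 : ¬ (q - p ≈ 0#))
    (1+βⁿ≉0 : ∀ n → ¬ (1# + pow ((q * q) ⁻¹) (suc n) ≈ 0#))
    (AZ : ∀ v i → q * (A ⊙ (Z ⊙ v)) i - p * (Z ⊙ (A ⊙ v)) i ≈ (q - p) * v i)
    (ZB : ∀ v i → q * (Z ⊙ (B ⊙ v)) i - p * (B ⊙ (Z ⊙ v)) i ≈ (q - p) * v i)
    (XZ : ∀ v i → (q - p) * ξ * ((X ⊙ v) i - (Z ⊙ v) i) ≈ (B ⊙ (A ⊙ v)) i - (A ⊙ (B ⊙ v)) i)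
    (AB-XZ : ∀ v i → ξ * p * (Z ⊙ v) i + ξ * q * (X ⊙ v) i + (A ⊙ (B ⊙ v)) i ≈ (1# + ξ * l) * v i)
    (ZX-AB : ∀ v i → ξ * (Z ⊙ (X ⊙ v)) i + q * (A ⊙ v) i + p * (B ⊙ v) i ≈ (ξ + l) * v i)
    (r : ℕ → Carrier) (r₀≈1 : r 0 ≈ 1#)
    (W-r : ∀ n → Wneg (q * q) A B n ≈M ((r n ·M A) -M ((q * ξ * rPrev r n) ·M IM)))
    where

    b β e : Carrier
    b = q * q
    β = b ⁻¹
    e = q * ξ

    open Recursion b A B

    C : PowerSeries
    C = dilate β r *PS r

    s : ℕ → Carrier
    s = rPrev r

    pq≈1 : p * q ≈ 1#
    pq≈1 = trans (*-comm p q) qp≈1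

    β≈p² : β ≈ p * p
    β≈p² = ⁻¹-unique (linear₁ qp≈1 (solve 2 (λ q p → q :* q :* (p :* p) :- :1 := (q :* p :+ :1) :* (q :* p :- :1))
      refl q p))

    b-1≉0 : ¬ (b - 1# ≈ 0#)
    b-1≉0 b-1≈0 = *-≉0 (x*y≈1⇒x≉0 qp≈1) q-p≉0 (linear₂ b-1≈0 qp≈1 (solve 2 (λ q p →
      q :* (q :- p) :- :0 := :1 :* (q :* q :- :1 :- :0) :+ (:- :1) :* (q :* p :- :1)) refl q p))

    1-β≈ : 1# - β ≈ p * (q - p)
    1-β≈ = linear₂ β≈p² qp≈1 (solve 3 (λ q p β → (:1 :- β) :- p :* (q :- p) :=
      (:- :1) :* (β :- p :* p) :+ (:- :1) :* (q :* p :- :1)) refl q p β)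

    1-β≉0 : ¬ (1# - β ≈ 0#)
    1-β≉0 1-β≈0 = *-≉0 (x*y≈1⇒x≉0 pq≈1) q-p≉0 (trans (sym 1-β≈) 1-β≈0)

    -- Since β = p², the constants e β and e² β simplify to ξ p and ξ².
    convolution′ : ∀ m x y z w →
      sumℕ (suc m) (λ j → pow β j * (r j * (r (m ∸ j) * x - e * s (m ∸ j) * y)
                                     - e * s j * (r (m ∸ j) * z - e * s (m ∸ j) * w))) ≈
      C m * x - q * ξ * rPrev C m * y - ξ * p * rPrev C m * z + ξ * ξ * rPrev (rPrev C) m * w
    convolution′ m x y z w = trans (convolution β e r m x y z w) (linear₂ β≈p² qp≈1
      (solve 11 (λ q p ξ β C C′ C″ x y z w →
        let e = q :* ξ in
        C :* x :- e :* C′ :* y :- e :* β :* C′ :* z :+ e :* e :* β :* C″ :* w :-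
        (C :* x :- q :* ξ :* C′ :* y :- ξ :* p :* C′ :* z :+ ξ :* ξ :* C″ :* w) :=
        (e :* e :* C″ :* w :- e :* C′ :* z) :* (β :- p :* p)
        :+ (ξ :* ξ :* C″ :* w :* (q :* p :+ :1) :- ξ :* p :* C′ :* z) :* (q :* p :- :1))
        refl q p ξ β (C m) (rPrev C m) (rPrev (rPrev C) m) x y z w))

    T-difference : ∀ (T : Mat N) a b {x y z : Vect N} → (∀ i → z i ≈ a * x i - b * y i) →
                   ∀ i → (T ⊙ z) i ≈ a * (T ⊙ x) i - b * (T ⊙ y) i
    T-difference T a b {x} {y} {z} z≈ i = begin
      (T ⊙ z) i
        ≈⟨ ⊙-cong T (λ j → trans (z≈ j) (solve 4 (λ a b x y → a :* x :- b :* y := a :* x :+ (:- b) :* y)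
                                            refl a b (x j) (y j))) i ⟩
      (T ⊙ ((a ·V x) +V ((- b) ·V y))) i
        ≈⟨ ⊙-linear₂ T a x (- b) y i ⟩
      a * (T ⊙ x) i + (- b) * (T ⊙ y) i
        ≈⟨ solve 4 (λ a b x y → a :* x :+ (:- b) :* y := a :* x :- b :* y) refl a b _ _ ⟩
      a * (T ⊙ x) i - b * (T ⊙ y) i ∎

    -- W_(-n) is absent because `W-r` supplies its value for every n.
    record Evaluated (n : ℕ) (a : Alt N) : Set (c ⊔ ℓ) where
      field
        Wp-⊙ : ∀ v i → (Alt.Wp a ⊙ v) i ≈ r n * (B ⊙ v) i - e * s n * v i
        G-⊙  : ∀ v i → (Alt.G a ⊙ v) i ≈ r n * v i - e * s n * (Z ⊙ v) i
        Gt-⊙ : ∀ v i → (Alt.Gt a ⊙ v) i ≈ r n * v i - e * s n * (X ⊙ v) i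
    open Evaluated

    Wm-⊙ : ∀ n v i → (Wneg b A B n ⊙ v) i ≈ r n * (A ⊙ v) i - e * s n * v i
    Wm-⊙ n v i = trans (⊙-congᴹ (W-r n) v i) (trans (-M-⊙ (r n ·M A) ((e * s n) ·M IM) v i)
      (+-cong (·M-⊙ (r n) A v i) (-‿cong (scalar-⊙ (e * s n) v i))))

    evaluated-0 : Evaluated 0 (altElems b A B 0)
    evaluated-0 = record
      { Wp-⊙ = λ v i → initial ((B ⊙ v) i) (v i)
      ; G-⊙  = λ v i → trans (IM-⊙ v i) (initial (v i) ((Z ⊙ v) i))
      ; Gt-⊙ = λ v i → trans (IM-⊙ v i) (initial (v i) ((X ⊙ v) i)) }
      where
      initial : ∀ x y → x ≈ r 0 * x - e * 0# * y
      initial x y = linear₁ r₀≈1 (solve 4 (λ r e x y →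
        x :- (r :* x :- e :* :0 :* y) := (:- x) :* (r :- :1)) refl (r 0) e x y)

    -- The negative of the coefficient of t^(n+1) in (1 - t)(1 - ξ l t + ξ² t²) R(t) R(βt).
    δ : ℕ → Carrier
    δ n = (1# + ξ * l) * C n - ξ * (ξ + l) * rPrev C n + ξ * ξ * rPrev (rPrev C) n - C (suc n)

    module Step (n : ℕ) (ih : ∀ k → k ≤ n → Evaluated k (altElems b A B k)) where
      m : ℕ
      m = suc n

      ε : Carrier
      ε = 1# + pow β m

      hist-eval : ∀ k → k ≤ n → Evaluated k (hist n k)
      hist-eval k k≤n = ≡.subst (Evaluated k) (≡.sym (hist-altElems n k k≤n)) (ih k k≤n)

      W-term : ∀ v i j → j ≤ n → (WW m (hist n) j ⊙ v) i ≈
        pow β j * (r j * (r (n ∸ j) * (A ⊙ (B ⊙ v)) i - e * s (n ∸ j) * (A ⊙ v) i)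
                   - e * s j * (r (n ∸ j) * (B ⊙ v) i - e * s (n ∸ j) * v i))
      W-term v i j j≤n = trans (·M-⊙ (pow β j) (Alt.Wm (hist n j) ⊗ P) v i) (*-congˡ (begin
        ((Alt.Wm (hist n j) ⊗ P) ⊙ v) i
          ≈⟨ ⊗-⊙ (Alt.Wm (hist n j)) P v i ⟩
        (Alt.Wm (hist n j) ⊙ (P ⊙ v)) i
          ≡⟨ ≡.cong (λ a → (Alt.Wm a ⊙ (P ⊙ v)) i) (hist-altElems n j j≤n) ⟩
        (Wneg b A B j ⊙ (P ⊙ v)) i
          ≈⟨ Wm-⊙ j (P ⊙ v) i ⟩
        r j * (A ⊙ (P ⊙ v)) i - e * s j * (P ⊙ v) i
          ≈⟨ +-cong (*-congˡ (T-difference A (r (n ∸ j)) (e * s (n ∸ j)) (P-⊙ v) i))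
                    (-‿cong (*-congˡ (P-⊙ v i))) ⟩
        r j * (r (n ∸ j) * (A ⊙ (B ⊙ v)) i - e * s (n ∸ j) * (A ⊙ v) i)
          - e * s j * (r (n ∸ j) * (B ⊙ v) i - e * s (n ∸ j) * v i) ∎))
        where
        P : Mat N
        P = Alt.Wp (hist n ((m ∸ j) ∸ 1))

        P-⊙ : ∀ v i → (P ⊙ v) i ≈ r (n ∸ j) * (B ⊙ v) i - e * s (n ∸ j) * v i
        P-⊙ v i = trans (reflexive (≡.cong (λ k → (Alt.Wp (hist n (k ∸ 1)) ⊙ v) i) (ℕₚ.+-∸-assoc 1 j≤n)))
          (Wp-⊙ (hist-eval (n ∸ j) (ℕₚ.m∸n≤m n j)) v i)

      GG-formula : Vect N → Fin N → ℕ → Carrier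
      GG-formula v i j = pow β j * (r j * (r (m ∸ j) * v i - e * s (m ∸ j) * (X ⊙ v) i)
                                    - e * s j * (r (m ∸ j) * (Z ⊙ v) i - e * s (m ∸ j) * (Z ⊙ (X ⊙ v)) i))

      G-term : ∀ v i j → j < n → (GG m (hist n) (suc j) ⊙ v) i ≈ GG-formula v i (suc j)
      G-term v i j j<n = trans (·M-⊙ (pow β (suc j)) (P ⊗ Q) v i) (*-congˡ (begin
        ((P ⊗ Q) ⊙ v) i
          ≈⟨ ⊗-⊙ P Q v i ⟩
        (P ⊙ (Q ⊙ v)) i
          ≈⟨ G-⊙ (hist-eval (suc j) j<n) (Q ⊙ v) i ⟩
        r (suc j) * (Q ⊙ v) i - e * s (suc j) * (Z ⊙ (Q ⊙ v)) i
          ≈⟨ +-cong (*-congˡ (Q-⊙ i))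
                    (-‿cong (*-congˡ (T-difference Z (r (n ∸ j)) (e * s (n ∸ j)) Q-⊙ i))) ⟩
        r (suc j) * (r (n ∸ j) * v i - e * s (n ∸ j) * (X ⊙ v) i)
          - e * s (suc j) * (r (n ∸ j) * (Z ⊙ v) i - e * s (n ∸ j) * (Z ⊙ (X ⊙ v)) i) ∎))
        where
        P Q : Mat N
        P = Alt.G (hist n (suc j))
        Q = Alt.Gt (hist n (n ∸ j))

        Q-⊙ : ∀ i → (Q ⊙ v) i ≈ r (n ∸ j) * v i - e * s (n ∸ j) * (X ⊙ v) i
        Q-⊙ i = Gt-⊙ (hist-eval (n ∸ j) (ℕₚ.m∸n≤m n j)) v i

      sumWW-value : ∀ v i → (sumWW n (hist n) m m ⊙ v) i ≈
        C n * (A ⊙ (B ⊙ v)) i - q * ξ * rPrev C n * (A ⊙ v) i - ξ * p * rPrev C n * (B ⊙ v) i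
          + ξ * ξ * rPrev (rPrev C) n * v i
      sumWW-value v i = trans (sumWW-⊙ n (hist n) m m v i)
        (trans (sumℕ-cong-< m (λ j j<m → W-term v i j (ℕₚ.≤-pred j<m)))
          (convolution′ n _ _ _ _))

      g gt : Vect N → Fin N → Carrier
      g  v i = r m * v i - e * r n * (Z ⊙ v) i
      gt v i = r m * v i - e * r n * (X ⊙ v) i

      -- The terms of index 0 and m, absent from the recursion, complete the convolution.
      sumGG-value : ∀ v i → (sumGG n (hist n) m m ⊙ v) i ≈
        C m * v i - q * ξ * C n * (X ⊙ v) i - ξ * p * C n * (Z ⊙ v) i + ξ * ξ * rPrev C n * (Z ⊙ (X ⊙ v)) i
          - gt v i - pow β m * g v i
      sumGG-value v i = begin
        (sumGG n (hist n) m m ⊙ v) i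
          ≈⟨ trans (sumGG-⊙ n (hist n) m m v i) (sumℕ-head n _) ⟩
        (GG m (hist n) 0 ⊙ v) i + sumℕ n (λ j → (GG m (hist n) (suc j) ⊙ v) i)
          ≈⟨ +-cong (0M-⊙ v i) (sumℕ-cong-< n (G-term v i)) ⟩
        0# + sumℕ n (λ j → GG-formula v i (suc j))
          ≈⟨ linear₄ (sumℕ-head n (GG-formula v i)) first last
               (convolution′ m (v i) ((X ⊙ v) i) ((Z ⊙ v) i) ((Z ⊙ (X ⊙ v)) i))
               (solve 7 (λ Σ Σ′ t₀ tₘ y z w →
                  :0 :+ Σ :- (w :- y :- z) :=
                  (:- :1) :* (Σ′ :- (t₀ :+ Σ)) :+ (:- :1) :* (t₀ :- y) :+ (:- :1) :* (tₘ :- z)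
                  :+ :1 :* (Σ′ :+ tₘ :- w))
                  refl (sumℕ n (λ j → GG-formula v i (suc j))) (sumℕ m (GG-formula v i)) (GG-formula v i 0)
                       (GG-formula v i m) (gt v i) (pow β m * g v i) _) ⟩
        C m * v i - q * ξ * C n * (X ⊙ v) i - ξ * p * C n * (Z ⊙ v) i + ξ * ξ * rPrev C n * (Z ⊙ (X ⊙ v)) i
          - gt v i - pow β m * g v i ∎
        where
        first : GG-formula v i 0 ≈ gt v i
        first = linear₁ r₀≈1 (solve 4 (λ r e x y →
          :1 :* (r :* x :- e :* :0 :* y) :- x := x :* (r :- :1))
          refl (r 0) e (gt v i) (r m * (Z ⊙ v) i - e * r n * (Z ⊙ (X ⊙ v)) i))

        last : GG-formula v i m ≈ pow β m * g v i
        last = trans (reflexive (≡.cong (λ k → pow β m * (r m * (r k * v i - e * s k * (X ⊙ v) i)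
                   - e * r n * (r k * (Z ⊙ v) i - e * s k * (Z ⊙ (X ⊙ v)) i))) (ℕₚ.n∸n≡0 n)))
          (linear₁ r₀≈1 (solve 9 (λ b r₀ rm rn e v x z zx →
            b :* (rm :* (r₀ :* v :- e :* :0 :* x) :- e :* rn :* (r₀ :* z :- e :* :0 :* zx)) :-
            b :* (rm :* v :- e :* rn :* z) := (b :* (rm :* v :- e :* rn :* z)) :* (r₀ :- :1))
            refl (pow β m) (r 0) (r m) (r n) e (v i) ((X ⊙ v) i) ((Z ⊙ v) i) ((Z ⊙ (X ⊙ v)) i)))

      commutator : ∀ v i → (comm (Alt.Wp (hist n n)) A ⊙ v) i ≈ r n * ((B ⊙ (A ⊙ v)) i - (A ⊙ (B ⊙ v)) i)
      commutator v i = trans (comm-⊙ W A v i) (trans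
        (+-cong (W-⊙ (A ⊙ v) i) (-‿cong (T-difference A (r n) (e * s n) (W-⊙ v) i)))
        (solve 6 (λ rn e s ba a ab →
          (rn :* ba :- e :* s :* a) :- (rn :* ab :- e :* s :* a) := rn :* (ba :- ab)) refl (r n) e (s n) _ _ _))
        where
        W : Mat N
        W = Alt.Wp (hist n n)

        W-⊙ = Wp-⊙ (hist-eval n ℕₚ.≤-refl)

      -- (1 - β)⁻¹ [W_m, A] = G_m - G̃_m for the proposed values of G_m and G̃_m
      scaled-commutator : ∀ v i → r n * ((B ⊙ (A ⊙ v)) i - (A ⊙ (B ⊙ v)) i) ≈ (1# - β) * (g v i - gt v i)
      scaled-commutator v i = linear₃ (XZ v i) 1-β≈ qp≈1 (solve 11 (λ q p ξ β rn rm ba ab x z v →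
        rn :* (ba :- ab) :- (:1 :- β) :* ((rm :* v :- q :* ξ :* rn :* z) :- (rm :* v :- q :* ξ :* rn :* x)) :=
        (:- rn) :* ((q :- p) :* ξ :* (x :- z) :- (ba :- ab))
        :+ (:- (q :* ξ :* rn :* (x :- z))) :* ((:1 :- β) :- p :* (q :- p))
        :+ (:- ((q :- p) :* ξ :* rn :* (x :- z))) :* (q :* p :- :1))
        refl q p ξ β (r n) (r m) ((B ⊙ (A ⊙ v)) i) ((A ⊙ (B ⊙ v)) i) ((X ⊙ v) i) ((Z ⊙ v) i) (v i))

      Gₘ : Mat N
      Gₘ = Alt.G (altElems b A B m)

      Gₘ-formula : ∀ v i → (Gₘ ⊙ v) i ≈
        ε ⁻¹ * ((sumWW n (hist n) m m ⊙ v) i - (sumGG n (hist n) m m ⊙ v) i)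
          + (ε * (1# - β)) ⁻¹ * (comm (Alt.Wp (hist n n)) A ⊙ v) i
      Gₘ-formula v i = trans (reflexive (≡.cong (λ M → (M ⊙ v) i) (G-suc n)))
        (trans (+M-⊙ ((ε ⁻¹) ·M D) (((ε * (1# - β)) ⁻¹) ·M K) v i)
        (+-cong (trans (·M-⊙ (ε ⁻¹) D v i) (*-congˡ (-M-⊙ (sumWW n (hist n) m m) (sumGG n (hist n) m m) v i)))
                (·M-⊙ ((ε * (1# - β)) ⁻¹) K v i)))
        where
        D K : Mat N
        D = sumWW n (hist n) m m -M sumGG n (hist n) m m
        K = comm (Alt.Wp (hist n n)) A

      -- The scalar operators reduce the difference of the completed convolutions to δ n. The
      -- boundary terms `gt` and β^m `g`, together with `g` - `gt` from the commutator, add up to (1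
      -- + β^m) `g`.
      ε-Gₘ : ∀ v i → ε * (Gₘ ⊙ v) i ≈ δ n * v i + ε * g v i
      ε-Gₘ v i = begin
        ε * (Gₘ ⊙ v) i
          ≈⟨ *-congˡ (trans (Gₘ-formula v i) (+-cong
               (*-congˡ (+-cong (sumWW-value v i) (-‿cong (sumGG-value v i))))
               (*-congˡ (trans (commutator v i) (scaled-commutator v i))))) ⟩
        ε * (ε ⁻¹ * (w - w′) + (ε * (1# - β)) ⁻¹ * ((1# - β) * (g v i - gt v i)))
          ≈⟨ linear₂ (⁻¹-inverse ε (1+βⁿ≉0 n)) (⁻¹-inverse _ (*-≉0 (1+βⁿ≉0 n) 1-β≉0))
               (solve 6 (λ ε ε′ β f w h →
                 ε :* (ε′ :* w :+ f :* ((:1 :- β) :* h)) :- (w :+ h) :=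
                 w :* (ε :* ε′ :- :1) :+ h :* (ε :* (:1 :- β) :* f :- :1))
                 refl ε (ε ⁻¹) β ((ε * (1# - β)) ⁻¹) (w - w′) (g v i - gt v i)) ⟩
        (w - w′) + (g v i - gt v i)
          ≈⟨ solve 5 (λ w w″ g gt bg → (w :- (w″ :- gt :- bg)) :+ (g :- gt) := (w :- w″) :+ (g :+ bg))
               refl w _ (g v i) (gt v i) (pow β m * g v i) ⟩
        (w - (C m * v i - q * ξ * C n * (X ⊙ v) i - ξ * p * C n * (Z ⊙ v) i
              + ξ * ξ * rPrev C n * (Z ⊙ (X ⊙ v)) i)) + (g v i + pow β m * g v i)
          ≈⟨ +-cong
               (linear₂ (AB-XZ v i) (ZX-AB v i) (solve 15 (λ q p ξ l Cm Cn C′ C″ v x z ab zx a b →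
                  (Cn :* ab :- q :* ξ :* C′ :* a :- ξ :* p :* C′ :* b :+ ξ :* ξ :* C″ :* v) :-
                  (Cm :* v :- q :* ξ :* Cn :* x :- ξ :* p :* Cn :* z :+ ξ :* ξ :* C′ :* zx) :-
                  ((:1 :+ ξ :* l) :* Cn :- ξ :* (ξ :+ l) :* C′ :+ ξ :* ξ :* C″ :- Cm) :* v :=
                  Cn :* (ξ :* p :* z :+ ξ :* q :* x :+ ab :- (:1 :+ ξ :* l) :* v)
                  :+ (:- (ξ :* C′)) :* (ξ :* zx :+ q :* a :+ p :* b :- (ξ :+ l) :* v))
                  refl q p ξ l (C m) (C n) (rPrev C n) (rPrev (rPrev C) n)
                  (v i) ((X ⊙ v) i) ((Z ⊙ v) i) ((A ⊙ (B ⊙ v)) i) ((Z ⊙ (X ⊙ v)) i) ((A ⊙ v) i) ((B ⊙ v) i)))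
               (solve 2 (λ g b → g :+ b :* g := (:1 :+ b) :* g) refl (g v i) (pow β m)) ⟩
        δ n * v i + ε * g v i ∎
        where
        w w′ : Carrier
        w  = C n * (A ⊙ (B ⊙ v)) i - q * ξ * rPrev C n * (A ⊙ v) i - ξ * p * rPrev C n * (B ⊙ v) i
             + ξ * ξ * rPrev (rPrev C) n * v i
        w′ = C m * v i - q * ξ * C n * (X ⊙ v) i - ξ * p * C n * (Z ⊙ v) i
             + ξ * ξ * rPrev C n * (Z ⊙ (X ⊙ v)) i - gt v i - pow β m * g v i

      -- Comparison with the given form of W_{-m} kills the scalar by which Gₘ deviates from g.
      δ′ : Carrier
      δ′ = ε ⁻¹ * δ n

      Gₘ-δ′ : ∀ v i → (Gₘ ⊙ v) i ≈ (δ′ + r m) * v i - e * r n * (Z ⊙ v) i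
      Gₘ-δ′ v i = *-cancelˡ (1+βⁿ≉0 n) (trans (ε-Gₘ v i) (linear₁ (⁻¹-inverse ε (1+βⁿ≉0 n))
        (solve 8 (λ ε ε′ δ rm rn e v z →
          δ :* v :+ ε :* (rm :* v :- e :* rn :* z) :- ε :* ((ε′ :* δ :+ rm) :* v :- e :* rn :* z) :=
          (:- (δ :* v)) :* (ε :* ε′ :- :1))
          refl ε (ε ⁻¹) (δ n) (r m) (r n) e (v i) ((Z ⊙ v) i))))

      -- W_(-m) is (b - 1)⁻¹ [A, G_m]_b. By `AZ` the proposed part of G_m already produces the value
      -- given for W_(-m), and the extra scalar adds δ′ A.
      δ′A≈0 : ∀ v i → δ′ * (A ⊙ v) i ≈ 0#
      δ′A≈0 v i = x*y≈0⇒y≈0 b-1≉0 (linear₄ W (AZ v i) qp≈1 (⁻¹-inverse _ b-1≉0)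
        (solve 11 (λ q p ξ b′ δ rm rn a v az za →
          let e = q :* ξ
              b = q :* q
              D = b :* ((δ :+ rm) :* a :- e :* rn :* az) :- ((δ :+ rm) :* a :- e :* rn :* za) in
          (b :- :1) :* (δ :* a) :- :0 :=
          (b :- :1) :* (b′ :* D :- (rm :* a :- e :* rn :* v))
          :+ (e :* rn :* q) :* (q :* az :- p :* za :- (q :- p) :* v)
          :+ (e :* rn :* (za :- v)) :* (q :* p :- :1)
          :+ (:- D) :* ((b :- :1) :* b′ :- :1))
          refl q p ξ ((b - 1#) ⁻¹) δ′ (r m) (r n) ((A ⊙ v) i) (v i) ((A ⊙ (Z ⊙ v)) i) ((Z ⊙ (A ⊙ v)) i)))
        where
        W : (b - 1#) ⁻¹ * (b * ((δ′ + r m) * (A ⊙ v) i - e * r n * (A ⊙ (Z ⊙ v)) i)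
                             - ((δ′ + r m) * (A ⊙ v) i - e * r n * (Z ⊙ (A ⊙ v)) i)) ≈
            r m * (A ⊙ v) i - e * r n * v i
        W = begin
          _ ≈⟨ *-congˡ (+-cong (*-congˡ (T-difference A (δ′ + r m) (e * r n) (Gₘ-δ′ v) i))
                               (-‿cong (Gₘ-δ′ (A ⊙ v) i))) ⟨
          (b - 1#) ⁻¹ * (b * (A ⊙ (Gₘ ⊙ v)) i - (Gₘ ⊙ (A ⊙ v)) i)
            ≈⟨ *-congˡ (commb-⊙ b A Gₘ v i) ⟨
          (b - 1#) ⁻¹ * (commb b A Gₘ ⊙ v) i
            ≈⟨ ·M-⊙ ((b - 1#) ⁻¹) (commb b A Gₘ) v i ⟨
          ((((b - 1#) ⁻¹) ·M commb b A Gₘ) ⊙ v) i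
            ≡⟨ ≡.cong (λ M → (M ⊙ v) i) (Wm-suc n) ⟨
          (Wneg b A B m ⊙ v) i
            ≈⟨ Wm-⊙ m v i ⟩
          r m * (A ⊙ v) i - e * r n * v i ∎

      -- A is cancelled without being inverted: `AZ` writes (q - p) v through AZv and ZAv, and δ′
      -- annihilates both.
      δ′≈0 : δ′ ≈ 0#
      δ′≈0 = x*y≈0⇒y≈0 q-p≉0 (linear₃ (AZ v i₀) (δ′A≈0 (Z ⊙ v) i₀) Zδ′A≈0
        (solve 5 (λ q p δ az za →
          (q :- p) :* δ :- :0 :=
          (:- δ) :* (q :* az :- p :* za :- (q :- p) :* :1) :+ q :* (δ :* az :- :0) :+ (:- p) :* (δ :* za :- :0))
          refl q p δ′ ((A ⊙ (Z ⊙ v)) i₀) ((Z ⊙ (A ⊙ v)) i₀)))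
        where
        v : Vect N
        v _ = 1#

        Zδ′A≈0 : δ′ * (Z ⊙ (A ⊙ v)) i₀ ≈ 0#
        Zδ′A≈0 = trans (sym (⊙-·V Z δ′ (A ⊙ v) i₀)) (⊙-zero Z (δ′A≈0 v) i₀)

      δ≈0 : δ n ≈ 0#
      δ≈0 = linear₂ (⁻¹-inverse ε (1+βⁿ≉0 n)) δ′≈0 (solve 3 (λ ε ε′ δ →
        δ :- :0 := (:- δ) :* (ε :* ε′ :- :1) :+ ε :* (ε′ :* δ :- :0)) refl ε (ε ⁻¹) (δ n))

      Gₘ-⊙ : ∀ v i → (Gₘ ⊙ v) i ≈ r m * v i - e * r n * (Z ⊙ v) i
      Gₘ-⊙ v i = trans (Gₘ-δ′ v i) (+-congʳ (*-congʳ (trans (+-congʳ δ′≈0) (+-identityˡ (r m)))))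

      evaluated : Evaluated m (altElems b A B m)
      evaluated = record { Wp-⊙ = wp ; G-⊙ = Gₘ-⊙ ; Gt-⊙ = gt-value }
        where
        wp : ∀ v i → (Alt.Wp (altElems b A B m) ⊙ v) i ≈ r m * (B ⊙ v) i - e * r n * v i
        wp v i = begin
          (Alt.Wp (altElems b A B m) ⊙ v) i
            ≡⟨ ≡.cong (λ M → (M ⊙ v) i) (Wp-suc n) ⟩
          ((((b - 1#) ⁻¹) ·M commb b Gₘ B) ⊙ v) i
            ≈⟨ trans (·M-⊙ ((b - 1#) ⁻¹) (commb b Gₘ B) v i) (*-congˡ (commb-⊙ b Gₘ B v i)) ⟩
          (b - 1#) ⁻¹ * (b * (Gₘ ⊙ (B ⊙ v)) i - (B ⊙ (Gₘ ⊙ v)) i)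
            ≈⟨ *-congˡ (+-cong (*-congˡ (Gₘ-⊙ (B ⊙ v) i))
                               (-‿cong (T-difference B (r m) (e * r n) (Gₘ-⊙ v) i))) ⟩
          (b - 1#) ⁻¹ * (b * (r m * (B ⊙ v) i - e * r n * (Z ⊙ (B ⊙ v)) i)
                           - (r m * (B ⊙ v) i - e * r n * (B ⊙ (Z ⊙ v)) i))
            ≈⟨ linear₃ (ZB v i) qp≈1 (⁻¹-inverse _ b-1≉0)
                 (solve 10 (λ q p ξ b′ rm rn x v zb bz →
                   let e = q :* ξ
                       b = q :* q in
                   b′ :* (b :* (rm :* x :- e :* rn :* zb) :- (rm :* x :- e :* rn :* bz)) :-
                   (rm :* x :- e :* rn :* v) :=
                   (:- (b′ :* e :* rn :* q)) :* (q :* zb :- p :* bz :- (q :- p) :* v)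
                   :+ (b′ :* e :* rn :* (v :- bz)) :* (q :* p :- :1)
                   :+ (rm :* x :- e :* rn :* v) :* ((b :- :1) :* b′ :- :1))
                   refl q p ξ ((b - 1#) ⁻¹) (r m) (r n) ((B ⊙ v) i) (v i) ((Z ⊙ (B ⊙ v)) i) ((B ⊙ (Z ⊙ v)) i)) ⟩
          r m * (B ⊙ v) i - e * r n * v i ∎

        gt-value : ∀ v i → (Alt.Gt (altElems b A B m) ⊙ v) i ≈ gt v i
        gt-value v i = begin
          (Alt.Gt (altElems b A B m) ⊙ v) i
            ≡⟨ ≡.cong (λ M → (M ⊙ v) i) (Gt-suc n) ⟩
          ((Gₘ +M (((1# - β) ⁻¹) ·M comm A W)) ⊙ v) i
            ≈⟨ trans (+M-⊙ Gₘ (((1# - β) ⁻¹) ·M comm A W) v i) (+-cong (Gₘ-⊙ v i)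
                 (trans (·M-⊙ ((1# - β) ⁻¹) (comm A W) v i) (*-congˡ (trans (comm-⊙ A W v i) reversed)))) ⟩
          g v i + (1# - β) ⁻¹ * (- ((1# - β) * (g v i - gt v i)))
            ≈⟨ linear₁ (⁻¹-inverse _ 1-β≉0) (solve 4 (λ k k′ g h →
                 g :+ k′ :* (:- (k :* (g :- h))) :- h := (:- (g :- h)) :* (k :* k′ :- :1))
                 refl (1# - β) ((1# - β) ⁻¹) (g v i) (gt v i)) ⟩
          gt v i ∎
          where
          W : Mat N
          W = Alt.Wp (hist n n)

          reversed : (A ⊙ (W ⊙ v)) i - (W ⊙ (A ⊙ v)) i ≈ - ((1# - β) * (g v i - gt v i))
          reversed = trans (solve 2 (λ x y → x :- y := :- (y :- x)) refl _ _)
            (-‿cong (trans (sym (comm-⊙ W A v i)) (trans (commutator v i) (scaled-commutator v i))))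

    evaluated-≤ : ∀ n k → k ≤ n → Evaluated k (altElems b A B k)
    evaluated-≤ zero    zero z≤n = evaluated-0
    evaluated-≤ (suc n) k k≤1+n with ℕₚ.m≤n⇒m<n∨m≡n k≤1+n
    ... | inj₁ k<1+n  = evaluated-≤ n k (ℕₚ.≤-pred k<1+n)
    ... | inj₂ ≡.refl = Step.evaluated n (evaluated-≤ n)

    recurrence : ∀ n → δ n ≈ 0#
    recurrence n = Step.δ≈0 n (evaluated-≤ n)

  -- Powers of q and the coefficients of the exponent

  module Generic {q : Carrier} (q-generic : NotRootOfUnity q) where

    p β : Carrier
    p = q ⁻¹
    β = (q * q) ⁻¹

    q≉0 : ¬ (q ≈ 0#)
    q≉0 = proj₁ q-generic

    qp≈1 : q * p ≈ 1#
    qp≈1 = ⁻¹-inverse q q≉0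

    pq≈1 : p * q ≈ 1#
    pq≈1 = ⁻¹-inverseˡ q≉0

    pow-q≉1 : ∀ n → ¬ (pow q (suc n) ≈ 1#)
    pow-q≉1 = proj₂ q-generic

    q-p≉0 : ¬ (q - p ≈ 0#)
    q-p≉0 q-p≈0 = pow-q≉1 1 (linear₂ q-p≈0 qp≈1 (solve 2 (λ q p →
      q :* (q :* :1) :- :1 := q :* (q :- p :- :0) :+ :1 :* (q :* p :- :1)) refl q p))

    pow-q≉0 : ∀ n → ¬ (pow q n ≈ 0#)
    pow-q≉0 n = x*y≈1⇒x≉0 (pow-inverse n qp≈1)

    pow-q² : ∀ n → pow (q * q) n ≈ pow q (n ℕ.* 2)
    pow-q² n = trans (pow-cong n (*-congˡ (sym (*-identityʳ q)))) (sym (pow-* q n 2))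

    q²≉0 : ¬ (q * q ≈ 0#)
    q²≉0 = *-≉0 q≉0 q≉0

    -- If 1 + β^k = 0, then q^(2k) = -1 and q^(4k) = 1, so q would be a root of unity.
    1+βⁿ≉0 : ∀ n → ¬ (1# + pow β (suc n) ≈ 0#)
    1+βⁿ≉0 n 1+βᵏ≈0 = pow-q≉1 (suc ((n ℕ.+ k) ℕ.* 2)) (trans (sym (pow-q² (k ℕ.+ k))) (trans (pow-+ (q * q) k k)
      (linear₂ 1+βᵏ≈0 (pow-inverse k (⁻¹-inverse _ q²≉0)) (solve 2 (λ y b →
        y :* y :- :1 := ((y :- :1) :* y) :* (:1 :+ b :- :0) :+ (:- (y :- :1)) :* (y :* b :- :1))
        refl (pow (q * q) k) (pow β k)))))
      where k = suc n

    βq≈p : β * q ≈ p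
    βq≈p = linear₂ (⁻¹-inverse _ q²≉0) qp≈1 (solve 3 (λ q p b →
      b :* q :- p := p :* (q :* q :* b :- :1) :+ (:- (b :* q)) :* (q :* p :- :1)) refl q p β)

    βⁿqⁿ≈pⁿ : ∀ n → pow β n * pow q n ≈ pow p n
    βⁿqⁿ≈pⁿ n = trans (sym (pow-distrib-* β q n)) (pow-cong n βq≈p)

    qⁿ+pⁿ≉0 : ∀ n → ¬ (pow q (suc n) + pow p (suc n) ≈ 0#)
    qⁿ+pⁿ≉0 n sum≈0 = *-≉0 (pow-q≉0 (suc n)) (1+βⁿ≉0 n) (linear₂ sum≈0 (βⁿqⁿ≈pⁿ (suc n)) (solve 3 (λ Q P B →
      Q :* (:1 :+ B) :- :0 := :1 :* (Q :+ P :- :0) :+ :1 :* (B :* Q :- P)) refl _ _ (pow β (suc n))))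

    module Exponents (d : ℕ) where
      s t : Carrier
      s = pow q d
      t = pow p d

      st≈1 : s * t ≈ 1#
      st≈1 = pow-inverse d qp≈1

      q²s²≉1 : ¬ (q * q * (s * s) - 1# ≈ 0#)
      q²s²≉1 eq = pow-q≉1 (d ℕ.+ suc d) (trans (pow-+ q (suc d) (suc d)) (linear₁ eq (solve 2 (λ q s →
        q :* s :* (q :* s) :- :1 := :1 :* (q :* q :* (s :* s) :- :1 :- :0)) refl q s)))

      -- ϑ n = q^(2n-d) and σ n = q^(d-2n)
      ϑ σ : ℕ → Carrier
      ϑ n = pow (q * q) n * t
      σ n = pow (p * p) n * s

      ϑ-suc : ∀ n → ϑ (suc n) ≈ q * q * ϑ n
      ϑ-suc n = *-assoc (q * q) (pow (q * q) n) t

      σ-suc : ∀ n → σ (suc n) ≈ p * p * σ n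
      σ-suc n = *-assoc (p * p) (pow (p * p) n) s

      q²p²≈1 : q * q * (p * p) ≈ 1#
      q²p²≈1 = linear₁ qp≈1 (solve 2 (λ q p →
        q :* q :* (p :* p) :- :1 := (q :* p :+ :1) :* (q :* p :- :1)) refl q p)

      ϑσ≈1 : ∀ n → ϑ n * σ n ≈ 1#
      ϑσ≈1 n = linear₂ (pow-inverse n q²p²≈1) st≈1 (solve 4 (λ x y s t →
        x :* t :* (y :* s) :- :1 := (s :* t) :* (x :* y :- :1) :+ :1 :* (s :* t :- :1))
        refl (pow (q * q) n) (pow (p * p) n) s t)

      σϑ≈1 : ∀ n → σ n * ϑ n ≈ 1#
      σϑ≈1 n = trans (*-comm (σ n) (ϑ n)) (ϑσ≈1 n)

      pow-2* : ∀ x n → pow x (2 ℕ.* n) ≈ pow (x * x) n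
      pow-2* x n = trans (reflexive (≡.cong (pow x) (ℕₚ.*-comm 2 n)))
        (trans (pow-* x n 2) (pow-cong n (*-congˡ (*-identityʳ x))))

      zpow-ϑ : ∀ n → zpow q ((2 ℕ.* n) ⊖ d) ≈ ϑ n
      zpow-ϑ n = trans (zpow-⊖ q≉0 (2 ℕ.* n) d) (*-congʳ (pow-2* q n))

      zpow-σ : ∀ n → zpow q (d ⊖ (2 ℕ.* n)) ≈ σ n
      zpow-σ n = trans (zpow-⊖ q≉0 d (2 ℕ.* n)) (trans (*-congˡ (pow-2* p n)) (*-comm _ _))

      -- 2n - d = d - 2m when m + n = d; this is how reversing the orderings exchanges the two
      -- sequences.
      ϑ≈σ : ∀ m n → m ℕ.+ n ≡ d → ϑ n ≈ σ m
      ϑ≈σ m n ≡.refl = trans (*-cong (pow-distrib-* q q n) (pow-+ p m n)) (trans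
        (linear₂ (pow-inverse n qp≈1) (pow-inverse m qp≈1) (solve 4 (λ a a′ c c′ →
          a :* a :* (c′ :* a′) :- c′ :* c′ :* (c :* a) :=
          (a :* c′) :* (a :* a′ :- :1) :+ (:- (a :* c′)) :* (c :* c′ :- :1))
          refl (pow q n) (pow p n) (pow q m) (pow p m)))
        (sym (*-cong (pow-distrib-* p p m) (pow-+ q m n))))

      module _ (ξ : Carrier) where

        α γ : Carrier
        α = ξ * (q * s)
        γ = ξ * (p * t)

        -- (1 + β^k) q^k = q^k + q^(-k) removes the denominator, and the Euler derivation removes
        -- 1/k. What remains is the sum of the k-th powers of 1, ξ q^(d+1) and ξ q^(-d-1).
        expoSeries-powerSums : CharZero → ∀ n → (1# + pow β n) * euler (expoSeries q d ξ) n ≈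
                               geometric 1# n + geometric α n + geometric γ n
        expoSeries-powerSums _ zero = solve 1 (λ b → (:1 :+ b) :* (:0 :* :0) := :0 :+ :0 :+ :0) refl (pow β 0)
        expoSeries-powerSums charZero (suc n) = trans
          (linear₃ (βⁿqⁿ≈pⁿ k) (⁻¹-inverse _ (qⁿ+pⁿ≉0 n)) (⁻¹-inverse _ (charZero n))
            (solve 7 (λ B Q P D F F′ Σ →
              (:1 :+ B) :* (F :* (Σ :* D :* (Q :* F′))) :- Σ :=
              (Σ :* D :* (F :* F′)) :* (B :* Q :- P) :+ (Σ :* (F :* F′)) :* ((Q :+ P) :* D :- :1)
              :+ Σ :* (F :* F′ :- :1))
              refl (pow β k) (pow q k) (pow p k) ((pow q k + pow p k) ⁻¹) (fromℕ k) ((fromℕ k) ⁻¹)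
              ((1# + (pow q (k ℕ.* suc d) * pow ξ k)) + (pow p (k ℕ.* suc d) * pow ξ k))))
          (+-cong (+-cong (sym (pow-1# k)) (root q)) (root p))
          where
          k = suc n

          root : ∀ x → pow x (k ℕ.* suc d) * pow ξ k ≈ pow (ξ * (x * pow x d)) k
          root x = trans (*-congʳ (pow-* x k (suc d)))
            (trans (*-comm _ _) (sym (pow-distrib-* ξ (x * pow x d) k)))

        rPrev-factor : ∀ a f n → rPrev (factor a f) n ≈ rPrev f n - a * rPrev (rPrev f) n
        rPrev-factor a f zero    = solve 1 (λ a → :0 := :0 :- a :* :0) refl a
        rPrev-factor a f (suc n) = refl

        -- α + γ = ξ l and, by q p = s t = 1, α γ = ξ². So the three factors multiply to the cubic
        -- whose coefficients appear in the recurrence.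
        factors-vanish : ∀ (C : PowerSeries) n → let l = q * s + p * t in
          (1# + ξ * l) * C n - ξ * (ξ + l) * rPrev C n + ξ * ξ * rPrev (rPrev C) n - C (suc n) ≈ 0# →
          factor 1# (factor α (factor γ C)) (suc n) ≈ 0#
        factors-vanish C n eq = linear₄ eq (rPrev-factor γ C n) qp≈1 st≈1
          (solve 10 (λ q p s t ξ C₁ C₀ C′ C″ f →
            let l = q :* s :+ p :* t
                α = ξ :* (q :* s)
                γ = ξ :* (p :* t) in
            (C₁ :- γ :* C₀) :- α :* (C₀ :- γ :* C′) :- :1 :* ((C₀ :- γ :* C′) :- α :* f) :- :0 :=
            (:- :1) :* ((:1 :+ ξ :* l) :* C₀ :- ξ :* (ξ :+ l) :* C′ :+ ξ :* ξ :* C″ :- C₁ :- :0)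
            :+ α :* (f :- (C′ :- γ :* C″))
            :+ (ξ :* ξ :* (C′ :- C″) :* (s :* t)) :* (q :* p :- :1)
            :+ (ξ :* ξ :* (C′ :- C″)) :* (s :* t :- :1))
            refl q p s t ξ (C (suc n)) (C n) (rPrev C n) (rPrev (rPrev C) n) (rPrev (factor γ C) n))

  -- Tridiagonal systems

  module TDSystem {q : Carrier} (q-generic : NotRootOfUnity q)
    {d N : ℕ} {A : Mat N} {E : Fin (suc d) → Mat N} {As : Mat N} {Es : Fin (suc d) → Mat N}
    (system : IsTDSystem A E As Es (λ i → zpow q ((2 ℕ.* toℕ i) ⊖ d)) (λ i → zpow q (d ⊖ (2 ℕ.* toℕ i))) (c ⊔ ℓ))
    (dimE : ∀ i → ImageDimOne (E i)) (dimEs : ∀ i → ImageDimOne (Es i))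
    where
    open Generic q-generic
    open Exponents d
    open IsTDSystem system

    module EA  = IdempotentProperties primA
    module EAs = IdempotentProperties primAs

    bound : ∀ (j : Fin (suc d)) → toℕ j ≤ d
    bound j = Finₚ.toℕ≤pred[n] j

    top : Fin (suc d)
    top = Fin.fromℕ d

    below-top : ∀ j → ¬ (toℕ j < d) → j ≡ top
    below-top j j≮d = Finₚ.toℕ-injective (≡.trans (ℕₚ.≤-antisym (bound j) (ℕₚ.≮⇒≥ j≮d)) (≡.sym (Finₚ.toℕ-fromℕ d)))

    module S = SplitDecomposition system toℕ bound (λ j k → inj₁) ϑ (λ j → zpow-ϑ (toℕ j))
      (λ j n j+n≡d → trans (zpow-σ (toℕ j)) (sym (ϑ≈σ (toℕ j) n j+n≡d)))

    -- Reversal interchanges ϑ and σ, so the relations for x₂₃ are obtained here with p and q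
    -- exchanged.
    module R = SplitDecomposition system (λ j → d ∸ toℕ j) (λ j → ℕₚ.m∸n≤m d (toℕ j))
      (λ j k lt → inj₂ (reflect-far (bound j) lt)) σ
      (λ j → trans (zpow-ϑ (toℕ j)) (ϑ≈σ (d ∸ toℕ j) (toℕ j) (ℕₚ.m∸n+n≡m (bound j))))
      (λ j n eq → trans (zpow-σ (toℕ j)) (reflexive (≡.cong σ
        (ℕₚ.+-cancelˡ-≡ (d ∸ toℕ j) (toℕ j) n (≡.trans (ℕₚ.m∸n+n≡m (bound j)) (≡.sym eq))))))

    Es-image : ∀ k → let v = proj₁ (dimEs k) in ∀ j → ¬ (j ≡ k) → (Es j ⊙ v) ≈V 0V
    Es-image k j j≢k i with dimEs k
    ... | v , _ , (u , Eu≈v) , _ = trans (sym (⊙-cong (Es j) Eu≈v i)) (EAs.E-orth j k j≢k u i)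

    v₀ : Vect N
    v₀ = proj₁ (dimEs top)

    v₀≢0 : NonzeroV v₀
    v₀≢0 = proj₁ (proj₂ (dimEs top))

    v₀∈U₀ : S.U 0 v₀
    v₀∈U₀ = lift ((λ j ()) , λ j j<d → Es-image top j λ { ≡.refl →
      ℕₚ.<-irrefl ≡.refl (≡.subst (_< d) (≡.trans (ℕₚ.+-identityʳ (toℕ top)) (Finₚ.toℕ-fromℕ d)) j<d) })

    -- In U 0 only the component under E*_d survives, and it lies on a line. This provides the
    -- coefficient φ₁ of B u₁.
    U₀-line : ∀ w → S.U 0 w → ∃ λ a → w ≈V (a ·V v₀)
    U₀-line w (lift (_ , high)) with dimEs top
    ... | v , _ , _ , line with line w
    ...   | a , Ew≈av = a , λ i → trans (sym (IM-⊙ w i)) (trans (EAs.agree IM (Es top) w onImage i) (Ew≈av i))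
      where
      onImage : ∀ k → (IM ⊙ (Es k ⊙ w)) ≈V (Es top ⊙ (Es k ⊙ w))
      onImage k i with toℕ k ℕₚ.<? d
      ... | yes k<d = trans (IM-⊙ _ i) (trans (Ekw≈0 i) (sym (⊙-zero (Es top) Ekw≈0 i)))
        where Ekw≈0 = high k (≡.subst (_< d) (≡.sym (ℕₚ.+-identityʳ (toℕ k))) k<d)
      ... | no  k≮d with below-top k k≮d
      ...   | ≡.refl = trans (IM-⊙ _ i) (sym (EAs.E-idem top w i))

    v₀′ : Vect N
    v₀′ = proj₁ (dimEs fzero)

    v₀′∈U₀ : R.U 0 v₀′
    v₀′∈U₀ = lift ((λ j ()) , λ j lt → Es-image fzero j λ { ≡.refl →
      ℕₚ.<-irrefl (ℕₚ.+-identityʳ d) lt })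

    u : ℕ → Vect N
    u zero    = v₀
    u (suc n) = (A ⊙ u n) +V ((- ϑ n) ·V u n)

    u∈U : ∀ n → S.U n (u n)
    u∈U zero    = v₀∈U₀
    u∈U (suc n) = S.raise n (u n) (u∈U n)

    Eₜ-u-suc : ∀ n i → (E top ⊙ u (suc n)) i ≈ (ϑ d - ϑ n) * (E top ⊙ u n) i
    Eₜ-u-suc n i = begin
      (E top ⊙ u (suc n)) i
        ≈⟨ trans (⊙-+V (E top) (A ⊙ u n) ((- ϑ n) ·V u n) i)
             (+-cong (EA.E-A top (u n) i) (⊙-·V (E top) (- ϑ n) (u n) i)) ⟩
      zpow q ((2 ℕ.* toℕ top) ⊖ d) * (E top ⊙ u n) i + (- ϑ n) * (E top ⊙ u n) i
        ≈⟨ +-congʳ (*-congʳ (trans (zpow-ϑ (toℕ top)) (reflexive (≡.cong ϑ (Finₚ.toℕ-fromℕ d))))) ⟩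
      ϑ d * (E top ⊙ u n) i + (- ϑ n) * (E top ⊙ u n) i
        ≈⟨ solve 3 (λ a b x → a :* x :+ (:- b) :* x := (a :- b) :* x) refl (ϑ d) (ϑ n) _ ⟩
      (ϑ d - ϑ n) * (E top ⊙ u n) i ∎

    ϑ-distinct : ∀ n → n < d → ¬ (ϑ d - ϑ n ≈ 0#)
    ϑ-distinct n n<d eq = ArePrimitiveIdempotents.distinct primA top j top≢j
      (trans (zpow-ϑ (toℕ top)) (trans (reflexive (≡.cong ϑ (Finₚ.toℕ-fromℕ d)))
        (trans (x-y≈0⇒x≈y _ _ eq) (sym (trans (zpow-ϑ (toℕ j)) (reflexive (≡.cong ϑ toℕ-j)))))))
      where
      n<1+d : n < suc d
      n<1+d = ℕₚ.m<n⇒m<1+n n<d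

      j : Fin (suc d)
      j = fromℕ< n<1+d

      toℕ-j : toℕ j ≡ n
      toℕ-j = Finₚ.toℕ-fromℕ< n<1+d

      top≢j : ¬ (top ≡ j)
      top≢j top≡j = ℕₚ.<-irrefl (≡.trans (≡.sym toℕ-j) (≡.trans (≡.cong toℕ (≡.sym top≡j)) (Finₚ.toℕ-fromℕ d))) n<d

    -- Going down the chain, E_d u_d = 0 forces E_d u_0 = 0.
    Eₜ-u-vanish : u d ≈V 0V → ∀ n → (E top ⊙ u n) ≈V 0V
    Eₜ-u-vanish ud≈0 = up
      where
      down : ∀ k n → k ℕ.+ n ≡ d → (E top ⊙ u n) ≈V 0V
      down zero    n ≡.refl i = ⊙-zero (E top) ud≈0 i
      down (suc k) n eq     i = x*y≈0⇒y≈0 (ϑ-distinct n (ℕₚ.≤-trans (s≤s (ℕₚ.m≤n+m n k)) (ℕₚ.≤-reflexive eq)))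
        (trans (sym (Eₜ-u-suc n i)) (down k (suc n) (≡.trans (ℕₚ.+-suc k n) eq) i))

      up : ∀ n → (E top ⊙ u n) ≈V 0V
      up zero    = down d 0 (ℕₚ.+-identityʳ d)
      up (suc n) i = trans (Eₜ-u-suc n i) (trans (*-congˡ (up n i)) (zeroʳ _))

    module Main
      {x01 : Mat N}
      (x01-act : ∀ (i : Fin (suc d)) v →
         InSum Es (λ j → (d ∸ toℕ i) ≤ᵇ toℕ j) v → InSum E (λ j → toℕ i ≤ᵇ toℕ j) v →
         (x01 ⊙ v) ≈V (zpow q (d ⊖ (2 ℕ.* toℕ i)) ·V v))
      {x23 : Mat N}
      (x23-act : ∀ (i : Fin (suc d)) v →
         InSum Es (λ j → toℕ j ≤ᵇ toℕ i) v → InSum E (λ j → toℕ j ≤ᵇ (d ∸ toℕ i)) v →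
         (x23 ⊙ v) ≈V (zpow q ((2 ℕ.* toℕ i) ⊖ d) ·V v))
      {ξ : Carrier}
      (x01-x23 : (ξ ·M (x01 -M x23)) ≈M (((q - q ⁻¹) ⁻¹) ·M comm As A))
      where

      -- Bridges the `Fin` indices of the hypotheses and the natural indices of the split spaces.
      at-index : ∀ {P : ℕ → Set (c ⊔ ℓ)} → (∀ (i : Fin (suc d)) → P (toℕ i)) → ∀ n → n ≤ d → P n
      at-index {P} all n n≤d = ≡.subst P (Finₚ.toℕ-fromℕ< (s≤s n≤d)) (all (fromℕ< (s≤s n≤d)))

      x01-U : ∀ n → n ≤ d → ∀ v → S.U n v → (x01 ⊙ v) ≈V (σ n ·V v)
      x01-U = at-index λ i v (lift (low , high)) k → trans
        (x01-act i v
          (inSum Es _ v (EAs.resolve v) (λ j eq → high j (ℕₚ.m≤o∸n⇒m+n≤o (suc (toℕ j)) (bound i) (≤ᵇ-false eq))))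
          (inSum E _ v (EA.resolve v) (λ j eq → low j (≤ᵇ-false eq))) k)
        (*-congʳ (zpow-σ (toℕ i)))

      x23-U : ∀ n → n ≤ d → ∀ v → R.U n v → (x23 ⊙ v) ≈V (ϑ n ·V v)
      x23-U = at-index λ i v (lift (low , high)) k → trans
        (x23-act i v
          (inSum Es _ v (EAs.resolve v) (λ j eq → high j (≡.subst (d ∸ toℕ j ℕ.+ toℕ i <_)
            (ℕₚ.m∸n+n≡m (bound j)) (ℕₚ.+-monoʳ-< (d ∸ toℕ j) (≤ᵇ-false eq)))))
          (inSum E _ v (EA.resolve v) (λ j eq → low j (ℕₚ.≰⇒> λ i≤d∸j → ℕₚ.<⇒≱ (≤ᵇ-false eq)
            (ℕₚ.m+n≤o⇒m≤o∸n (toℕ j) (≡.subst (_≤ d) (ℕₚ.+-comm (toℕ i) (toℕ j))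
              (ℕₚ.m≤o∸n⇒m+n≤o (toℕ i) (bound j) i≤d∸j)))))) k)
        (*-congʳ (zpow-ϑ (toℕ i)))

      XZ : ∀ v i → (q - p) * ξ * ((x01 ⊙ v) i - (x23 ⊙ v) i) ≈ (As ⊙ (A ⊙ v)) i - (A ⊙ (As ⊙ v)) i
      XZ v i = linear₂ acted (⁻¹-inverse _ q-p≉0) (solve 5 (λ k k′ ξ x y →
        k :* ξ :* x :- y := k :* (ξ :* x :- k′ :* y) :+ y :* (k :* k′ :- :1))
        refl (q - p) ((q - p) ⁻¹) ξ _ _)
        where
        acted : ξ * ((x01 ⊙ v) i - (x23 ⊙ v) i) ≈
                (q - p) ⁻¹ * ((As ⊙ (A ⊙ v)) i - (A ⊙ (As ⊙ v)) i)
        acted = begin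
          ξ * ((x01 ⊙ v) i - (x23 ⊙ v) i)          ≈⟨ *-congˡ (-M-⊙ x01 x23 v i) ⟨
          ξ * ((x01 -M x23) ⊙ v) i                 ≈⟨ ·M-⊙ ξ (x01 -M x23) v i ⟨
          ((ξ ·M (x01 -M x23)) ⊙ v) i              ≈⟨ ⊙-congᴹ x01-x23 v i ⟩
          ((((q - p) ⁻¹) ·M comm As A) ⊙ v) i      ≈⟨ ·M-⊙ ((q - p) ⁻¹) (comm As A) v i ⟩
          (q - p) ⁻¹ * (comm As A ⊙ v) i           ≈⟨ *-congˡ (comm-⊙ As A v i) ⟩
          (q - p) ⁻¹ * ((As ⊙ (A ⊙ v)) i - (A ⊙ (As ⊙ v)) i) ∎

      flip-q : ∀ {x y z} → p * x - q * y ≈ (p - q) * z → q * y - p * x ≈ (q - p) * z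
      flip-q {x} {y} {z} eq = linear₁ eq (solve 5 (λ q p x y z →
        (q :* y :- p :* x) :- (q :- p) :* z := (:- :1) :* ((p :* x :- q :* y) :- (p :- q) :* z))
        refl q p x y z)

      AZ : ∀ v i → q * (A ⊙ (x23 ⊙ v)) i - p * (x23 ⊙ (A ⊙ v)) i ≈ (q - p) * v i
      AZ v i = flip-q (R.XA-relation pq≈1 ϑ ϑσ≈1 ϑ-suc x23 x23-U v₀′∈U₀ (proj₁ (proj₂ (dimEs fzero))) v i)

      ZB : ∀ v i → q * (x23 ⊙ (As ⊙ v)) i - p * (As ⊙ (x23 ⊙ v)) i ≈ (q - p) * v i
      ZB v i = flip-q (R.AsX-relation pq≈1 ϑ ϑσ≈1 ϑ-suc x23 x23-U v₀′∈U₀ (proj₁ (proj₂ (dimEs fzero))) v i)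

      module Rel = EquitableRelations {A = A} {As} {x01} {x23} {q} {p} {ξ} qp≈1 q-p≉0 irred
        (S.XA-relation qp≈1 σ σϑ≈1 σ-suc x01 x01-U v₀∈U₀ v₀≢0)
        (S.AsX-relation qp≈1 σ σϑ≈1 σ-suc x01 x01-U v₀∈U₀ v₀≢0)
        AZ ZB XZ

      φ₁ : ∃ λ a → ((As ⊙ u 1) +V ((- ϑ 1) ·V u 1)) ≈V (a ·V v₀)
      φ₁ = U₀-line _ (S.lower-suc 0 (u 1) (u∈U 1))

      As-v₀ : (As ⊙ v₀) ≈V (t ·V v₀)
      As-v₀ i = linear₁ (S.lower-0 v₀ v₀∈U₀ i) (solve 3 (λ x t y →
        x :- t :* y := :1 :* (x :+ (:- (:1 :* t)) :* y :- :0)) refl ((As ⊙ v₀) i) t (v₀ i))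

      As-u₁ : ∀ i → (As ⊙ u 1) i ≈ q * q * t * u 1 i + proj₁ φ₁ * u 0 i
      As-u₁ i = linear₁ (proj₂ φ₁ i) (solve 6 (λ q t φ x y z →
        x :- (q :* q :* t :* y :+ φ :* z) := :1 :* (x :+ (:- (q :* q :* :1 :* t)) :* y :- φ :* z))
        refl q t (proj₁ φ₁) ((As ⊙ u 1) i) (u 1 i) (v₀ i))

      ϑ-top : ϑ (suc d) ≈ q * q * s
      ϑ-top = trans (ϑ-suc d) (*-congˡ (trans (ϑ≈σ 0 d ≡.refl) (*-identityˡ s)))

      σ-top : σ (suc d) ≈ p * p * t
      σ-top = trans (σ-suc d) (*-congˡ (trans (sym (ϑ≈σ d 0 (ℕₚ.+-identityʳ d))) (*-identityˡ t)))

      module Eig = Rel.Eigenvalues d s t st≈1 q²s²≉1 ϑ σ (*-identityˡ t) (*-identityˡ s) ϑ-suc σ-suc ϑ-top σ-top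
        u (λ n i → +-congˡ (solve 2 (λ a x → (:- a) :* x := :- (a :* x)) refl (ϑ n) (u n i)))
        (λ n → S.act qp≈1 σ σϑ≈1 σ-suc x01 x01-U v₀∈U₀ v₀≢0 n (u n) (u∈U n))
        As-v₀ (proj₁ φ₁) As-u₁ v₀≢0

      -- Otherwise E_d would kill the whole chain, which spans V, although its image contains a
      -- nonzero vector.
      u-d≢0 : NonzeroV (u d)
      u-d≢0 ud≈0 with dimE top
      ... | v , v≢0 , (w , Ew≈v) , _ = v≢0 λ i → trans (sym (Ew≈v i)) (trans
        (span-agree (E top) 0M
          (λ { x (lift (n , u≈x)) i → trans (sym (⊙-cong (E top) u≈x i))
                 (trans (Eₜ-u-vanish ud≈0 n i) (sym (0M-⊙ x i))) })
          w (Eig.chain-spans w) i)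
        (0M-⊙ w i))

      u-top : u (suc d) ≈V 0V
      u-top = S.U-beyond (suc d) (u (suc d)) ℕₚ.≤-refl (u∈U (suc d))

      r-exp : CharZero → (r : ℕ → Carrier) → r 0 ≈ 1# →
              (∀ n → Wneg (q * q) A As n ≈M ((r n ·M A) -M ((q * ξ * rPrev r n) ·M IM))) →
              ∀ n → r n ≈ expPS (expoSeries q d ξ) n
      r-exp charZero r r₀≈1 W-r =
        expPS-unique charZero β 1# (α ξ) (γ ξ) 1+βⁿ≉0
          (expoSeries q d ξ) refl (expoSeries-powerSums ξ charZero) r r₀≈1
          (λ n → factors-vanish ξ (dilate β r *PS r) n
            -- The parameter l is q s + p t = q^(d+1) + q^(-d-1).
            (AlternatingElements.recurrence {A = A} {As} {x01} {x23} {q} {p} {ξ} {q * s + p * t}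
              (coordinate v₀≢0) qp≈1 q-p≉0 1+βⁿ≉0 AZ ZB XZ
              (Eig.AB-XZ u-d≢0 u-top) (Eig.ZX-AB u-d≢0 u-top) r r₀≈1 W-r n))

theorem10p15 : ∀ {c ℓ} (F : Field c ℓ) → let open Over F in
    CharZero →
    (q : Carrier) → NotRootOfUnity q →
    (d : ℕ) → 1 ≤ d →
    (N : ℕ) (A : Mat N) (E : Fin (suc d) → Mat N) (As : Mat N) (Es : Fin (suc d) → Mat N) →
    IsTDSystem A E As Es (λ i → zpow q ((2 ℕ.* toℕ i) ⊖ d)) (λ i → zpow q (d ⊖ (2 ℕ.* toℕ i))) (c ⊔ ℓ) →
    (∀ i → ImageDimOne (E i)) → (∀ i → ImageDimOne (Es i)) →
    (x01 : Mat N) →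
    (∀ (i : Fin (suc d)) v →
    InSum Es (λ j → (d ∸ toℕ i) ≤ᵇ toℕ j) v →
    InSum E (λ j → toℕ i ≤ᵇ toℕ j) v →
    (x01 ⊙ v) ≈V (zpow q (d ⊖ (2 ℕ.* toℕ i)) ·V v)) →
    (x23 : Mat N) →
    (∀ (i : Fin (suc d)) v →
    InSum Es (λ j → toℕ j ≤ᵇ toℕ i) v →
    InSum E (λ j → toℕ j ≤ᵇ (d ∸ toℕ i)) v →
    (x23 ⊙ v) ≈V (zpow q ((2 ℕ.* toℕ i) ⊖ d) ·V v)) →
    (ξ : Carrier) → ¬ (ξ ≈ 0#) →
    (ξ ·M (x01 -M x23)) ≈M (((q - q ⁻¹) ⁻¹) ·M comm As A) →
    ((ξ ⁻¹) ·M (A -M As)) ≈M (((q - q ⁻¹) ⁻¹) ·M comm x01 x23) →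
    (r : ℕ → Carrier) → r 0 ≈ 1# →
    (∀ n → Wneg (q * q) A As n ≈M
    ((r n ·M A) -M ((q * ξ * rPrev r n) ·M IM))) →
    ∀ n → r n ≈ expPS (expoSeries q d ξ) n
theorem10p15 F charZero q q-generic d _ N A E As Es system dimE dimEs
  x01 x01-act x23 x23-act ξ _ x01-x23 _ r r₀≈1 W-r =
  Proof.TDSystem.Main.r-exp F q-generic system dimE dimEs x01-act x23-act x01-x23 charZero r r₀≈1 W-r
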